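{- Let $n,r_1,\ldots,r_n$ be positive integers and let $a_1,\ldots,a_n$ be nonnegative integers; put $R=r_1+\cdots+r_n$. Then in the shuffle algebra $(\mathfrak{h},\sqcup\!\sqcup)$, $$x^{a_1}y^{r_1}\;\sqcup\!\sqcup\; x^{a_2}y^{r_2}\;\sqcup\!\sqcup\;\cdots\;\sqcup\!\sqcup\; x^{a_n}y^{r_n}=\sum_{\substack{\alpha_1+\cdots+\alpha_R=a_1+\cdots+a_n\\ \alpha_i\ge0}}c_{\alpha_1,\ldots,\alpha_R}\,x^{\alpha_1}y\cdots x^{\alpha_R}y,$$ with $$c_{\alpha_1,\ldots,\alpha_R}=\sum_{\substack{l_1+\cdots+l_n=R\\ l_i\ge1}}\sum_{\sigma\in\mathfrak{S}_n}\sigma_r\Bigg\{\prod_{j=2}^n\binom{\sum_{i=j}^n l_i-\sum_{i=j+1}^n r_i-1}{r_j-1}\Bigg\}\,\sigma_a\Bigg\{\prod_{j=1}^{n-1}\binom{\sum_{i=1}^{L_{j-1}+1}\alpha_i-\sum_{i=1}^{j-1}a_i}{a_j}\Bigg\}\prod_{i=L_{n-1}+2}^{R}\delta_{\alpha_i,0},$$ where $L_0=0$, $L_j=l_1+\cdots+l_j$, and for $\sigma\in\mathfrak{S}_n$, $\sigma_r\{\cdot\}$ (resp. $\sigma_a\{\cdot\}$) denotes the expression obtained by replacing each $r_j$ by $r_{\sigma(j)}$ (resp. each $a_j$ by $a_{\sigma(j)}$).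
   Context: $\mathfrak{h}=\mathbb{Q}\langle x,y\rangle$ is spanned by words in the noncommuting letters $x,y$ (including the empty word $1$); the shuffle product $\sqcup\!\sqcup$ is defined bilinearly by $1\sqcup\!\sqcup w=w\sqcup\!\sqcup1=w$ and $aw_1\sqcup\!\sqcup bw_2=a(w_1\sqcup\!\sqcup bw_2)+b(aw_1\sqcup\!\sqcup w_2)$ for letters $a,b$ and words $w,w_1,w_2$; it is commutative and associative. $\mathfrak{S}_n$ is the symmetric group on $n$ letters. Conventions: $\delta_{ij}$ is the Kronecker delta; for integers $\alpha,\beta$, $\binom{\alpha}{\beta}=0$ if $\beta<0$ or $\alpha<\beta$; empty products equal $1$. -}

module Defs where

open import Data.Nat as ℕ using (ℕ; zero; suc; _∸_; _≡ᵇ_; _≤ᵇ_)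
open import Data.Nat.Combinatorics using (_C_)
open import Data.Integer as ℤ using (ℤ; +_; -[1+_])
open import Data.Rational as ℚ using (ℚ; 0ℚ; 1ℚ)
open import Data.Fin as Fin using (Fin)
open import Data.Vec as Vec using (Vec; []; _∷_)
open import Data.List as List using (List; []; _∷_; _++_; [_]; map; concatMap; foldr; filter; take; drop; upTo; allFin; replicate)
open import Data.List.Properties using (≡-dec)
open import Data.Nat.ListAction using (sum; product)
open import Data.Bool using (Bool; true; false; if_then_else_; _∧_; not)
open import Data.Product using (_×_; _,_)
open import Relation.Nullary.Decidable using (does)
open import Relation.Binary.PropositionalEquality using (_≡_; refl)
open import Relation.Binary.Definitions using (DecidableEquality)

data Letter : Set where
  x y : Letter

_≟L_ : DecidableEquality Letter
x ≟L x = Relation.Nullary.Decidable.yes refl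
  where import Relation.Nullary.Decidable
x ≟L y = Relation.Nullary.Decidable.no (λ ())
  where import Relation.Nullary.Decidable
y ≟L x = Relation.Nullary.Decidable.no (λ ())
  where import Relation.Nullary.Decidable
y ≟L y = Relation.Nullary.Decidable.yes refl
  where import Relation.Nullary.Decidable

Word : Set
Word = List Letter

_≟W_ : DecidableEquality Word
_≟W_ = ≡-dec _≟L_

𝔥 : Set
𝔥 = List (ℚ × Word)

coeff : 𝔥 → Word → ℚ
coeff [] w = 0ℚ
coeff ((c , v) ∷ p) w = (if does (v ≟W w) then c else 0ℚ) ℚ.+ coeff p w

infix 4 _≈𝔥_
_≈𝔥_ : 𝔥 → 𝔥 → Set
p ≈𝔥 q = ∀ w → coeff p w ≡ coeff q w

one𝔥 : 𝔥
one𝔥 = (1ℚ , []) ∷ []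

word : Word → 𝔥
word w = (1ℚ , w) ∷ []

_·_ : ℚ → 𝔥 → 𝔥
c · p = map (λ { (d , w) → (c ℚ.* d , w) }) p

Σ𝔥 : List 𝔥 → 𝔥
Σ𝔥 = foldr _++_ []

shW : Word → Word → List Word
shW [] v = [ v ]
shW (a ∷ u) [] = [ a ∷ u ]
shW (a ∷ u) (b ∷ v) = map (a ∷_) (shW u (b ∷ v)) ++ map (b ∷_) (shW (a ∷ u) v)

infixr 6 _⧢_
_⧢_ : 𝔥 → 𝔥 → 𝔥
p ⧢ q = concatMap (λ { (c , u) → concatMap (λ { (d , v) → map (λ w → (c ℚ.* d , w)) (shW u v) }) q }) p

xpow : ℕ → Word
xpow k = replicate k x

ypow : ℕ → Word
ypow k = replicate k y

xyWord : List ℕ → Word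
xyWord = concatMap (λ k → xpow k ++ [ y ])

-- binomial with the convention binom α β = 0 if β < 0 or α < β
binomℤ : ℤ → ℤ → ℕ
binomℤ α -[1+ _ ] = 0
binomℤ -[1+ _ ] (+ b) = 0
binomℤ (+ a) (+ b) = if b ≤ᵇ a then a C b else 0

-- i-th entry (0-based) of a list, default 0 (only used in range)
at : List ℕ → ℕ → ℕ
at [] _ = 0
at (k ∷ ks) zero = k
at (k ∷ ks) (suc i) = at ks i

allB : {A : Set} → (A → Bool) → List A → Bool
allB p [] = true
allB p (z ∷ zs) = p z ∧ allB p zs

wcomp : ℕ → ℕ → List (List ℕ)
wcomp zero zero = [ [] ]
wcomp zero (suc s) = []
wcomp (suc k) s = concatMap (λ i → map (i ∷_) (wcomp k (s ∸ i))) (upTo (suc s))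

pcomp : ℕ → ℕ → List (List ℕ)
pcomp k s = filter (λ ls → Data.Bool.T? (allB (λ l → 1 ≤ᵇ l) ls)) (wcomp k s)
  where import Data.Bool

allMaps : (n k : ℕ) → List (Vec (Fin n) k)
allMaps n zero = [ [] ]
allMaps n (suc k) = concatMap (λ i → map (i ∷_) (allMaps n k)) (allFin n)

distinctF : {n : ℕ} → List (Fin n) → Bool
distinctF [] = true
distinctF (i ∷ is) = allB (λ j → not (does (i Fin.≟ j))) is ∧ distinctF is

-- the symmetric group 𝔖ₙ, as the list of all bijections σ : Fin n → Fin n
-- (σ represented by the vector (σ(1),…,σ(n)); injective self-maps of a
-- finite set are exactly the bijections)
Sym : (n : ℕ) → List (Vec (Fin n) n)
Sym n = filter (λ σ → Data.Bool.T? (distinctF (Vec.toList σ))) (allMaps n n)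
  where import Data.Bool

-- replace each entry v_j by v_{σ(j)}
permute : {n : ℕ} → Vec (Fin n) n → Vec ℕ n → List ℕ
permute σ v = Vec.toList (Vec.map (Vec.lookup v) σ)

δ0 : ℕ → ℕ
δ0 k = if k ≡ᵇ 0 then 1 else 0

-- The coefficient c_{α₁,…,α_R}.  Lists are 0-indexed: entry j-1 of a
-- list is the paper's index j.  Here rs, as are the (permuted) r's, a's,
-- ls = (l₁,…,lₙ), αs = (α₁,…,α_R).

-- ∏_{j=2}^{n} binom(∑_{i=j}^n l_i − ∑_{i=j+1}^n r_i − 1, r_j − 1)
rFactor : ℕ → List ℕ → List ℕ → ℕ
rFactor n rs ls =
  product (map (λ j → binomℤ ((+ sum (drop (j ∸ 1) ls) ℤ.- + sum (drop j rs)) ℤ.- + 1)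
                              (+ at rs (j ∸ 1) ℤ.- + 1))
               (List.map (λ k → k ℕ.+ 2) (upTo (n ∸ 1))))

Lsum : List ℕ → ℕ → ℕ
Lsum ls j = sum (take j ls)

-- ∏_{j=1}^{n-1} binom(∑_{i=1}^{L_{j-1}+1} α_i − ∑_{i=1}^{j-1} a_i, a_j)
aFactor : ℕ → List ℕ → List ℕ → List ℕ → ℕ
aFactor n as ls αs =
  product (map (λ j → binomℤ (+ sum (take (Lsum ls (j ∸ 1) ℕ.+ 1) αs) ℤ.- + sum (take (j ∸ 1) as))
                              (+ at as (j ∸ 1)))
               (List.map suc (upTo (n ∸ 1))))

-- ∏_{i=L_{n-1}+2}^{R} δ_{α_i,0}
δFactor : ℕ → List ℕ → List ℕ → ℕ
δFactor n ls αs = product (map δ0 (drop (Lsum ls (n ∸ 1) ℕ.+ 1) αs))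

coeffC : (n : ℕ) → Vec ℕ n → Vec ℕ n → List ℕ → ℕ
coeffC n r a αs =
  sum (map (λ ls → sum (map (λ σ → rFactor n (permute σ r) ls
                                   ℕ.* aFactor n (permute σ a) ls αs)
                            (Sym n))
                   ℕ.* δFactor n ls αs)
           (pcomp n (sum (Vec.toList r))))

shuffleLHS : {n : ℕ} → Vec ℕ n → Vec ℕ n → 𝔥
shuffleLHS r a = Vec.foldr _ (λ p q → p ⧢ q) one𝔥
                   (Vec.zipWith (λ aj rj → word (xpow aj ++ ypow rj)) a r)

shuffleRHS : (n : ℕ) → Vec ℕ n → Vec ℕ n → 𝔥
shuffleRHS n r a =
  Σ𝔥 (map (λ αs → (+ coeffC n r a αs ℚ./ 1) · word (xyWord αs))
          (wcomp (sum (Vec.toList r)) (sum (Vec.toList a))))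

-- The coefficient of a word w in the shuffle product is its multiplicity among the shuffles of the
-- factors x^{aᵢ} y^{rᵢ}. Peeling letters off the front of w = x^{α₁} y ⋯ x^{α_R} y writes this
-- multiplicity as a sum over the arrangements cy of the multiset {1^{r₁}, …, n^{rₙ}}, recording the
-- factor each y comes from, of a product of binomial coefficients placing the x's: all x's of a
-- factor precede its first y. That product only depends on the profile of cy, namely the order σ in
-- which the factors first occur and the distances l₁, …, lₙ between these first occurrences, and it
-- equals σ_a{aFactor} · δFactor. Grouping the arrangements by profile, the number of arrangements
-- with profile (σ , l) is σ_r{rFactor}: read from the right, the other r_{σ(j)} - 1 letters of
-- factor σ(j) fill free slots after its first occurrence, and a Pascal recursion evaluates this chain
-- of binomial coefficients. All other words have multiplicity zero.

module Submission where

open import Defs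
open import Data.Bool using (Bool; true; false; if_then_else_; _∨_; _∧_; not; T; T?)
open import Data.Bool.Properties using (∨-comm; ∨-assoc; ∨-identityʳ; ∨-zeroʳ; ∨-conicalˡ; T-≡)
open import Data.Empty using (⊥; ⊥-elim)
open import Data.Fin as Fin using (Fin; zero; suc; toℕ; fromℕ<)
import Data.Fin.Properties as Finₚ
open import Data.List as List
  using (List; []; _∷_; _++_; _∷ʳ_; [_]; map; concatMap; filter; length; zip; take; drop; upTo; allFin; applyUpTo; tabulate)
import Data.List.Properties as Listₚ
open import Data.List.Reverse using (reverseView; []; _∶_∶ʳ_)
open import Data.List.Relation.Unary.All using (All; []; _∷_)
open import Data.List.Membership.Propositional using (_∈_; find)
open import Data.List.Membership.Propositional.Properties using (∈-concatMap⁻; ∈-map⁺; ∈-map⁻; ∈-upTo⁻; ∈-filter⁻)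
open import Data.List.Relation.Unary.Any using (here; there)
open import Data.Nat as ℕ using (ℕ; zero; suc; _+_; _*_; _∸_; _≤_; _≥_; _<_; z≤n; s≤s; pred; _≤ᵇ_)
open import Data.Nat.ListAction using (sum; product)
open import Data.Nat.ListAction.Properties using (sum-++)
open import Data.Nat.Properties
open import Data.Nat.Tactic.RingSolver using (solve-∀)
open import Data.Nat.Combinatorics using (_C_; nCk+nC[k+1]≡[n+1]C[k+1])
open import Data.Product using (_×_; _,_; proj₁; proj₂; ∃; map₁)
open import Data.Product.Properties using () renaming (≡-dec to ×-≡-dec)
open import Data.Unit using (⊤; tt)
open import Data.Sum using (_⊎_; inj₁; inj₂; [_,_]′)
open import Data.Vec as Vec using (Vec; []; _∷_; lookup; updateAt)
import Data.Vec.Properties as Vecₚ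
open import Data.Vec.Properties using (lookup∘updateAt; lookup∘updateAt′; updateAt-commutes; updateAt-updateAt; updateAt-id-local)
open import Function using (_∘_; Equivalence)
open import Level using (0ℓ)
open import Relation.Binary.Definitions using (DecidableEquality)
open import Relation.Binary.PropositionalEquality hiding ([_])
open import Relation.Nullary using (¬_; Dec)
open import Relation.Nullary.Decidable using (does; yes; no; dec-true; dec-false)
open import Relation.Unary using (Pred; Decidable)
open ≡-Reasoning

open import Algebra.Properties.CommutativeSemigroup +-commutativeSemigroup using () renaming (interchange to +-interchange)
open import Algebra.Properties.CommutativeSemigroup *-commutativeSemigroup using () renaming (x∙yz≈y∙xz to x*[y*z]≡y*[x*z])
open import Algebra.Properties.Semiring.Sum +-*-semiring
  using (sum-syntax; ∑-distrib-+; ∑-comm; *-distribˡ-sum; sum-cong-≗; sum-replicate-zero)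

𝟙 : Bool → ℕ
𝟙 b = if b then 1 else 0

𝟙>0 : ℕ → ℕ
𝟙>0 zero = 0
𝟙>0 (suc _) = 1

𝟙=0 : ℕ → ℕ
𝟙=0 zero = 1
𝟙=0 (suc _) = 0

𝟙>0-cong : ∀ k {m n} → (1 ≤ k → m ≡ n) → 𝟙>0 k * m ≡ 𝟙>0 k * n
𝟙>0-cong zero _ = refl
𝟙>0-cong (suc k) eq = cong (1 *_) (eq (s≤s z≤n))

𝟙>0-≥1 : ∀ {k} → 1 ≤ k → 𝟙>0 k ≡ 1
𝟙>0-≥1 (s≤s _) = refl

𝟙>0-vanish : ∀ k {m} → (1 ≤ k → m ≡ 0) → 𝟙>0 k * m ≡ 0
𝟙>0-vanish k {m} eq = trans (𝟙>0-cong k eq) (*-zeroʳ (𝟙>0 k))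

𝟙=0-vanish : ∀ k {m} → (k ≡ 0 → m ≡ 0) → 𝟙=0 k * m ≡ 0
𝟙=0-vanish zero eq = trans (+-identityʳ _) (eq refl)
𝟙=0-vanish (suc k) eq = refl

-- Sums, Kronecker deltas and binomial coefficients

∑ : {A : Set} → (A → ℕ) → List A → ℕ
∑ f [] = 0
∑ f (u ∷ us) = f u + ∑ f us

module _ {A : Set} where

  sum-map : (f : A → ℕ) (us : List A) → sum (map f us) ≡ ∑ f us
  sum-map f [] = refl
  sum-map f (u ∷ us) = cong (f u +_) (sum-map f us)

  ∑-++ : (f : A → ℕ) (us vs : List A) → ∑ f (us ++ vs) ≡ ∑ f us + ∑ f vs
  ∑-++ f [] vs = refl
  ∑-++ f (u ∷ us) vs = trans (cong (f u +_) (∑-++ f us vs)) (sym (+-assoc (f u) _ _))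

  ∑-cong : {f g : A → ℕ} (us : List A) → (∀ u → f u ≡ g u) → ∑ f us ≡ ∑ g us
  ∑-cong [] eq = refl
  ∑-cong (u ∷ us) eq = cong₂ _+_ (eq u) (∑-cong us eq)

  ∑-zero : (us : List A) → ∑ (λ _ → 0) us ≡ 0
  ∑-zero [] = refl
  ∑-zero (u ∷ us) = ∑-zero us

  ∑-+ : (f g : A → ℕ) (us : List A) → ∑ (λ u → f u + g u) us ≡ ∑ f us + ∑ g us
  ∑-+ f g [] = refl
  ∑-+ f g (u ∷ us) = trans (cong (f u + g u +_) (∑-+ f g us)) (+-interchange (f u) (g u) _ _)

  ∑-*ˡ : (k : ℕ) (f : A → ℕ) (us : List A) → ∑ (λ u → k * f u) us ≡ k * ∑ f us
  ∑-*ˡ k f [] = sym (*-zeroʳ k)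
  ∑-*ˡ k f (u ∷ us) = trans (cong (k * f u +_) (∑-*ˡ k f us)) (sym (*-distribˡ-+ k (f u) _))

  ∑-*ʳ : (k : ℕ) (f : A → ℕ) (us : List A) → ∑ (λ u → f u * k) us ≡ ∑ f us * k
  ∑-*ʳ k f us = trans (∑-cong us (λ u → *-comm (f u) k)) (trans (∑-*ˡ k f us) (*-comm k _))

  ∑-filter : {P : Pred A 0ℓ} (P? : Decidable P) (f : A → ℕ) (us : List A) →
    ∑ f (filter P? us) ≡ ∑ (λ u → 𝟙 (does (P? u)) * f u) us
  ∑-filter P? f [] = refl
  ∑-filter P? f (u ∷ us) with does (P? u)
  ... | true = cong₂ _+_ (sym (+-identityʳ (f u))) (∑-filter P? f us)
  ... | false = ∑-filter P? f us

module _ {A B : Set} where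

  ∑-map : (f : B → ℕ) (g : A → B) (us : List A) → ∑ f (map g us) ≡ ∑ (f ∘ g) us
  ∑-map f g [] = refl
  ∑-map f g (u ∷ us) = cong (f (g u) +_) (∑-map f g us)

  ∑-concatMap : (f : B → ℕ) (g : A → List B) (us : List A) →
    ∑ f (concatMap g us) ≡ ∑ (λ u → ∑ f (g u)) us
  ∑-concatMap f g [] = refl
  ∑-concatMap f g (u ∷ us) = trans (∑-++ f (g u) (concatMap g us)) (cong (∑ f (g u) +_) (∑-concatMap f g us))

module Kronecker {A : Set} (_≟_ : DecidableEquality A) where

  δ : A → A → ℕ
  δ u v = 𝟙 (does (u ≟ v))

  δ-refl : ∀ u → δ u u ≡ 1
  δ-refl u with u ≟ u
  ... | yes _ = refl
  ... | no u≢u = ⊥-elim (u≢u refl)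

  δ-≡ : ∀ {u v} → u ≡ v → δ u v ≡ 1
  δ-≡ refl = δ-refl _

  δ-≢ : ∀ {u v} → u ≢ v → δ u v ≡ 0
  δ-≢ {u} {v} u≢v with u ≟ v
  ... | yes u≡v = ⊥-elim (u≢v u≡v)
  ... | no _ = refl

  δ-transport : ∀ u v (f : A → ℕ) → δ u v * f u ≡ δ u v * f v
  δ-transport u v f with u ≟ v
  ... | yes refl = refl
  ... | no _ = refl

  ∑-δ : (f : A → ℕ) (v : A) (us : List A) →
    ∑ (λ u → δ u v * f u) us ≡ ∑ (λ u → δ u v) us * f v
  ∑-δ f v us = trans (∑-cong us (λ u → δ-transport u v f)) (∑-*ʳ (f v) (λ u → δ u v) us)

module KroneckerFin {n : ℕ} = Kronecker (Fin._≟_ {n})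
open KroneckerFin using () renaming (δ to δᶠ; δ-≢ to δᶠ-≢)

∑ᶠ-zero : ∀ n → ∑[ i < n ] 0 ≡ 0
∑ᶠ-zero n = sum-replicate-zero n

∑ᶠ-*ˡ : ∀ n k (f : Fin n → ℕ) → ∑[ i < n ] (k * f i) ≡ k * ∑[ i < n ] f i
∑ᶠ-*ˡ n k f = sym (*-distribˡ-sum k f)

∑ᶠ-pick : ∀ n (c : Fin n) (f : Fin n → ℕ) → ∑[ i < n ] (δᶠ i c * f i) ≡ f c
∑ᶠ-pick (suc n) zero f = begin
  1 * f zero + ∑[ i < n ] (δᶠ (suc i) zero * f (suc i)) ≡⟨ cong (1 * f zero +_) (sum-cong-≗ (λ i → cong (_* f (suc i)) (δᶠ-≢ {u = suc i} {v = zero} λ ()))) ⟩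
  1 * f zero + ∑[ i < n ] 0                            ≡⟨ cong₂ _+_ (*-identityˡ (f zero)) (∑ᶠ-zero n) ⟩
  f zero + 0                                            ≡⟨ +-identityʳ (f zero) ⟩
  f zero                                                ∎
∑ᶠ-pick (suc n) (suc c) f = begin
  0 * f zero + ∑[ i < n ] (δᶠ (suc i) (suc c) * f (suc i)) ≡⟨⟩
  ∑[ i < n ] (δᶠ i c * f (suc i))                         ≡⟨ ∑ᶠ-pick n c (f ∘ suc) ⟩
  f (suc c)                                               ∎

∑-tabulate : {A : Set} (n : ℕ) (f : A → ℕ) (g : Fin n → A) → ∑ f (tabulate g) ≡ ∑[ i < n ] f (g i)
∑-tabulate zero f g = refl
∑-tabulate (suc n) f g = cong (f (g zero) +_) (∑-tabulate n f (g ∘ suc))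

binom : ℕ → ℕ → ℕ
binom n zero = 1
binom zero (suc k) = 0
binom (suc n) (suc k) = binom n k + binom n (suc k)

binom-< : ∀ {n k} → n < k → binom n k ≡ 0
binom-< {zero} {suc k} _ = refl
binom-< {suc n} {suc k} (s≤s n<k) = cong₂ _+_ (binom-< n<k) (binom-< (m<n⇒m<1+n n<k))

binom-diag : ∀ n → binom n n ≡ 1
binom-diag zero = refl
binom-diag (suc n) = cong₂ _+_ (binom-diag n) (binom-< (n<1+n n))

binom-zeroˡ : ∀ k → binom 0 k ≡ 𝟙=0 k
binom-zeroˡ zero = refl
binom-zeroˡ (suc k) = refl

binom≡C : ∀ n k → binom n k ≡ n C k
binom≡C n zero = refl
binom≡C zero (suc k) = refl
binom≡C (suc n) (suc k) = trans (cong₂ _+_ (binom≡C n k) (binom≡C n (suc k))) (nCk+nC[k+1]≡[n+1]C[k+1] n k)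

-- Multiplicities in iterated shuffles

open Kronecker _≟W_ using () renaming (δ to δʷ)

∂ : Letter → (Word → ℕ) → Word → ℕ
∂ c h [] = 0
∂ c h (b ∷ w) = if does (b ≟L c) then h w else 0

∑-∂-map-∷ : (c b : Letter) (h : Word → ℕ) (ws : List Word) →
  ∑ (∂ c h) (map (b ∷_) ws) ≡ (if does (b ≟L c) then ∑ h ws else 0)
∑-∂-map-∷ c b h [] with b ≟L c
... | yes _ = refl
... | no _ = refl
∑-∂-map-∷ c b h (w ∷ ws) with b ≟L c | ∑-∂-map-∷ c b h ws
... | yes _ | ih = cong (h w +_) ih
... | no _  | ih = ih

shW-[]ʳ : (u : Word) → shW u [] ≡ [ u ]
shW-[]ʳ [] = refl
shW-[]ʳ (a ∷ u) = refl

∑-∂-shW : (c : Letter) (h : Word → ℕ) (u v : Word) →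
  ∑ (∂ c h) (shW u v) ≡ ∂ c (λ u′ → ∑ h (shW u′ v)) u + ∂ c (λ v′ → ∑ h (shW u v′)) v
∑-∂-shW c h [] [] = refl
∑-∂-shW c h [] (b ∷ v) with b ≟L c
... | yes _ = refl
... | no _ = refl
∑-∂-shW c h (a ∷ u) [] with a ≟L c
... | yes _ = cong (_+ 0) (trans (sym (+-identityʳ _)) (cong (∑ h) (sym (shW-[]ʳ u))))
... | no _ = refl
∑-∂-shW c h (a ∷ u) (b ∷ v) =
  trans (∑-++ (∂ c h) (map (a ∷_) (shW u (b ∷ v))) (map (b ∷_) (shW (a ∷ u) v)))
        (cong₂ _+_ (∑-∂-map-∷ c a h (shW u (b ∷ v))) (∑-∂-map-∷ c b h (shW (a ∷ u) v)))

shuffles : List Word → List Word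
shuffles [] = [ [] ]
shuffles (u ∷ us) = concatMap (shW u) (shuffles us)

stripHead : Letter → List Word → Word → List (List Word)
stripHead c us [] = []
stripHead c us (b ∷ u) = if does (b ≟L c) then [ u ∷ us ] else []

derivatives : Letter → List Word → List (List Word)
derivatives c [] = []
derivatives c (u ∷ us) = stripHead c us u ++ map (u ∷_) (derivatives c us)

∑-∂-shuffles : (c : Letter) (h : Word → ℕ) (us : List Word) →
  ∑ (∂ c h) (shuffles us) ≡ ∑ (λ vs → ∑ h (shuffles vs)) (derivatives c us)
∑-∂-shuffles c h [] = refl
∑-∂-shuffles c h (u ∷ us) = begin
  ∑ (∂ c h) (concatMap (shW u) (shuffles us))
    ≡⟨ ∑-concatMap (∂ c h) (shW u) (shuffles us) ⟩
  ∑ (λ v → ∑ (∂ c h) (shW u v)) (shuffles us)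
    ≡⟨ trans (∑-cong (shuffles us) (∑-∂-shW c h u)) (∑-+ _ _ (shuffles us)) ⟩
  ∑ (λ v → ∂ c (λ u′ → ∑ h (shW u′ v)) u) (shuffles us) + ∑ (∂ c (λ v′ → ∑ h (shW u v′))) (shuffles us)
    ≡⟨ cong₂ _+_ (stripped u) (∑-∂-shuffles c (λ v′ → ∑ h (shW u v′)) us) ⟩
  F (stripHead c us u) + ∑ (λ vs → ∑ (λ v′ → ∑ h (shW u v′)) (shuffles vs)) (derivatives c us)
    ≡⟨ cong (F (stripHead c us u) +_) kept ⟩
  F (stripHead c us u) + F (map (u ∷_) (derivatives c us))
    ≡⟨ ∑-++ _ (stripHead c us u) _ ⟨
  F (derivatives c (u ∷ us)) ∎
  where
  F : List (List Word) → ℕ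
  F = ∑ (λ vs → ∑ h (shuffles vs))
  stripped : (u : Word) → ∑ (λ v → ∂ c (λ u′ → ∑ h (shW u′ v)) u) (shuffles us) ≡ F (stripHead c us u)
  stripped [] = ∑-zero (shuffles us)
  stripped (b ∷ u′) with b ≟L c
  ... | yes _ = trans (sym (∑-concatMap h (shW u′) (shuffles us))) (sym (+-identityʳ _))
  ... | no _ = ∑-zero (shuffles us)
  kept : ∑ (λ vs → ∑ (λ v′ → ∑ h (shW u v′)) (shuffles vs)) (derivatives c us) ≡ F (map (u ∷_) (derivatives c us))
  kept = trans (∑-cong (derivatives c us) (λ vs → sym (∑-concatMap h (shW u) (shuffles vs))))
               (sym (∑-map (λ vs → ∑ h (shuffles vs)) (u ∷_) (derivatives c us)))

multiplicity : List Word → Word → ℕ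
multiplicity us w = ∑ (λ v → δʷ v w) (shuffles us)

δʷ-∷ : (c : Letter) (w v : Word) → δʷ v (c ∷ w) ≡ ∂ c (λ v′ → δʷ v′ w) v
δʷ-∷ c w [] = refl
δʷ-∷ c w (b ∷ v) with does (b ≟L c)
... | true = refl
... | false = refl

multiplicity-∷ : (c : Letter) (w : Word) (us : List Word) →
  multiplicity us (c ∷ w) ≡ ∑ (λ vs → multiplicity vs w) (derivatives c us)
multiplicity-∷ c w us = trans (∑-cong (shuffles us) (δʷ-∷ c w)) (∑-∂-shuffles c (λ v → δʷ v w) us)

-- Sums over arrangements of a multiset

decAt : ∀ {n} → Vec ℕ n → Fin n → Vec ℕ n
decAt v i = updateAt v i pred

clearAt : ∀ {n} → Vec ℕ n → Fin n → Vec ℕ n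
clearAt v i = updateAt v i (λ _ → 0)

Σᵛ : ∀ {n} → Vec ℕ n → ℕ
Σᵛ v = sum (Vec.toList v)

Σᵛ-decAt : ∀ {n} (v : Vec ℕ n) i → 1 ≤ lookup v i → suc (Σᵛ (decAt v i)) ≡ Σᵛ v
Σᵛ-decAt (suc k ∷ v) zero _ = refl
Σᵛ-decAt (k ∷ v) (suc i) vᵢ≥1 = trans (sym (+-suc k _)) (cong (k +_) (Σᵛ-decAt v i vᵢ≥1))

Σᵛ≡0⇒≡0 : ∀ {n} (v : Vec ℕ n) → Σᵛ v ≡ 0 → ∀ i → lookup v i ≡ 0
Σᵛ≡0⇒≡0 (k ∷ v) eq zero = m+n≡0⇒m≡0 k eq
Σᵛ≡0⇒≡0 (k ∷ v) eq (suc i) = Σᵛ≡0⇒≡0 v (m+n≡0⇒n≡0 k eq) i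

Σᵛ≢0⇒∃≥1 : ∀ {n} (v : Vec ℕ n) → Σᵛ v ≢ 0 → ∃ λ i → 1 ≤ lookup v i
Σᵛ≢0⇒∃≥1 [] ne = ⊥-elim (ne refl)
Σᵛ≢0⇒∃≥1 (suc k ∷ v) ne = zero , s≤s z≤n
Σᵛ≢0⇒∃≥1 (zero ∷ v) ne with Σᵛ≢0⇒∃≥1 v ne
... | i , vᵢ≥1 = suc i , vᵢ≥1

𝟙=0ᵛ : ∀ {n} → Vec ℕ n → ℕ
𝟙=0ᵛ [] = 1
𝟙=0ᵛ (k ∷ v) = 𝟙=0 k * 𝟙=0ᵛ v

𝟙=0ᵛ-cases : ∀ {n} (v : Vec ℕ n) → 𝟙=0ᵛ v ≡ 0 ⊎ (∀ i → lookup v i ≡ 0)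
𝟙=0ᵛ-cases [] = inj₂ (λ ())
𝟙=0ᵛ-cases (suc k ∷ v) = inj₁ refl
𝟙=0ᵛ-cases (zero ∷ v) with 𝟙=0ᵛ-cases v
... | inj₁ eq = inj₁ (trans (+-identityʳ _) eq)
... | inj₂ null = inj₂ (λ { zero → refl ; (suc i) → null i })

𝟙=0ᵛ-null : ∀ {n} (v : Vec ℕ n) → (∀ i → lookup v i ≡ 0) → 𝟙=0ᵛ v ≡ 1
𝟙=0ᵛ-null [] _ = refl
𝟙=0ᵛ-null (k ∷ v) null with null zero
... | refl = trans (+-identityʳ _) (𝟙=0ᵛ-null v (null ∘ suc))

-- The sum of f over the words of length R over Fin n in which each letter i occurs (lookup r i) times.
∑-arrangements : ∀ {n} → ℕ → Vec ℕ n → (List (Fin n) → ℕ) → ℕ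
∑-arrangements zero r f = 𝟙=0ᵛ r * f []
∑-arrangements {n} (suc R) r f = ∑[ c < n ] (𝟙>0 (lookup r c) * ∑-arrangements R (decAt r c) (λ cy → f (c ∷ cy)))

Covers : ∀ {n} → Vec ℕ n → List (Fin n) → Set
Covers r cy = ∀ i → 1 ≤ lookup r i → i ∈ cy

SameSupport : ∀ {n} → Vec ℕ n → List (Fin n) → Set
SameSupport r cy = Covers r cy × (∀ i → i ∈ cy → 1 ≤ lookup r i)

1≰0 : ¬ (1 ≤ 0)
1≰0 ()

SameSupport-∷ : ∀ {n} (r : Vec ℕ n) c cy → 1 ≤ lookup r c → SameSupport (decAt r c) cy → SameSupport r (c ∷ cy)
SameSupport-∷ r c cy r_c≥1 (covers , inSupport) = covers′ , inSupport′
  where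
  covers′ : Covers r (c ∷ cy)
  covers′ i rᵢ≥1 with i Fin.≟ c
  ... | yes refl = here refl
  ... | no i≢c = there (covers i (subst (1 ≤_) (sym (lookup∘updateAt′ i c i≢c r)) rᵢ≥1))
  inSupport′ : ∀ i → i ∈ c ∷ cy → 1 ≤ lookup r i
  inSupport′ i (here refl) = r_c≥1
  inSupport′ i (there i∈cy) with i Fin.≟ c
  ... | yes refl = r_c≥1
  ... | no i≢c = subst (1 ≤_) (lookup∘updateAt′ i c i≢c r) (inSupport i i∈cy)

∑-arrangements-cong : ∀ {n} R (r : Vec ℕ n) {f g : List (Fin n) → ℕ} →
  (∀ cy → SameSupport r cy → length cy ≡ R → f cy ≡ g cy) → ∑-arrangements R r f ≡ ∑-arrangements R r g
∑-arrangements-cong zero r {f} {g} eq with 𝟙=0ᵛ-cases r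
... | inj₁ r≢0 = trans (cong (_* f []) r≢0) (sym (cong (_* g []) r≢0))
... | inj₂ r≡0 = cong (𝟙=0ᵛ r *_) (eq [] ((λ i rᵢ≥1 → ⊥-elim (1≰0 (subst (1 ≤_) (r≡0 i) rᵢ≥1))) , (λ i ())) refl)
∑-arrangements-cong (suc R) r eq = sum-cong-≗ λ c → 𝟙>0-cong (lookup r c) λ r_c≥1 →
  ∑-arrangements-cong R (decAt r c) (λ cy supp len → eq (c ∷ cy) (SameSupport-∷ r c cy r_c≥1 supp) (cong suc len))

∑-arrangements-*ˡ : ∀ {n} R (r : Vec ℕ n) k (f : List (Fin n) → ℕ) →
  ∑-arrangements R r (λ cy → k * f cy) ≡ k * ∑-arrangements R r f
∑-arrangements-*ˡ zero r k f = x*[y*z]≡y*[x*z] (𝟙=0ᵛ r) k (f [])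
∑-arrangements-*ˡ {n} (suc R) r k f = begin
  ∑[ c < n ] (𝟙>0 (lookup r c) * ∑-arrangements R (decAt r c) (λ cy → k * f (c ∷ cy)))
    ≡⟨ sum-cong-≗ (λ c → cong (𝟙>0 (lookup r c) *_) (∑-arrangements-*ˡ R (decAt r c) k _)) ⟩
  ∑[ c < n ] (𝟙>0 (lookup r c) * (k * ∑-arrangements R (decAt r c) (λ cy → f (c ∷ cy))))
    ≡⟨ sum-cong-≗ (λ c → x*[y*z]≡y*[x*z] (𝟙>0 (lookup r c)) k _) ⟩
  ∑[ c < n ] (k * (𝟙>0 (lookup r c) * ∑-arrangements R (decAt r c) (λ cy → f (c ∷ cy))))
    ≡⟨ ∑ᶠ-*ˡ n k _ ⟩
  k * ∑-arrangements (suc R) r f ∎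

∑-arrangements-*ʳ : ∀ {n} R (r : Vec ℕ n) k (f : List (Fin n) → ℕ) →
  ∑-arrangements R r (λ cy → f cy * k) ≡ ∑-arrangements R r f * k
∑-arrangements-*ʳ R r k f = trans (∑-arrangements-cong R r (λ cy _ _ → *-comm (f cy) k))
  (trans (∑-arrangements-*ˡ R r k f) (*-comm k _))

∑-arrangements-zero : ∀ {n} R (r : Vec ℕ n) → ∑-arrangements R r (λ _ → 0) ≡ 0
∑-arrangements-zero R r = ∑-arrangements-*ˡ R r 0 (λ _ → 0)

∑-arrangements-+ : ∀ {n} R (r : Vec ℕ n) (f g : List (Fin n) → ℕ) →
  ∑-arrangements R r (λ cy → f cy + g cy) ≡ ∑-arrangements R r f + ∑-arrangements R r g
∑-arrangements-+ zero r f g = *-distribˡ-+ (𝟙=0ᵛ r) (f []) (g [])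
∑-arrangements-+ (suc R) r f g = trans
  (sum-cong-≗ λ c → trans (cong (𝟙>0 (lookup r c) *_) (∑-arrangements-+ R (decAt r c) _ _)) (*-distribˡ-+ (𝟙>0 (lookup r c)) _ _))
  (∑-distrib-+ (λ c → 𝟙>0 (lookup r c) * ∑-arrangements R (decAt r c) (λ cy → f (c ∷ cy)))
                (λ c → 𝟙>0 (lookup r c) * ∑-arrangements R (decAt r c) (λ cy → g (c ∷ cy))))

∑-arrangements-∑ : ∀ {n} {A : Set} R (r : Vec ℕ n) (h : A → List (Fin n) → ℕ) (us : List A) →
  ∑-arrangements R r (λ cy → ∑ (λ u → h u cy) us) ≡ ∑ (λ u → ∑-arrangements R r (h u)) us
∑-arrangements-∑ R r h [] = ∑-arrangements-zero R r
∑-arrangements-∑ R r h (u ∷ us) = trans (∑-arrangements-+ R r (h u) _) (cong (∑-arrangements R r (h u) +_) (∑-arrangements-∑ R r h us))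

∑-arrangements-∑ᶠ : ∀ {n} R (r : Vec ℕ n) (h : Fin n → List (Fin n) → ℕ) →
  ∑-arrangements R r (λ cy → ∑[ i < n ] h i cy) ≡ ∑[ i < n ] ∑-arrangements R r (h i)
∑-arrangements-∑ᶠ {n} zero r h = sym (∑ᶠ-*ˡ n (𝟙=0ᵛ r) _)
∑-arrangements-∑ᶠ {n} (suc R) r h = begin
  ∑[ c < n ] (𝟙>0 (lookup r c) * ∑-arrangements R (decAt r c) (λ cy → ∑[ i < n ] h i (c ∷ cy)))
    ≡⟨ sum-cong-≗ (λ c → cong (𝟙>0 (lookup r c) *_) (∑-arrangements-∑ᶠ R (decAt r c) (λ i cy → h i (c ∷ cy)))) ⟩
  ∑[ c < n ] (𝟙>0 (lookup r c) * ∑[ i < n ] ∑-arrangements R (decAt r c) (λ cy → h i (c ∷ cy)))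
    ≡⟨ sum-cong-≗ (λ c → sym (∑ᶠ-*ˡ n (𝟙>0 (lookup r c)) _)) ⟩
  ∑[ c < n ] ∑[ i < n ] (𝟙>0 (lookup r c) * ∑-arrangements R (decAt r c) (λ cy → h i (c ∷ cy)))
    ≡⟨ ∑-comm (λ c i → 𝟙>0 (lookup r c) * ∑-arrangements R (decAt r c) (λ cy → h i (c ∷ cy))) ⟩
  ∑[ i < n ] ∑-arrangements (suc R) r (h i) ∎

∑-arrangements-snoc : ∀ {n} R (r : Vec ℕ n) (f : List (Fin n) → ℕ) →
  ∑-arrangements (suc R) r f ≡ ∑[ c < n ] (𝟙>0 (lookup r c) * ∑-arrangements R (decAt r c) (λ cy → f (cy ++ [ c ])))
∑-arrangements-snoc zero r f = refl
∑-arrangements-snoc {n} (suc R) r f = begin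
  ∑[ c < n ] (𝟙>0 (lookup r c) * ∑-arrangements (suc R) (decAt r c) (λ cy → f (c ∷ cy)))
    ≡⟨ sum-cong-≗ (λ c → cong (𝟙>0 (lookup r c) *_) (∑-arrangements-snoc R (decAt r c) (λ cy → f (c ∷ cy)))) ⟩
  ∑[ c < n ] (𝟙>0 (lookup r c) * ∑[ d < n ] Tail c d)
    ≡⟨ sum-cong-≗ (λ c → sym (∑ᶠ-*ˡ n (𝟙>0 (lookup r c)) (Tail c))) ⟩
  ∑[ c < n ] ∑[ d < n ] (𝟙>0 (lookup r c) * Tail c d)
    ≡⟨ sum-cong-≗ (λ c → sum-cong-≗ (λ d → remove-in-either-order c d)) ⟩
  ∑[ c < n ] ∑[ d < n ] (𝟙>0 (lookup r d) * (𝟙>0 (lookup (decAt r d) c) * ∑-arrangements R (decAt (decAt r d) c) (λ cy → f (c ∷ (cy ++ [ d ])))))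
    ≡⟨ ∑-comm (λ c d → 𝟙>0 (lookup r d) * (𝟙>0 (lookup (decAt r d) c) * ∑-arrangements R (decAt (decAt r d) c) (λ cy → f (c ∷ (cy ++ [ d ]))))) ⟩
  ∑[ d < n ] ∑[ c < n ] (𝟙>0 (lookup r d) * (𝟙>0 (lookup (decAt r d) c) * ∑-arrangements R (decAt (decAt r d) c) (λ cy → f (c ∷ (cy ++ [ d ])))))
    ≡⟨ sum-cong-≗ (λ d → ∑ᶠ-*ˡ n (𝟙>0 (lookup r d)) _) ⟩
  ∑[ d < n ] (𝟙>0 (lookup r d) * ∑-arrangements (suc R) (decAt r d) (λ cy → f (cy ++ [ d ]))) ∎
  where
  Tail : Fin n → Fin n → ℕ
  Tail c d = 𝟙>0 (lookup (decAt r c) d) * ∑-arrangements R (decAt (decAt r c) d) (λ cy → f (c ∷ (cy ++ [ d ])))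
  remove-in-either-order : ∀ c d → 𝟙>0 (lookup r c) * Tail c d ≡
    𝟙>0 (lookup r d) * (𝟙>0 (lookup (decAt r d) c) * ∑-arrangements R (decAt (decAt r d) c) (λ cy → f (c ∷ (cy ++ [ d ]))))
  remove-in-either-order c d with c Fin.≟ d
  ... | yes refl = refl
  ... | no c≢d = begin
    𝟙>0 (lookup r c) * (𝟙>0 (lookup (decAt r c) d) * ∑-arrangements R (decAt (decAt r c) d) g)
      ≡⟨ cong₂ (λ u v → 𝟙>0 (lookup r c) * (𝟙>0 u * ∑-arrangements R v g))
               (lookup∘updateAt′ d c (c≢d ∘ sym) r) (updateAt-commutes d c (c≢d ∘ sym) r) ⟩
    𝟙>0 (lookup r c) * (𝟙>0 (lookup r d) * ∑-arrangements R (decAt (decAt r d) c) g)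
      ≡⟨ x*[y*z]≡y*[x*z] (𝟙>0 (lookup r c)) (𝟙>0 (lookup r d)) _ ⟩
    𝟙>0 (lookup r d) * (𝟙>0 (lookup r c) * ∑-arrangements R (decAt (decAt r d) c) g)
      ≡⟨ cong (λ u → 𝟙>0 (lookup r d) * (𝟙>0 u * ∑-arrangements R (decAt (decAt r d) c) g)) (sym (lookup∘updateAt′ c d c≢d r)) ⟩
    𝟙>0 (lookup r d) * (𝟙>0 (lookup (decAt r d) c) * ∑-arrangements R (decAt (decAt r d) c) g) ∎
    where
    g = λ cy → f (c ∷ (cy ++ [ d ]))

-- Placing the x's

head₀ : List ℕ → ℕ
head₀ [] = 0
head₀ (k ∷ _) = k

-- The y's are read from left to right, cy listing the factor each one belongs to, and βs the
-- numbers of x's following them; s x's have been read but not yet attributed, and factor i still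
-- owns lookup a i x's. All x's of a factor precede its first y, so they are chosen among the s
-- pending ones when that y is read.
xPlacements : ∀ {n} → List (Fin n) → List ℕ → ℕ → Vec ℕ n → ℕ
xPlacements [] βs s a = 𝟙=0 s
xPlacements (c ∷ cy) βs s a = binom s (lookup a c) * xPlacements cy (drop 1 βs) (s ∸ lookup a c + head₀ βs) (clearAt a c)

decAt-clearAt-≢ : ∀ {n} (a : Vec ℕ n) {i c} → i ≢ c → (F : ℕ → Vec ℕ n → ℕ) →
  𝟙>0 (lookup a i) * F (lookup (decAt a i) c) (clearAt (decAt a i) c) ≡
  𝟙>0 (lookup (clearAt a c) i) * F (lookup a c) (decAt (clearAt a c) i)
decAt-clearAt-≢ a {i} {c} i≢c F = cong₃ (λ u k v → 𝟙>0 u * F k v)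
  (sym (lookup∘updateAt′ i c i≢c a)) (lookup∘updateAt′ c i (i≢c ∘ sym) a) (updateAt-commutes c i (i≢c ∘ sym) a)
  where
  cong₃ : ∀ {A B C D : Set} (f : A → B → C → D) {a a′ b b′ c c′} → a ≡ a′ → b ≡ b′ → c ≡ c′ → f a b c ≡ f a′ b′ c′
  cong₃ f refl refl refl = refl

decAt-clearAt-≡ : ∀ {n} (a : Vec ℕ n) c (F : ℕ → Vec ℕ n → ℕ) →
  F (lookup (decAt a c) c) (clearAt (decAt a c) c) ≡ F (pred (lookup a c)) (clearAt a c)
decAt-clearAt-≡ a c F = cong₂ F (lookup∘updateAt c a) (updateAt-updateAt c a)

Covers-[] : ∀ {n} (a : Vec ℕ n) → Covers a [] → ∀ i → lookup a i ≡ 0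
Covers-[] a cov i with lookup a i in a_i≡
... | zero = refl
... | suc _ with cov i (subst (1 ≤_) (sym a_i≡) (s≤s z≤n))
...   | ()

Covers-clearAt : ∀ {n} (a : Vec ℕ n) c cy → Covers a (c ∷ cy) → Covers (clearAt a c) cy
Covers-clearAt a c cy cov i a′ᵢ≥1 with i Fin.≟ c
... | yes refl = ⊥-elim (1≰0 (subst (1 ≤_) (lookup∘updateAt c a) a′ᵢ≥1))
... | no i≢c with cov i (subst (1 ≤_) (lookup∘updateAt′ i c i≢c a) a′ᵢ≥1)
...   | here i≡c = ⊥-elim (i≢c i≡c)
...   | there i∈cy = i∈cy

-- Pascal's rule, one pending x at a time: the extra x belongs to some factor i.
xPlacements-suc : ∀ {n} (cy : List (Fin n)) βs s (a : Vec ℕ n) → Covers a cy →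
  xPlacements cy βs (suc s) a ≡ ∑[ i < n ] (𝟙>0 (lookup a i) * xPlacements cy βs s (decAt a i))
xPlacements-suc {n} [] βs s a cov =
  sym (trans (sum-cong-≗ (λ i → cong (λ k → 𝟙>0 k * 𝟙=0 s) (Covers-[] a cov i))) (∑ᶠ-zero n))
xPlacements-suc {n} (c ∷ cy) βs s a cov with lookup a c in a_c≡
... | zero = begin
  P (suc (s + h)) a′ + 0
    ≡⟨ +-identityʳ _ ⟩
  P (suc (s + h)) a′
    ≡⟨ xPlacements-suc cy β′ (s + h) a′ cov′ ⟩
  ∑[ i < n ] (𝟙>0 (lookup a′ i) * P (s + h) (decAt a′ i))
    ≡⟨ sum-cong-≗ summand ⟨
  ∑[ i < n ] (𝟙>0 (lookup a i) * X (lookup (decAt a i) c) (clearAt (decAt a i) c)) ∎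
  where
  β′ = drop 1 βs
  h = head₀ βs
  a′ = clearAt a c
  P = xPlacements cy β′
  X = λ k v → binom s k * P (s ∸ k + h) v
  cov′ = Covers-clearAt a c cy cov
  summand : ∀ i → 𝟙>0 (lookup a i) * X (lookup (decAt a i) c) (clearAt (decAt a i) c) ≡ 𝟙>0 (lookup a′ i) * P (s + h) (decAt a′ i)
  summand i with i Fin.≟ c
  ... | yes refl = trans (cong (λ k → 𝟙>0 k * X (lookup (decAt a i) i) (clearAt (decAt a i) i)) a_c≡)
                         (cong (λ k → 𝟙>0 k * P (s + h) (decAt a′ i)) (sym (lookup∘updateAt i a)))
  ... | no i≢c = trans (decAt-clearAt-≢ a i≢c X)
    (trans (cong (λ k → 𝟙>0 (lookup a′ i) * X k (decAt a′ i)) a_c≡) (cong (𝟙>0 (lookup a′ i) *_) (+-identityʳ _)))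
... | suc m = begin
  (binom s m + binom s (suc m)) * P (s ∸ m + h) a′
    ≡⟨ *-distribʳ-+ (P (s ∸ m + h) a′) (binom s m) (binom s (suc m)) ⟩
  X m a′ + binom s (suc m) * P (s ∸ m + h) a′
    ≡⟨ cong (X m a′ +_) extra-x ⟩
  X m a′ + binom s (suc m) * ∑[ i < n ] (𝟙>0 (lookup a′ i) * Y i)
    ≡⟨ cong₂ _+_ (∑ᶠ-pick n c (λ _ → X m a′)) (∑ᶠ-*ˡ n (binom s (suc m)) (λ i → 𝟙>0 (lookup a′ i) * Y i)) ⟨
  ∑[ i < n ] (δᶠ i c * X m a′) + ∑[ i < n ] (binom s (suc m) * (𝟙>0 (lookup a′ i) * Y i))
    ≡⟨ ∑-distrib-+ (λ i → δᶠ i c * X m a′) (λ i → binom s (suc m) * (𝟙>0 (lookup a′ i) * Y i)) ⟨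
  ∑[ i < n ] (δᶠ i c * X m a′ + binom s (suc m) * (𝟙>0 (lookup a′ i) * Y i))
    ≡⟨ sum-cong-≗ summand ⟨
  ∑[ i < n ] (𝟙>0 (lookup a i) * X (lookup (decAt a i) c) (clearAt (decAt a i) c)) ∎
  where
  β′ = drop 1 βs
  h = head₀ βs
  a′ = clearAt a c
  P = xPlacements cy β′
  X = λ k v → binom s k * P (s ∸ k + h) v
  Y = λ i → P (s ∸ suc m + h) (decAt a′ i)
  extra-x : binom s (suc m) * P (s ∸ m + h) a′ ≡ binom s (suc m) * ∑[ i < n ] (𝟙>0 (lookup a′ i) * Y i)
  extra-x with m <? s
  ... | no m≮s = trans (cong (_* P (s ∸ m + h) a′) s<1+m) (sym (cong (_* ∑[ i < n ] (𝟙>0 (lookup a′ i) * Y i)) s<1+m))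
    where
    s<1+m = binom-< (s≤s (≮⇒≥ m≮s))
  ... | yes m<s = cong (binom s (suc m) *_)
    (trans (cong (λ k → P (k + h) a′) (+-∸-assoc 1 m<s)) (xPlacements-suc cy β′ (s ∸ suc m + h) a′ (Covers-clearAt a c cy cov)))
  summand-c : 𝟙>0 (lookup a c) * X (lookup (decAt a c) c) (clearAt (decAt a c) c) ≡
              1 * X m a′ + binom s (suc m) * (𝟙>0 (lookup a′ c) * Y c)
  summand-c = begin
    𝟙>0 (lookup a c) * X (lookup (decAt a c) c) (clearAt (decAt a c) c)
      ≡⟨ cong₂ _*_ (cong 𝟙>0 a_c≡) (trans (decAt-clearAt-≡ a c X) (cong (λ k → X (pred k) a′) a_c≡)) ⟩
    1 * X m a′
      ≡⟨ +-identityʳ (1 * X m a′) ⟨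
    1 * X m a′ + 0
      ≡⟨ cong (1 * X m a′ +_) (trans (cong (λ k → binom s (suc m) * (𝟙>0 k * Y c)) (lookup∘updateAt c a)) (*-zeroʳ (binom s (suc m)))) ⟨
    1 * X m a′ + binom s (suc m) * (𝟙>0 (lookup a′ c) * Y c) ∎
  summand : ∀ i → 𝟙>0 (lookup a i) * X (lookup (decAt a i) c) (clearAt (decAt a i) c) ≡
                  δᶠ i c * X m a′ + binom s (suc m) * (𝟙>0 (lookup a′ i) * Y i)
  summand i with i Fin.≟ c
  ... | yes refl = summand-c
  ... | no i≢c = begin
    𝟙>0 (lookup a i) * X (lookup (decAt a i) c) (clearAt (decAt a i) c)
      ≡⟨ decAt-clearAt-≢ a i≢c X ⟩
    𝟙>0 (lookup a′ i) * X (lookup a c) (decAt a′ i)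
      ≡⟨ cong (λ k → 𝟙>0 (lookup a′ i) * X k (decAt a′ i)) a_c≡ ⟩
    𝟙>0 (lookup a′ i) * (binom s (suc m) * Y i)
      ≡⟨ x*[y*z]≡y*[x*z] (𝟙>0 (lookup a′ i)) (binom s (suc m)) (Y i) ⟩
    binom s (suc m) * (𝟙>0 (lookup a′ i) * Y i) ∎

factors : ∀ {n} → Vec ℕ n → Vec ℕ n → List Word
factors [] [] = []
factors (a₀ ∷ a) (r₀ ∷ r) = (xpow a₀ ++ ypow r₀) ∷ factors a r

∑-derivatives-x : ∀ {n} (a r : Vec ℕ n) (f : List Word → ℕ) →
  ∑ f (derivatives x (factors a r)) ≡ ∑[ i < n ] (𝟙>0 (lookup a i) * f (factors (decAt a i) r))
∑-derivatives-x [] [] f = refl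
∑-derivatives-x (a₀ ∷ a) (r₀ ∷ r) f =
  trans (∑-++ f (stripHead x (factors a r) (xpow a₀ ++ ypow r₀)) _)
        (cong₂ _+_ (first a₀ r₀) (trans (∑-map f ((xpow a₀ ++ ypow r₀) ∷_) (derivatives x (factors a r))) (∑-derivatives-x a r _)))
  where
  first : ∀ a₀ r₀ → ∑ f (stripHead x (factors a r) (xpow a₀ ++ ypow r₀)) ≡ 𝟙>0 a₀ * f (factors (decAt (a₀ ∷ a) zero) (r₀ ∷ r))
  first (suc k) r₀ = refl
  first zero zero = refl
  first zero (suc r₀) = refl

∑-derivatives-y : ∀ {n} (a r : Vec ℕ n) (f : List Word → ℕ) →
  ∑ f (derivatives y (factors a r)) ≡ ∑[ i < n ] (𝟙=0 (lookup a i) * (𝟙>0 (lookup r i) * f (factors a (decAt r i))))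
∑-derivatives-y [] [] f = refl
∑-derivatives-y (a₀ ∷ a) (r₀ ∷ r) f =
  trans (∑-++ f (stripHead y (factors a r) (xpow a₀ ++ ypow r₀)) _)
        (cong₂ _+_ (first a₀ r₀) (trans (∑-map f ((xpow a₀ ++ ypow r₀) ∷_) (derivatives y (factors a r))) (∑-derivatives-y a r _)))
  where
  first : ∀ a₀ r₀ → ∑ f (stripHead y (factors a r) (xpow a₀ ++ ypow r₀)) ≡ 𝟙=0 a₀ * (𝟙>0 r₀ * f (factors (a₀ ∷ a) (decAt (r₀ ∷ r) zero)))
  first (suc k) r₀ = refl
  first zero zero = refl
  first zero (suc r₀) = sym (+-identityʳ _)

-- Factors without y are empty; this is how r > 0 enters the recursion.
Admissible : ∀ {n} → Vec ℕ n → Vec ℕ n → Set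
Admissible a r = ∀ i → lookup r i ≡ 0 → lookup a i ≡ 0

Admissible-decAtˡ : ∀ {n} (a r : Vec ℕ n) i → Admissible a r → Admissible (decAt a i) r
Admissible-decAtˡ a r i adm j r_j≡0 with j Fin.≟ i
... | yes refl = trans (lookup∘updateAt j a) (cong pred (adm j r_j≡0))
... | no j≢i = trans (lookup∘updateAt′ j i j≢i a) (adm j r_j≡0)

Admissible-decAtʳ : ∀ {n} (a r : Vec ℕ n) i → lookup a i ≡ 0 → Admissible a r → Admissible a (decAt r i)
Admissible-decAtʳ a r i a_i≡0 adm j r′_j≡0 with j Fin.≟ i
... | yes refl = a_i≡0
... | no j≢i = adm j (trans (sym (lookup∘updateAt′ j i j≢i r)) r′_j≡0)

Admissible-≥1 : ∀ {n} (a r : Vec ℕ n) i → Admissible a r → 1 ≤ lookup a i → 1 ≤ lookup r i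
Admissible-≥1 a r i adm a_i≥1 with lookup r i in r_i≡
... | suc _ = s≤s z≤n
... | zero with () ← subst (1 ≤_) (adm i r_i≡) a_i≥1

Admissible-Covers : ∀ {n} (a r : Vec ℕ n) cy → Admissible a r → Covers r cy → Covers a cy
Admissible-Covers a r cy adm cov i a_i≥1 = cov i (Admissible-≥1 a r i adm a_i≥1)

shuffles-factors-null : ∀ {n} (a r : Vec ℕ n) → Σᵛ a ≡ 0 → Σᵛ r ≡ 0 → shuffles (factors a r) ≡ [ [] ]
shuffles-factors-null [] [] _ _ = refl
shuffles-factors-null (a₀ ∷ a) (r₀ ∷ r) Σa≡0 Σr≡0 with m+n≡0⇒m≡0 a₀ Σa≡0 | m+n≡0⇒m≡0 r₀ Σr≡0
... | refl | refl = cong (concatMap (shW [])) (shuffles-factors-null a r Σa≡0 Σr≡0)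

-- The first letters of the word are peeled off one at a time: an x comes from some factor i
-- (Pascal's rule on the pending x's), a y from a factor i whose x's are exhausted.
mutual
  multiplicity-xyWord : ∀ {n} (α : List ℕ) (a r : Vec ℕ n) → Admissible a r → length α ≡ Σᵛ r → sum α ≡ Σᵛ a →
    multiplicity (factors a r) (xyWord α) ≡ ∑-arrangements (length α) r (λ cy → xPlacements cy (drop 1 α) (head₀ α) a)
  multiplicity-xyWord [] a r adm len≡ sum≡ = begin
    multiplicity (factors a r) []
      ≡⟨ cong (∑ (λ v → δʷ v [])) (shuffles-factors-null a r (sym sum≡) (sym len≡)) ⟩
    1
      ≡⟨ 𝟙=0ᵛ-null r (Σᵛ≡0⇒≡0 r (sym len≡)) ⟨
    𝟙=0ᵛ r
      ≡⟨ *-identityʳ _ ⟨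
    𝟙=0ᵛ r * 1 ∎
  multiplicity-xyWord (k ∷ α) a r adm len≡ sum≡ = multiplicity-x^k-y α k a r adm len≡ sum≡

  multiplicity-x^k-y : ∀ {n} (α : List ℕ) k (a r : Vec ℕ n) → Admissible a r → suc (length α) ≡ Σᵛ r → k + sum α ≡ Σᵛ a →
    multiplicity (factors a r) (xyWord (k ∷ α)) ≡ ∑-arrangements (suc (length α)) r (λ cy → xPlacements cy α k a)
  multiplicity-x^k-y {n} α (suc k) a r adm len≡ sum≡ = begin
    multiplicity (factors a r) (x ∷ xyWord (k ∷ α))
      ≡⟨ multiplicity-∷ x _ (factors a r) ⟩
    ∑ (λ vs → multiplicity vs (xyWord (k ∷ α))) (derivatives x (factors a r))
      ≡⟨ ∑-derivatives-x a r _ ⟩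
    ∑[ i < n ] (𝟙>0 (lookup a i) * multiplicity (factors (decAt a i) r) (xyWord (k ∷ α)))
      ≡⟨ sum-cong-≗ (λ i → 𝟙>0-cong (lookup a i) λ a_i≥1 →
           multiplicity-x^k-y α k (decAt a i) r (Admissible-decAtˡ a r i adm) len≡ (suc-injective (trans sum≡ (sym (Σᵛ-decAt a i a_i≥1))))) ⟩
    ∑[ i < n ] (𝟙>0 (lookup a i) * ∑-arrangements R r (λ cy → xPlacements cy α k (decAt a i)))
      ≡⟨ sum-cong-≗ (λ i → ∑-arrangements-*ˡ R r (𝟙>0 (lookup a i)) (λ cy → xPlacements cy α k (decAt a i))) ⟨
    ∑[ i < n ] ∑-arrangements R r (λ cy → 𝟙>0 (lookup a i) * xPlacements cy α k (decAt a i))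
      ≡⟨ ∑-arrangements-∑ᶠ R r (λ i cy → 𝟙>0 (lookup a i) * xPlacements cy α k (decAt a i)) ⟨
    ∑-arrangements R r (λ cy → ∑[ i < n ] (𝟙>0 (lookup a i) * xPlacements cy α k (decAt a i)))
      ≡⟨ ∑-arrangements-cong R r (λ cy (covers , _) _ → sym (xPlacements-suc cy α k a (Admissible-Covers a r cy adm covers))) ⟩
    ∑-arrangements R r (λ cy → xPlacements cy α (suc k) a) ∎
    where
    R = suc (length α)
  multiplicity-x^k-y {n} α zero a r adm len≡ sum≡ = begin
    multiplicity (factors a r) (y ∷ xyWord α)
      ≡⟨ multiplicity-∷ y _ (factors a r) ⟩
    ∑ (λ vs → multiplicity vs (xyWord α)) (derivatives y (factors a r))
      ≡⟨ ∑-derivatives-y a r _ ⟩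
    ∑[ c < n ] (𝟙=0 (lookup a c) * (𝟙>0 (lookup r c) * multiplicity (factors a (decAt r c)) (xyWord α)))
      ≡⟨ sum-cong-≗ first-y ⟩
    ∑[ c < n ] (𝟙>0 (lookup r c) * ∑-arrangements (length α) (decAt r c) (λ cy → xPlacements (c ∷ cy) α 0 a)) ∎
    where
    first-y : ∀ c → 𝟙=0 (lookup a c) * (𝟙>0 (lookup r c) * multiplicity (factors a (decAt r c)) (xyWord α)) ≡
                    𝟙>0 (lookup r c) * ∑-arrangements (length α) (decAt r c) (λ cy → xPlacements (c ∷ cy) α 0 a)
    first-y c with lookup a c in a_c≡
    ... | suc _ = sym (trans (cong (𝟙>0 (lookup r c) *_) (∑-arrangements-zero (length α) (decAt r c))) (*-zeroʳ (𝟙>0 (lookup r c))))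
    ... | zero = trans (+-identityʳ _) (𝟙>0-cong (lookup r c) λ r_c≥1 →
      trans (multiplicity-xyWord α a (decAt r c) (Admissible-decAtʳ a r c a_c≡ adm) (suc-injective (trans len≡ (sym (Σᵛ-decAt r c r_c≥1)))) sum≡)
            (∑-arrangements-cong (length α) (decAt r c) λ cy _ _ →
              sym (trans (+-identityʳ _) (cong (xPlacements cy (drop 1 α) (head₀ α)) (updateAt-id-local c a (sym a_c≡))))))

-- Profiles: first occurrences and the gaps between them

occurs : ∀ {n} → Fin n → List (Fin n) → Bool
occurs c [] = false
occurs c (d ∷ ds) = does (c Fin.≟ d) ∨ occurs c ds

-- An entry (c , g) records a letter c occurring for the first time and followed by g letters
-- before the next first occurrence.
Profile : ℕ → Set
Profile n = List (Fin n × ℕ)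

-- Given the letters S seen before: the number of leading letters of cy that are not new, and the
-- profile of the rest.
profileFrom : ∀ {n} → List (Fin n) → List (Fin n) → ℕ × Profile n
profileFrom S [] = (0 , [])
profileFrom S (c ∷ cy) =
  if occurs c S then map₁ suc (profileFrom S cy)
  else (0 , (c , proj₁ (profileFrom (c ∷ S) cy)) ∷ proj₂ (profileFrom (c ∷ S) cy))

profile : ∀ {n} → List (Fin n) → Profile n
profile cy = proj₂ (profileFrom [] cy)

profileFrom-[] : ∀ {n} (cy : List (Fin n)) → profileFrom [] cy ≡ (0 , profile cy)
profileFrom-[] [] = refl
profileFrom-[] (c ∷ cy) = refl

extendLast : ∀ {n} → Profile n → Profile n
extendLast [] = []
extendLast ((c , g) ∷ []) = (c , suc g) ∷ []
extendLast (e ∷ e′ ∷ es) = e ∷ extendLast (e′ ∷ es)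

extendLast-∷ʳ : ∀ {n} (es : Profile n) c g → extendLast (es ∷ʳ (c , g)) ≡ es ∷ʳ (c , suc g)
extendLast-∷ʳ [] c g = refl
extendLast-∷ʳ (e ∷ []) c g = refl
extendLast-∷ʳ (e ∷ e′ ∷ es) c g = cong (e ∷_) (extendLast-∷ʳ (e′ ∷ es) c g)

-- The effect on profileFrom of appending a letter, old or new.
snocProfile : ∀ {n} → Bool → Fin n → ℕ × Profile n → ℕ × Profile n
snocProfile true c (k , []) = (suc k , [])
snocProfile true c (k , e ∷ es) = (k , extendLast (e ∷ es))
snocProfile false c (k , es) = (k , es ∷ʳ (c , 0))

snocProfile-suc : ∀ {n} b (c : Fin n) p → snocProfile b c (map₁ suc p) ≡ map₁ suc (snocProfile b c p)
snocProfile-suc true c (k , []) = refl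
snocProfile-suc true c (k , e ∷ es) = refl
snocProfile-suc false c (k , es) = refl

snocProfile-new : ∀ {n} b (c d : Fin n) (p : ℕ × Profile n) →
  snocProfile b c (0 , (d , proj₁ p) ∷ proj₂ p) ≡ (0 , (d , proj₁ (snocProfile b c p)) ∷ proj₂ (snocProfile b c p))
snocProfile-new true c d (k , []) = refl
snocProfile-new true c d (k , e ∷ es) = refl
snocProfile-new false c d (k , es) = refl

profileFrom-∷ʳ : ∀ {n} (S cy : List (Fin n)) c → profileFrom S (cy ∷ʳ c) ≡ snocProfile (occurs c S ∨ occurs c cy) c (profileFrom S cy)
profileFrom-∷ʳ S [] c with occurs c S
... | true = refl
... | false = refl
profileFrom-∷ʳ S (d ∷ cy) c with occurs d S in d∈S
... | true = begin
  map₁ suc (profileFrom S (cy ∷ʳ c))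
    ≡⟨ cong (map₁ suc) (profileFrom-∷ʳ S cy c) ⟩
  map₁ suc (snocProfile (occurs c S ∨ occurs c cy) c (profileFrom S cy))
    ≡⟨ snocProfile-suc _ c (profileFrom S cy) ⟨
  snocProfile (occurs c S ∨ occurs c cy) c (map₁ suc (profileFrom S cy))
    ≡⟨ cong (λ b → snocProfile b c (map₁ suc (profileFrom S cy))) d-is-old ⟩
  snocProfile (occurs c S ∨ (does (c Fin.≟ d) ∨ occurs c cy)) c (map₁ suc (profileFrom S cy)) ∎
  where
  d-is-old : occurs c S ∨ occurs c cy ≡ occurs c S ∨ (does (c Fin.≟ d) ∨ occurs c cy)
  d-is-old with c Fin.≟ d
  ... | yes refl = trans (cong (_∨ occurs c cy) d∈S) (cong (_∨ true) (sym d∈S))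
  ... | no _ = refl
... | false = begin
  (0 , (d , proj₁ (profileFrom (d ∷ S) (cy ∷ʳ c))) ∷ proj₂ (profileFrom (d ∷ S) (cy ∷ʳ c)))
    ≡⟨ cong (λ p → (0 , (d , proj₁ p) ∷ proj₂ p)) (profileFrom-∷ʳ (d ∷ S) cy c) ⟩
  (0 , (d , proj₁ (snocProfile b c rest)) ∷ proj₂ (snocProfile b c rest))
    ≡⟨ snocProfile-new b c d rest ⟨
  snocProfile b c (0 , (d , proj₁ rest) ∷ proj₂ rest)
    ≡⟨ cong (λ b′ → snocProfile b′ c (0 , (d , proj₁ rest) ∷ proj₂ rest))
            (trans (cong (_∨ occurs c cy) (∨-comm (does (c Fin.≟ d)) (occurs c S))) (∨-assoc (occurs c S) _ _)) ⟩
  snocProfile (occurs c S ∨ (does (c Fin.≟ d) ∨ occurs c cy)) c (0 , (d , proj₁ rest) ∷ proj₂ rest) ∎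
  where
  rest = profileFrom (d ∷ S) cy
  b = (does (c Fin.≟ d) ∨ occurs c S) ∨ occurs c cy

profile-∷ʳ-old : ∀ {n} (cy : List (Fin n)) c → occurs c cy ≡ true → profile (cy ∷ʳ c) ≡ extendLast (profile cy)
profile-∷ʳ-old cy c c∈cy = begin
  proj₂ (profileFrom [] (cy ∷ʳ c))
    ≡⟨ cong proj₂ (profileFrom-∷ʳ [] cy c) ⟩
  proj₂ (snocProfile (occurs c cy) c (profileFrom [] cy))
    ≡⟨ cong₂ (λ b p → proj₂ (snocProfile b c p)) c∈cy (profileFrom-[] cy) ⟩
  proj₂ (snocProfile true c (0 , profile cy))
    ≡⟨ snoc-old (profile cy) ⟩
  extendLast (profile cy) ∎
  where
  snoc-old : ∀ es → proj₂ (snocProfile true c (0 , es)) ≡ extendLast es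
  snoc-old [] = refl
  snoc-old (e ∷ es) = refl

profile-∷ʳ-new : ∀ {n} (cy : List (Fin n)) c → occurs c cy ≡ false → profile (cy ∷ʳ c) ≡ profile cy ∷ʳ (c , 0)
profile-∷ʳ-new cy c c∉cy = trans (cong proj₂ (profileFrom-∷ʳ [] cy c))
  (cong₂ (λ b p → proj₂ (snocProfile b c p)) c∉cy (profileFrom-[] cy))

xPlacementsᵖ : ∀ {n} → Profile n → List ℕ → ℕ → Vec ℕ n → ℕ
xPlacementsᵖ [] βs s a = 𝟙=0 s
xPlacementsᵖ ((c , g) ∷ es) βs s a = binom s (lookup a c) * xPlacementsᵖ es (drop (suc g) βs) (s ∸ lookup a c + sum (take (suc g) βs)) a

sum-take-suc : ∀ k βs → sum (take (suc k) βs) ≡ head₀ βs + sum (take k (drop 1 βs))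
sum-take-suc k [] = cong (λ l → 0 + sum l) (sym (Listₚ.take-[] k))
sum-take-suc k (b ∷ βs) = refl

-- Once a factor has been met its x's are all placed, so clearing them changes nothing.
xPlacements≡xPlacementsᵖ-from : ∀ {n} (S cy : List (Fin n)) βs s (a₀ a : Vec ℕ n) →
  (∀ i → occurs i S ≡ true → lookup a i ≡ 0) → (∀ i → occurs i S ≡ false → lookup a i ≡ lookup a₀ i) →
  xPlacements cy βs s a ≡ xPlacementsᵖ (proj₂ (profileFrom S cy)) (drop (proj₁ (profileFrom S cy)) βs) (s + sum (take (proj₁ (profileFrom S cy)) βs)) a₀
xPlacements≡xPlacementsᵖ-from S [] βs s a₀ a seen unseen = cong 𝟙=0 (sym (+-identityʳ s))
xPlacements≡xPlacementsᵖ-from S (c ∷ cy) βs s a₀ a seen unseen with occurs c S in c∈S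
... | true = begin
  binom s (lookup a c) * xPlacements cy (drop 1 βs) (s ∸ lookup a c + head₀ βs) (clearAt a c)
    ≡⟨ cong (λ k → binom s k * xPlacements cy (drop 1 βs) (s ∸ k + head₀ βs) (clearAt a c)) (seen c c∈S) ⟩
  xPlacements cy (drop 1 βs) (s + head₀ βs) (clearAt a c) + 0
    ≡⟨ +-identityʳ _ ⟩
  xPlacements cy (drop 1 βs) (s + head₀ βs) (clearAt a c)
    ≡⟨ cong (xPlacements cy (drop 1 βs) (s + head₀ βs)) (updateAt-id-local c a (sym (seen c c∈S))) ⟩
  xPlacements cy (drop 1 βs) (s + head₀ βs) a
    ≡⟨ xPlacements≡xPlacementsᵖ-from S cy (drop 1 βs) (s + head₀ βs) a₀ a seen unseen ⟩
  xPlacementsᵖ es (drop k (drop 1 βs)) (s + head₀ βs + sum (take k (drop 1 βs))) a₀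
    ≡⟨ cong₂ (λ u v → xPlacementsᵖ es u v a₀) (Listₚ.drop-drop 1 k βs) (trans (+-assoc s _ _) (cong (s +_) (sym (sum-take-suc k βs)))) ⟩
  xPlacementsᵖ es (drop (suc k) βs) (s + sum (take (suc k) βs)) a₀ ∎
  where
  k = proj₁ (profileFrom S cy)
  es = proj₂ (profileFrom S cy)
... | false = begin
  binom s (lookup a c) * xPlacements cy (drop 1 βs) (s ∸ lookup a c + head₀ βs) (clearAt a c)
    ≡⟨ cong (λ k → binom s k * xPlacements cy (drop 1 βs) (s ∸ k + head₀ βs) (clearAt a c)) (unseen c c∈S) ⟩
  binom s (lookup a₀ c) * xPlacements cy (drop 1 βs) (s ∸ lookup a₀ c + head₀ βs) (clearAt a c)
    ≡⟨ cong (binom s (lookup a₀ c) *_) (xPlacements≡xPlacementsᵖ-from (c ∷ S) cy (drop 1 βs) (s ∸ lookup a₀ c + head₀ βs) a₀ (clearAt a c) seen′ unseen′) ⟩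
  binom s (lookup a₀ c) * xPlacementsᵖ es (drop k (drop 1 βs)) (s ∸ lookup a₀ c + head₀ βs + sum (take k (drop 1 βs))) a₀
    ≡⟨ cong₂ (λ u v → binom u (lookup a₀ c) * xPlacementsᵖ es (drop k (drop 1 βs)) v a₀) (sym (+-identityʳ s))
             (trans (+-assoc (s ∸ lookup a₀ c) _ _) (cong₂ _+_ (cong (_∸ lookup a₀ c) (sym (+-identityʳ s))) (sym (sum-take-suc k βs)))) ⟩
  binom (s + 0) (lookup a₀ c) * xPlacementsᵖ es (drop k (drop 1 βs)) (s + 0 ∸ lookup a₀ c + sum (take (suc k) βs)) a₀
    ≡⟨ cong (λ u → binom (s + 0) (lookup a₀ c) * xPlacementsᵖ es u (s + 0 ∸ lookup a₀ c + sum (take (suc k) βs)) a₀) (Listₚ.drop-drop 1 k βs) ⟩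
  binom (s + 0) (lookup a₀ c) * xPlacementsᵖ es (drop (suc k) βs) (s + 0 ∸ lookup a₀ c + sum (take (suc k) βs)) a₀ ∎
  where
  k = proj₁ (profileFrom (c ∷ S) cy)
  es = proj₂ (profileFrom (c ∷ S) cy)
  seen′ : ∀ i → occurs i (c ∷ S) ≡ true → lookup (clearAt a c) i ≡ 0
  seen′ i i∈cS with i Fin.≟ c
  ... | yes refl = lookup∘updateAt i a
  ... | no i≢c = trans (lookup∘updateAt′ i c i≢c a) (seen i i∈cS)
  unseen′ : ∀ i → occurs i (c ∷ S) ≡ false → lookup (clearAt a c) i ≡ lookup a₀ i
  unseen′ i i∉cS with i Fin.≟ c
  ... | yes refl with () ← i∉cS
  ... | no i≢c = trans (lookup∘updateAt′ i c i≢c a) (unseen i i∉cS)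

xPlacements≡xPlacementsᵖ : ∀ {n} (cy : List (Fin n)) βs s (a : Vec ℕ n) → xPlacements cy βs s a ≡ xPlacementsᵖ (profile cy) βs s a
xPlacements≡xPlacementsᵖ cy βs s a = begin
  xPlacements cy βs s a
    ≡⟨ xPlacements≡xPlacementsᵖ-from [] cy βs s a a (λ i ()) (λ i _ → refl) ⟩
  xPlacementsᵖ (proj₂ (profileFrom [] cy)) (drop (proj₁ (profileFrom [] cy)) βs) (s + sum (take (proj₁ (profileFrom [] cy)) βs)) a
    ≡⟨ cong (λ p → xPlacementsᵖ (proj₂ p) (drop (proj₁ p) βs) (s + sum (take (proj₁ p) βs)) a) (profileFrom-[] cy) ⟩
  xPlacementsᵖ (profile cy) βs (s + 0) a
    ≡⟨ cong (λ k → xPlacementsᵖ (profile cy) βs k a) (+-identityʳ s) ⟩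
  xPlacementsᵖ (profile cy) βs s a ∎

-- Chains of binomial coefficients

-- A step (g , b), the steps being read from right to left: g new free slots appear, then b of the
-- free slots are filled. The result records the free slots left and the number of ways.
fillings : ℕ × ℕ → List (ℕ × ℕ) → ℕ × ℕ
fillings st [] = st
fillings st ((g , b) ∷ ps) = (proj₁ (fillings st ps) + g ∸ b , binom (proj₁ (fillings st ps) + g) b * proj₂ (fillings st ps))

fillings-++ : ∀ st ps qs → fillings st (ps ++ qs) ≡ fillings (fillings st qs) ps
fillings-++ st [] qs = refl
fillings-++ st ((g , b) ∷ ps) qs = cong (λ p → (proj₁ p + g ∸ b , binom (proj₁ p + g) b * proj₂ p)) (fillings-++ st ps qs)

fillings-scale₁ : ∀ lo w ps → proj₁ (fillings (lo , w) ps) ≡ proj₁ (fillings (lo , 1) ps)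
fillings-scale₁ lo w [] = refl
fillings-scale₁ lo w ((g , b) ∷ ps) = cong (λ k → k + g ∸ b) (fillings-scale₁ lo w ps)

fillings-scale₂ : ∀ lo w ps → proj₂ (fillings (lo , w) ps) ≡ proj₂ (fillings (lo , 1) ps) * w
fillings-scale₂ lo w [] = sym (*-identityˡ w)
fillings-scale₂ lo w ((g , b) ∷ ps) = begin
  binom (proj₁ (fillings (lo , w) ps) + g) b * proj₂ (fillings (lo , w) ps)
    ≡⟨ cong₂ (λ u v → binom (u + g) b * v) (fillings-scale₁ lo w ps) (fillings-scale₂ lo w ps) ⟩
  binom (proj₁ (fillings (lo , 1) ps) + g) b * (proj₂ (fillings (lo , 1) ps) * w)
    ≡⟨ *-assoc (binom (proj₁ (fillings (lo , 1) ps) + g) b) _ w ⟨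
  binom (proj₁ (fillings (lo , 1) ps) + g) b * proj₂ (fillings (lo , 1) ps) * w ∎

weighted : ℕ → (ℕ → ℕ) → List (ℕ × ℕ) → ℕ
weighted lo f ps = proj₂ (fillings (lo , 1) ps) * f (proj₁ (fillings (lo , 1) ps))

decrements : List (ℕ × ℕ) → List (List (ℕ × ℕ))
decrements [] = []
decrements ((g , zero) ∷ ps) = map ((g , zero) ∷_) (decrements ps)
decrements ((g , suc b) ∷ ps) = ((g , b) ∷ ps) ∷ map ((g , suc b) ∷_) (decrements ps)

-- Pascal's rule for chains: an extra initial free slot is filled at some step, or stays free.
mutual
  weighted-suc : ∀ ps lo (f : ℕ → ℕ) →
    weighted (suc lo) f ps ≡ ∑ (weighted lo f) (decrements ps) + proj₂ (fillings (lo , 1) ps) * f (suc (proj₁ (fillings (lo , 1) ps)))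
  weighted-suc [] lo f = refl
  weighted-suc ((g , zero) ∷ ps) lo f = trans (weighted-suc-∷ g zero ps lo f)
    (cong (∑ (weighted lo f) (map ((g , zero) ∷_) (decrements ps)) +_) (rearrange (proj₂ (fillings (lo , 1) ps)) _))
    where
    rearrange : ∀ w u → w * (1 * u) ≡ 1 * w * u
    rearrange = solve-∀
  weighted-suc ((g , suc b) ∷ ps) lo f = trans (weighted-suc-∷ g (suc b) ps lo f) (begin
    S + w * ((binom t b + binom t (suc b)) * f (t ∸ b))
      ≡⟨ cong (λ z → S + w * z) (*-distribʳ-+ (f (t ∸ b)) (binom t b) (binom t (suc b))) ⟩
    S + w * (binom t b * f (t ∸ b) + binom t (suc b) * f (t ∸ b))
      ≡⟨ cong (λ z → S + w * (binom t b * f (t ∸ b) + z)) last-slot ⟩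
    S + w * (binom t b * f (t ∸ b) + binom t (suc b) * f (suc (t ∸ suc b)))
      ≡⟨ rearrange S w (binom t b) (binom t (suc b)) (f (t ∸ b)) (f (suc (t ∸ suc b))) ⟩
    binom t b * w * f (t ∸ b) + S + binom t (suc b) * w * f (suc (t ∸ suc b)) ∎)
    where
    w = proj₂ (fillings (lo , 1) ps)
    t = proj₁ (fillings (lo , 1) ps) + g
    S = ∑ (weighted lo f) (map ((g , suc b) ∷_) (decrements ps))
    last-slot : binom t (suc b) * f (t ∸ b) ≡ binom t (suc b) * f (suc (t ∸ suc b))
    last-slot with b <? t
    ... | yes b<t = cong (λ k → binom t (suc b) * f k) (+-∸-assoc 1 b<t)
    ... | no b≮t = trans (cong (_* f (t ∸ b)) t<1+b) (sym (cong (_* f (suc (t ∸ suc b))) t<1+b))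
      where
      t<1+b = binom-< (s≤s (≮⇒≥ b≮t))
    rearrange : ∀ S w A C u v → S + w * (A * u + C * v) ≡ A * w * u + S + C * w * v
    rearrange = solve-∀

  weighted-suc-∷ : ∀ g b ps lo (f : ℕ → ℕ) →
    weighted (suc lo) f ((g , b) ∷ ps) ≡
    ∑ (weighted lo f) (map ((g , b) ∷_) (decrements ps)) + proj₂ (fillings (lo , 1) ps) * (binom (suc (proj₁ (fillings (lo , 1) ps) + g)) b * f (suc (proj₁ (fillings (lo , 1) ps) + g) ∸ b))
  weighted-suc-∷ g b ps lo f = begin
    weighted (suc lo) f ((g , b) ∷ ps)
      ≡⟨ rearrange (binom (proj₁ (fillings (suc lo , 1) ps) + g) b) (proj₂ (fillings (suc lo , 1) ps)) _ ⟩
    weighted (suc lo) h ps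
      ≡⟨ weighted-suc ps lo h ⟩
    ∑ (weighted lo h) (decrements ps) + proj₂ (fillings (lo , 1) ps) * h (suc (proj₁ (fillings (lo , 1) ps)))
      ≡⟨ cong (_+ proj₂ (fillings (lo , 1) ps) * h (suc (proj₁ (fillings (lo , 1) ps)))) step-prepended ⟩
    ∑ (weighted lo f) (map ((g , b) ∷_) (decrements ps)) + proj₂ (fillings (lo , 1) ps) * h (suc (proj₁ (fillings (lo , 1) ps))) ∎
    where
    h : ℕ → ℕ
    h k = binom (k + g) b * f (k + g ∸ b)
    rearrange : ∀ u v w → u * v * w ≡ v * (u * w)
    rearrange = solve-∀
    step-prepended : ∑ (weighted lo h) (decrements ps) ≡ ∑ (weighted lo f) (map ((g , b) ∷_) (decrements ps))
    step-prepended = sym (trans (∑-map (weighted lo f) ((g , b) ∷_) (decrements ps))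
      (∑-cong (decrements ps) (λ q → rearrange (binom (proj₁ (fillings (lo , 1) q) + g) b) (proj₂ (fillings (lo , 1) q)) _)))

-- Counting the arrangements with a given profile

occurs⇒∈ : ∀ {n} (c : Fin n) cs → occurs c cs ≡ true → c ∈ cs
occurs⇒∈ c (d ∷ cs) c∈ with c Fin.≟ d
... | yes refl = here refl
... | no _ = there (occurs⇒∈ c cs c∈)

∈⇒occurs : ∀ {n} (c : Fin n) cs → c ∈ cs → occurs c cs ≡ true
∈⇒occurs c (d ∷ cs) (here refl) with c Fin.≟ c
... | yes _ = refl
... | no c≢c = ⊥-elim (c≢c refl)
∈⇒occurs c (d ∷ cs) (there c∈cs) with c Fin.≟ d
... | yes _ = refl
... | no _ = ∈⇒occurs c cs c∈cs

occurs-++ : ∀ {n} (c : Fin n) cs ds → occurs c (cs ++ ds) ≡ occurs c cs ∨ occurs c ds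
occurs-++ c [] ds = refl
occurs-++ c (d ∷ cs) ds = trans (cong (does (c Fin.≟ d) ∨_) (occurs-++ c cs ds)) (sym (∨-assoc (does (c Fin.≟ d)) _ _))

occurs-∷ʳ : ∀ {n} (c d : Fin n) cs → occurs c (cs ∷ʳ d) ≡ occurs c cs ∨ does (c Fin.≟ d)
occurs-∷ʳ c d cs = trans (occurs-++ c cs [ d ]) (cong (occurs c cs ∨_) (∨-identityʳ _))

occurs-∷ʳ-self : ∀ {n} (c : Fin n) cs → occurs c (cs ∷ʳ c) ≡ true
occurs-∷ʳ-self c cs = trans (occurs-∷ʳ c c cs) (trans (cong (occurs c cs ∨_) (dec-true (c Fin.≟ c) refl)) (∨-zeroʳ _))

occurs-∷ʳ-≢ : ∀ {n} (c d : Fin n) cs → c ≢ d → occurs c (cs ∷ʳ d) ≡ occurs c cs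
occurs-∷ʳ-≢ c d cs c≢d = trans (occurs-∷ʳ c d cs) (trans (cong (occurs c cs ∨_) (dec-false (c Fin.≟ d) c≢d)) (∨-identityʳ _))

_≟ᵖ_ : ∀ {n} → DecidableEquality (Profile n)
_≟ᵖ_ = Listₚ.≡-dec (×-≡-dec Fin._≟_ ℕ._≟_)

module KroneckerProfile {n : ℕ} = Kronecker (_≟ᵖ_ {n})
open KroneckerProfile using () renaming (δ to δᵖ; δ-refl to δᵖ-refl; δ-≡ to δᵖ-≡; δ-≢ to δᵖ-≢; δ-transport to δᵖ-transport)

colours : ∀ {n} → Profile n → List (Fin n)
colours = map proj₁

Distinct : ∀ {n} → List (Fin n) → Set
Distinct [] = ⊤
Distinct (c ∷ cs) = occurs c cs ≡ false × Distinct cs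

profileLength : ∀ {n} → Profile n → ℕ
profileLength = ∑ (λ e → suc (proj₂ e))

ValidProfile : ∀ {n} → ℕ → Vec ℕ n → Profile n → Set
ValidProfile R r es = Distinct (colours es) × (∀ c → occurs c (colours es) ≡ true → 1 ≤ lookup r c) ×
                      (∀ c → occurs c (colours es) ≡ false → lookup r c ≡ 0) × profileLength es ≡ R

-- The first y of a factor is placed by the profile; the chain then places the other (lookup r c - 1).
toStep : ∀ {n} → Vec ℕ n → Fin n × ℕ → ℕ × ℕ
toStep r (c , g) = (g , pred (lookup r c))

exactCount : List (ℕ × ℕ) → ℕ
exactCount = weighted 0 𝟙=0

profileCount : ∀ {n} → Profile n → Vec ℕ n → ℕ
profileCount es r = exactCount (map (toStep r) es)

exactCount-∷ʳ-zero : ∀ ps b → exactCount (ps ∷ʳ (0 , b)) ≡ 𝟙=0 b * exactCount ps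
exactCount-∷ʳ-zero ps b = begin
  proj₂ (fillings (0 , 1) (ps ∷ʳ (0 , b))) * 𝟙=0 (proj₁ (fillings (0 , 1) (ps ∷ʳ (0 , b))))
    ≡⟨ cong (λ p → proj₂ p * 𝟙=0 (proj₁ p)) (fillings-++ (0 , 1) ps [ (0 , b) ]) ⟩
  proj₂ (fillings (0 ∸ b , binom 0 b * 1) ps) * 𝟙=0 (proj₁ (fillings (0 ∸ b , binom 0 b * 1) ps))
    ≡⟨ cong₂ (λ u v → proj₂ (fillings (u , v * 1) ps) * 𝟙=0 (proj₁ (fillings (u , v * 1) ps))) (0∸n≡0 b) (binom-zeroˡ b) ⟩
  proj₂ (fillings (0 , 𝟙=0 b * 1) ps) * 𝟙=0 (proj₁ (fillings (0 , 𝟙=0 b * 1) ps))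
    ≡⟨ cong₂ (λ u v → u * 𝟙=0 v) (fillings-scale₂ 0 _ ps) (fillings-scale₁ 0 _ ps) ⟩
  proj₂ (fillings (0 , 1) ps) * (𝟙=0 b * 1) * 𝟙=0 (proj₁ (fillings (0 , 1) ps))
    ≡⟨ rearrange (proj₂ (fillings (0 , 1) ps)) (𝟙=0 b) (𝟙=0 (proj₁ (fillings (0 , 1) ps))) ⟩
  𝟙=0 b * exactCount ps ∎
  where
  rearrange : ∀ w z u → w * (z * 1) * u ≡ z * (w * u)
  rearrange = solve-∀

exactCount-∷ʳ-suc : ∀ ps g b → exactCount (ps ∷ʳ (suc g , b)) ≡ weighted 1 𝟙=0 (ps ∷ʳ (g , b))
exactCount-∷ʳ-suc ps g b = cong (λ p → proj₂ p * 𝟙=0 (proj₁ p))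
  (trans (fillings-++ (0 , 1) ps [ (suc g , b) ]) (sym (fillings-++ (1 , 1) ps [ (g , b) ])))

map-toStep-decAt : ∀ {n} (es : Profile n) r c → occurs c (colours es) ≡ false → map (toStep (decAt r c)) es ≡ map (toStep r) es
map-toStep-decAt [] r c _ = refl
map-toStep-decAt ((d , g) ∷ es) r c c∉ with c Fin.≟ d
... | no c≢d = cong₂ _∷_ (cong (λ k → (g , pred k)) (lookup∘updateAt′ d c (c≢d ∘ sym) r)) (map-toStep-decAt es r c c∉)
... | yes refl with () ← c∉

-- Lowering the step of entry e means lowering the y-count of its colour; pre is an already
-- processed prefix, whose steps are unaffected.
∑-decrements-toStep : ∀ {n} (r : Vec ℕ n) (pre es : Profile n) →
  (∀ e → e ∈ es → occurs (proj₁ e) (colours pre) ≡ false) → Distinct (colours es) →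
  ∑ (λ q → exactCount (map (toStep r) pre ++ q)) (decrements (map (toStep r) es)) ≡
  ∑ (λ e → 𝟙>0 (pred (lookup r (proj₁ e))) * profileCount (pre ++ es) (decAt r (proj₁ e))) es
∑-decrements-toStep r pre [] _ _ = refl
∑-decrements-toStep r pre ((c , g) ∷ es) fresh (c∉es , distinct) = split (pred (lookup r c)) refl
  where
  P = map (toStep r) pre
  Q = map (toStep r) es
  pre′ = pre ∷ʳ (c , g)
  fresh′ : ∀ e → e ∈ es → occurs (proj₁ e) (colours pre′) ≡ false
  fresh′ e e∈es = trans (cong (occurs (proj₁ e)) (Listₚ.map-++ proj₁ pre [ (c , g) ]))
    (trans (occurs-∷ʳ-≢ (proj₁ e) c (colours pre) e≢c) (fresh e (there e∈es)))
    where
    e≢c : proj₁ e ≢ c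
    e≢c refl with () ← trans (sym (∈⇒occurs c (colours es) (∈-map⁺ proj₁ e∈es))) c∉es
  Rest = ∑ (λ e → 𝟙>0 (pred (lookup r (proj₁ e))) * profileCount (pre ++ (c , g) ∷ es) (decAt r (proj₁ e))) es
  later : ∑ (λ q → exactCount (P ++ ((g , pred (lookup r c)) ∷ q))) (decrements Q) ≡ Rest
  later = trans (∑-cong (decrements Q) (λ q → cong exactCount (sym (trans (cong (_++ q) (Listₚ.map-++ (toStep r) pre [ (c , g) ])) (Listₚ.++-assoc P _ q)))))
    (trans (∑-decrements-toStep r pre′ es fresh′ distinct)
           (∑-cong es (λ e → cong (λ es′ → 𝟙>0 (pred (lookup r (proj₁ e))) * profileCount es′ (decAt r (proj₁ e))) (Listₚ.++-assoc pre [ (c , g) ] es))))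
  lowered : map (toStep (decAt r c)) (pre ++ (c , g) ∷ es) ≡ P ++ ((g , pred (pred (lookup r c))) ∷ Q)
  lowered = trans (Listₚ.map-++ (toStep (decAt r c)) pre ((c , g) ∷ es))
    (cong₂ _++_ (map-toStep-decAt pre r c (fresh (c , g) (here refl)))
                (cong₂ _∷_ (cong (λ k → (g , pred k)) (lookup∘updateAt c r)) (map-toStep-decAt es r c c∉es)))
  split : ∀ b → pred (lookup r c) ≡ b →
    ∑ (λ q → exactCount (P ++ q)) (decrements ((g , b) ∷ Q)) ≡ 𝟙>0 b * profileCount (pre ++ (c , g) ∷ es) (decAt r c) + Rest
  split zero r_c≡ = trans (∑-map (λ q → exactCount (P ++ q)) ((g , zero) ∷_) (decrements Q))
    (subst (λ k → ∑ (λ q → exactCount (P ++ ((g , k) ∷ q))) (decrements Q) ≡ Rest) r_c≡ later)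
  split (suc b) r_c≡ = cong₂ _+_
    (sym (trans (+-identityʳ _) (trans (cong exactCount lowered) (cong (λ k → exactCount (P ++ ((g , pred k) ∷ Q))) r_c≡))))
    (trans (∑-map (λ q → exactCount (P ++ q)) ((g , suc b) ∷_) (decrements Q))
           (subst (λ k → ∑ (λ q → exactCount (P ++ ((g , k) ∷ q))) (decrements Q) ≡ Rest) r_c≡ later))

∑-Distinct : ∀ {n} (cs : List (Fin n)) → Distinct cs → (h : Fin n → ℕ) → ∑ h cs ≡ ∑[ c < n ] (𝟙 (occurs c cs) * h c)
∑-Distinct {n} [] _ h = sym (∑ᶠ-zero n)
∑-Distinct {n} (e ∷ cs) (e∉cs , distinct) h = begin
  h e + ∑ h cs
    ≡⟨ cong₂ _+_ (sym (∑ᶠ-pick n e h)) (∑-Distinct cs distinct h) ⟩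
  ∑[ c < n ] (δᶠ c e * h c) + ∑[ c < n ] (𝟙 (occurs c cs) * h c)
    ≡⟨ ∑-distrib-+ (λ c → δᶠ c e * h c) (λ c → 𝟙 (occurs c cs) * h c) ⟨
  ∑[ c < n ] (δᶠ c e * h c + 𝟙 (occurs c cs) * h c)
    ≡⟨ sum-cong-≗ summand ⟩
  ∑[ c < n ] (𝟙 (occurs c (e ∷ cs)) * h c) ∎
  where
  summand : ∀ c → δᶠ c e * h c + 𝟙 (occurs c cs) * h c ≡ 𝟙 (occurs c (e ∷ cs)) * h c
  summand c with c Fin.≟ e
  ... | yes refl = trans (cong (λ b → 1 * h c + 𝟙 b * h c) e∉cs) (+-identityʳ _)
  ... | no _ = refl

Distinct-∷ʳ⁻ : ∀ {n} (cs : List (Fin n)) c → Distinct (cs ∷ʳ c) → Distinct cs × occurs c cs ≡ false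
Distinct-∷ʳ⁻ [] c _ = tt , refl
Distinct-∷ʳ⁻ (d ∷ cs) c (d∉csc , distinct) with Distinct-∷ʳ⁻ cs c distinct
... | distinct′ , c∉cs = (∨-conicalˡ _ _ (trans (sym (occurs-∷ʳ d c cs)) d∉csc) , distinct′) , c∉dcs
  where
  c∉dcs : does (c Fin.≟ d) ∨ occurs c cs ≡ false
  c∉dcs with c Fin.≟ d
  ... | no _ = c∉cs
  ... | yes refl with () ← trans (sym (occurs-∷ʳ-self c cs)) d∉csc

profileLength-∷ʳ : ∀ {n} (es : Profile n) c g → profileLength (es ∷ʳ (c , g)) ≡ profileLength es + suc g
profileLength-∷ʳ es c g = trans (∑-++ _ es _) (cong (profileLength es +_) (+-identityʳ _))

profile-≢[] : ∀ {n} (cy : List (Fin n)) c → occurs c cy ≡ true → profile cy ≢ []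
profile-≢[] (d ∷ cy) c _ ()

δᵖ-extendLast-∷ʳ-zero : ∀ {n} (es init : Profile n) d → es ≢ [] → δᵖ (extendLast es) (init ∷ʳ (d , 0)) ≡ 0
δᵖ-extendLast-∷ʳ-zero es init d es≢[] with reverseView es
... | [] = ⊥-elim (es≢[] refl)
... | es′ ∶ _ ∶ʳ (c , g) = δᵖ-≢ λ eq → suc≢0 (cong proj₂ (proj₂ (Listₚ.∷ʳ-injective es′ init (trans (sym (extendLast-∷ʳ es′ c g)) eq))))
  where
  suc≢0 : suc g ≢ 0
  suc≢0 ()

δᵖ-extendLast-∷ʳ-suc : ∀ {n} (es init : Profile n) d g → es ≢ [] → δᵖ (extendLast es) (init ∷ʳ (d , suc g)) ≡ δᵖ es (init ∷ʳ (d , g))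
δᵖ-extendLast-∷ʳ-suc es init d g es≢[] with reverseView es
... | [] = ⊥-elim (es≢[] refl)
... | es′ ∶ _ ∶ʳ (c , g′) = trans (cong (λ p → δᵖ p (init ∷ʳ (d , suc g))) (extendLast-∷ʳ es′ c g′)) same
  where
  same : δᵖ (es′ ∷ʳ (c , suc g′)) (init ∷ʳ (d , suc g)) ≡ δᵖ (es′ ∷ʳ (c , g′)) (init ∷ʳ (d , g))
  same with (es′ ∷ʳ (c , g′)) ≟ᵖ (init ∷ʳ (d , g))
  ... | yes eq with Listₚ.∷ʳ-injective es′ init eq
  ...   | refl , refl = δᵖ-refl (es′ ∷ʳ (c , suc g′))
  same | no ne = δᵖ-≢ λ eq → ne (unsuc (Listₚ.∷ʳ-injective es′ init eq))
    where
    unsuc : es′ ≡ init × (c , suc g′) ≡ (d , suc g) → es′ ∷ʳ (c , g′) ≡ init ∷ʳ (d , g)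
    unsuc (refl , refl) = refl

δᵖ-∷ʳ-zero-zero : ∀ {n} (es init : Profile n) c d → δᵖ (es ∷ʳ (c , 0)) (init ∷ʳ (d , 0)) ≡ δᶠ c d * δᵖ es init
δᵖ-∷ʳ-zero-zero es init c d with es ≟ᵖ init | c Fin.≟ d
... | yes refl | yes refl = δᵖ-refl (es ∷ʳ (c , 0))
... | yes refl | no c≢d = δᵖ-≢ λ eq → c≢d (cong proj₁ (proj₂ (Listₚ.∷ʳ-injective es es eq)))
... | no es≢init | c≟d = trans (δᵖ-≢ λ eq → es≢init (proj₁ (Listₚ.∷ʳ-injective es init eq))) (sym (*-zeroʳ (𝟙 (does c≟d))))

δᵖ-∷ʳ-zero-suc : ∀ {n} (es init : Profile n) c d g → δᵖ (es ∷ʳ (c , 0)) (init ∷ʳ (d , suc g)) ≡ 0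
δᵖ-∷ʳ-zero-suc es init c d g = δᵖ-≢ λ eq → 0≢suc (cong proj₂ (proj₂ (Listₚ.∷ʳ-injective es init eq)))
  where
  0≢suc : 0 ≢ suc g
  0≢suc ()

SameSupport-occurs : ∀ {n} (r : Vec ℕ n) cy c → SameSupport r cy → occurs c cy ≡ true → 1 ≤ lookup r c
SameSupport-occurs r cy c (_ , inSupport) c∈ = inSupport c (occurs⇒∈ c cy c∈)

SameSupport-¬occurs : ∀ {n} (r : Vec ℕ n) cy c → SameSupport r cy → occurs c cy ≡ false → lookup r c ≡ 0
SameSupport-¬occurs r cy c (covers , _) c∉ with lookup r c in r_c≡
... | zero = refl
... | suc _ with () ← trans (sym (∈⇒occurs c cy (covers c (subst (1 ≤_) (sym r_c≡) (s≤s z≤n))))) c∉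

-- Appending the letter c to an arrangement cy of decAt r c: a new letter closes the profile with
-- a zero gap, an old one lengthens the last gap.
δᵖ-profile-∷ʳ-zero : ∀ {n} (r : Vec ℕ n) cy c (init : Profile n) d → SameSupport (decAt r c) cy →
  δᵖ (profile (cy ∷ʳ c)) (init ∷ʳ (d , 0)) ≡ 𝟙=0 (pred (lookup r c)) * (δᶠ c d * δᵖ (profile cy) init)
δᵖ-profile-∷ʳ-zero r cy c init d supp with occurs c cy in c∈?
... | true = begin
  δᵖ (profile (cy ∷ʳ c)) (init ∷ʳ (d , 0))  ≡⟨ cong (λ p → δᵖ p (init ∷ʳ (d , 0))) (profile-∷ʳ-old cy c c∈?) ⟩
  δᵖ (extendLast (profile cy)) (init ∷ʳ (d , 0)) ≡⟨ δᵖ-extendLast-∷ʳ-zero (profile cy) init d (profile-≢[] cy c c∈?) ⟩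
  0 ≡⟨ 𝟙=0-vanish (pred (lookup r c)) (λ r_c≡1 → ⊥-elim (1≰0 (subst (1 ≤_) (trans (lookup∘updateAt c r) r_c≡1) (SameSupport-occurs (decAt r c) cy c supp c∈?)))) ⟨
  𝟙=0 (pred (lookup r c)) * (δᶠ c d * δᵖ (profile cy) init) ∎
... | false = begin
  δᵖ (profile (cy ∷ʳ c)) (init ∷ʳ (d , 0))  ≡⟨ cong (λ p → δᵖ p (init ∷ʳ (d , 0))) (profile-∷ʳ-new cy c c∈?) ⟩
  δᵖ (profile cy ∷ʳ (c , 0)) (init ∷ʳ (d , 0)) ≡⟨ δᵖ-∷ʳ-zero-zero (profile cy) init c d ⟩
  δᶠ c d * δᵖ (profile cy) init ≡⟨ +-identityʳ _ ⟨
  1 * (δᶠ c d * δᵖ (profile cy) init) ≡⟨ cong (λ k → 𝟙=0 k * (δᶠ c d * δᵖ (profile cy) init)) (trans (sym (lookup∘updateAt c r)) (SameSupport-¬occurs (decAt r c) cy c supp c∈?)) ⟨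
  𝟙=0 (pred (lookup r c)) * (δᶠ c d * δᵖ (profile cy) init) ∎

δᵖ-profile-∷ʳ-suc : ∀ {n} (r : Vec ℕ n) cy c (init : Profile n) d g → SameSupport (decAt r c) cy →
  δᵖ (profile (cy ∷ʳ c)) (init ∷ʳ (d , suc g)) ≡ 𝟙>0 (pred (lookup r c)) * δᵖ (profile cy) (init ∷ʳ (d , g))
δᵖ-profile-∷ʳ-suc r cy c init d g supp with occurs c cy in c∈?
... | true = begin
  δᵖ (profile (cy ∷ʳ c)) (init ∷ʳ (d , suc g)) ≡⟨ cong (λ p → δᵖ p (init ∷ʳ (d , suc g))) (profile-∷ʳ-old cy c c∈?) ⟩
  δᵖ (extendLast (profile cy)) (init ∷ʳ (d , suc g)) ≡⟨ δᵖ-extendLast-∷ʳ-suc (profile cy) init d g (profile-≢[] cy c c∈?) ⟩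
  δᵖ (profile cy) (init ∷ʳ (d , g)) ≡⟨ +-identityʳ _ ⟨
  1 * δᵖ (profile cy) (init ∷ʳ (d , g)) ≡⟨ cong (_* _) (𝟙>0-≥1 (subst (1 ≤_) (lookup∘updateAt c r) (SameSupport-occurs (decAt r c) cy c supp c∈?))) ⟨
  𝟙>0 (pred (lookup r c)) * δᵖ (profile cy) (init ∷ʳ (d , g)) ∎
... | false = begin
  δᵖ (profile (cy ∷ʳ c)) (init ∷ʳ (d , suc g)) ≡⟨ cong (λ p → δᵖ p (init ∷ʳ (d , suc g))) (profile-∷ʳ-new cy c c∈?) ⟩
  δᵖ (profile cy ∷ʳ (c , 0)) (init ∷ʳ (d , suc g)) ≡⟨ δᵖ-∷ʳ-zero-suc (profile cy) init c d g ⟩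
  0 ≡⟨ cong (λ k → 𝟙>0 k * δᵖ (profile cy) (init ∷ʳ (d , g))) (trans (sym (lookup∘updateAt c r)) (SameSupport-¬occurs (decAt r c) cy c supp c∈?)) ⟨
  𝟙>0 (pred (lookup r c)) * δᵖ (profile cy) (init ∷ʳ (d , g)) ∎

ValidProfile-∷ʳ-zero : ∀ {n} R (r : Vec ℕ n) init c → ValidProfile (suc R) r (init ∷ʳ (c , 0)) → pred (lookup r c) ≡ 0 →
  ValidProfile R (decAt r c) init
ValidProfile-∷ʳ-zero R r init c (distinct , inSupport , outSupport , len) r_c≡1 =
  proj₁ distinct′ , inSupport′ , outSupport′ , suc-injective (trans (+-comm 1 _) (trans (sym (profileLength-∷ʳ init c 0)) len))
  where
  coloursEq = Listₚ.map-++ proj₁ init [ (c , 0) ]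
  distinct′ = Distinct-∷ʳ⁻ (colours init) c (subst Distinct coloursEq distinct)
  inSupport′ : ∀ d → occurs d (colours init) ≡ true → 1 ≤ lookup (decAt r c) d
  inSupport′ d d∈ with d Fin.≟ c
  ... | yes refl with () ← trans (sym d∈) (proj₂ distinct′)
  ... | no d≢c = subst (1 ≤_) (sym (lookup∘updateAt′ d c d≢c r))
    (inSupport d (trans (cong (occurs d) coloursEq) (trans (occurs-∷ʳ-≢ d c (colours init) d≢c) d∈)))
  outSupport′ : ∀ d → occurs d (colours init) ≡ false → lookup (decAt r c) d ≡ 0
  outSupport′ d d∉ with d Fin.≟ c
  ... | yes refl = trans (lookup∘updateAt d r) r_c≡1
  ... | no d≢c = trans (lookup∘updateAt′ d c d≢c r)
    (outSupport d (trans (cong (occurs d) coloursEq) (trans (occurs-∷ʳ-≢ d c (colours init) d≢c) d∉)))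

ValidProfile-∷ʳ-suc : ∀ {n} R (r : Vec ℕ n) init c g d → ValidProfile (suc R) r (init ∷ʳ (c , suc g)) →
  1 ≤ lookup r d → 1 ≤ pred (lookup r d) → ValidProfile R (decAt r d) (init ∷ʳ (c , g))
ValidProfile-∷ʳ-suc R r init c g d (distinct , inSupport , outSupport , len) r_d≥1 r_d≥2 =
  subst Distinct coloursEq distinct , inSupport′ , outSupport′ ,
  trans (profileLength-∷ʳ init c g) (suc-injective (trans (sym (+-suc (profileLength init) (suc g))) (trans (sym (profileLength-∷ʳ init c (suc g))) len)))
  where
  coloursEq = trans (Listₚ.map-++ proj₁ init [ (c , suc g) ]) (sym (Listₚ.map-++ proj₁ init [ (c , g) ]))
  inSupport′ : ∀ e → occurs e (colours (init ∷ʳ (c , g))) ≡ true → 1 ≤ lookup (decAt r d) e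
  inSupport′ e e∈ with e Fin.≟ d
  ... | yes refl = subst (1 ≤_) (sym (lookup∘updateAt e r)) r_d≥2
  ... | no e≢d = subst (1 ≤_) (sym (lookup∘updateAt′ e d e≢d r)) (inSupport e (trans (cong (occurs e) coloursEq) e∈))
  outSupport′ : ∀ e → occurs e (colours (init ∷ʳ (c , g))) ≡ false → lookup (decAt r d) e ≡ 0
  outSupport′ e e∉ with e Fin.≟ d
  ... | yes refl with () ← subst (1 ≤_) (outSupport e (trans (cong (occurs e) coloursEq) e∉)) r_d≥1
  outSupport′ e e∉ | no e≢d = trans (lookup∘updateAt′ e d e≢d r) (outSupport e (trans (cong (occurs e) coloursEq) e∉))

-- Pascal's rule for chains, read on profiles: the extra slot is taken by one of the colours.
profileCount-∷ʳ-suc : ∀ {n} R (r : Vec ℕ n) init c g → ValidProfile (suc R) r (init ∷ʳ (c , suc g)) →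
  ∑[ d < n ] (𝟙>0 (lookup r d) * (𝟙>0 (pred (lookup r d)) * profileCount (init ∷ʳ (c , g)) (decAt r d))) ≡ profileCount (init ∷ʳ (c , suc g)) r
profileCount-∷ʳ-suc {n} R r init c g (distinct , inSupport , outSupport , _) = begin
  ∑[ d < n ] (𝟙>0 (lookup r d) * (𝟙>0 (pred (lookup r d)) * profileCount es′ (decAt r d)))
    ≡⟨ sum-cong-≗ (λ d → cong (_* (𝟙>0 (pred (lookup r d)) * profileCount es′ (decAt r d))) (in-support d)) ⟨
  ∑[ d < n ] (𝟙 (occurs d (colours es′)) * (𝟙>0 (pred (lookup r d)) * profileCount es′ (decAt r d)))
    ≡⟨ ∑-Distinct (colours es′) distinct′ (λ d → 𝟙>0 (pred (lookup r d)) * profileCount es′ (decAt r d)) ⟨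
  ∑ (λ d → 𝟙>0 (pred (lookup r d)) * profileCount es′ (decAt r d)) (colours es′)
    ≡⟨ ∑-map (λ d → 𝟙>0 (pred (lookup r d)) * profileCount es′ (decAt r d)) proj₁ es′ ⟩
  ∑ (λ e → 𝟙>0 (pred (lookup r (proj₁ e))) * profileCount es′ (decAt r (proj₁ e))) es′
    ≡⟨ ∑-decrements-toStep r [] es′ (λ _ _ → refl) distinct′ ⟨
  ∑ exactCount (decrements ps′)
    ≡⟨ trans (cong (∑ exactCount (decrements ps′) +_) (*-zeroʳ (proj₂ (fillings (0 , 1) ps′)))) (+-identityʳ _) ⟨
  ∑ exactCount (decrements ps′) + proj₂ (fillings (0 , 1) ps′) * 0
    ≡⟨ weighted-suc ps′ 0 𝟙=0 ⟨
  weighted 1 𝟙=0 ps′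
    ≡⟨ cong (weighted 1 𝟙=0) (Listₚ.map-++ (toStep r) init [ (c , g) ]) ⟩
  weighted 1 𝟙=0 (map (toStep r) init ∷ʳ (g , pred (lookup r c)))
    ≡⟨ exactCount-∷ʳ-suc (map (toStep r) init) g (pred (lookup r c)) ⟨
  exactCount (map (toStep r) init ∷ʳ (suc g , pred (lookup r c)))
    ≡⟨ cong exactCount (Listₚ.map-++ (toStep r) init [ (c , suc g) ]) ⟨
  profileCount (init ∷ʳ (c , suc g)) r ∎
  where
  es′ = init ∷ʳ (c , g)
  ps′ = map (toStep r) es′
  coloursEq = trans (Listₚ.map-++ proj₁ init [ (c , suc g) ]) (sym (Listₚ.map-++ proj₁ init [ (c , g) ]))
  distinct′ = subst Distinct coloursEq distinct
  in-support : ∀ d → 𝟙 (occurs d (colours es′)) ≡ 𝟙>0 (lookup r d)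
  in-support d with occurs d (colours es′) in d∈?
  ... | true = sym (𝟙>0-≥1 (inSupport d (trans (cong (occurs d) coloursEq) d∈?)))
  ... | false = cong 𝟙>0 (sym (outSupport d (trans (cong (occurs d) coloursEq) d∈?)))

mutual
  ∑-arrangements-profile : ∀ {n} R (r : Vec ℕ n) (es : Profile n) → ValidProfile R r es →
    ∑-arrangements R r (λ cy → δᵖ (profile cy) es) ≡ profileCount es r
  ∑-arrangements-profile zero r [] (_ , _ , outSupport , _) = trans (*-identityʳ _) (𝟙=0ᵛ-null r (λ c → outSupport c refl))
  ∑-arrangements-profile zero r (e ∷ es) (_ , _ , _ , ())
  ∑-arrangements-profile (suc R) r es valid with reverseView es
  ∑-arrangements-profile (suc R) r .[] (_ , _ , _ , ()) | []
  ... | init ∶ _ ∶ʳ (c , zero) = ∑-arrangements-profile-∷ʳ-zero R r init c valid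
  ... | init ∶ _ ∶ʳ (c , suc g) = ∑-arrangements-profile-∷ʳ-suc R r init c g valid

  ∑-arrangements-profile-∷ʳ-zero : ∀ {n} R (r : Vec ℕ n) init c → ValidProfile (suc R) r (init ∷ʳ (c , 0)) →
    ∑-arrangements (suc R) r (λ cy → δᵖ (profile cy) (init ∷ʳ (c , 0))) ≡ profileCount (init ∷ʳ (c , 0)) r
  ∑-arrangements-profile-∷ʳ-zero {n} R r init c valid@(distinct , inSupport , _ , _) = begin
    ∑-arrangements (suc R) r (λ cy → δᵖ (profile cy) es)
      ≡⟨ ∑-arrangements-snoc R r (λ cy → δᵖ (profile cy) es) ⟩
    ∑[ d < n ] (𝟙>0 (lookup r d) * ∑-arrangements R (decAt r d) (λ cy → δᵖ (profile (cy ∷ʳ d)) es))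
      ≡⟨ sum-cong-≗ (λ d → cong (𝟙>0 (lookup r d) *_) (last-letter d)) ⟩
    ∑[ d < n ] (𝟙>0 (lookup r d) * (𝟙=0 (pred (lookup r d)) * (δᶠ d c * Y d)))
      ≡⟨ sum-cong-≗ (λ d → rearrange (𝟙>0 (lookup r d)) (𝟙=0 (pred (lookup r d))) (δᶠ d c) (Y d)) ⟩
    ∑[ d < n ] (δᶠ d c * (𝟙>0 (lookup r d) * (𝟙=0 (pred (lookup r d)) * Y d)))
      ≡⟨ ∑ᶠ-pick n c (λ d → 𝟙>0 (lookup r d) * (𝟙=0 (pred (lookup r d)) * Y d)) ⟩
    𝟙>0 (lookup r c) * (𝟙=0 (pred (lookup r c)) * Y c)
      ≡⟨ 𝟙>0-cong (lookup r c) (λ _ → inner (pred (lookup r c)) refl) ⟩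
    𝟙>0 (lookup r c) * (𝟙=0 (pred (lookup r c)) * profileCount init r)
      ≡⟨ cong (_* (𝟙=0 (pred (lookup r c)) * profileCount init r)) (𝟙>0-≥1 r_c≥1) ⟩
    1 * (𝟙=0 (pred (lookup r c)) * profileCount init r)
      ≡⟨ *-identityˡ _ ⟩
    𝟙=0 (pred (lookup r c)) * profileCount init r
      ≡⟨ exactCount-∷ʳ-zero (map (toStep r) init) (pred (lookup r c)) ⟨
    exactCount (map (toStep r) init ∷ʳ (0 , pred (lookup r c)))
      ≡⟨ cong exactCount (Listₚ.map-++ (toStep r) init [ (c , 0) ]) ⟨
    profileCount es r ∎
    where
    es = init ∷ʳ (c , 0)
    Y = λ d → ∑-arrangements R (decAt r d) (λ cy → δᵖ (profile cy) init)
    rearrange : ∀ p q u v → p * (q * (u * v)) ≡ u * (p * (q * v))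
    rearrange = solve-∀
    coloursEq = Listₚ.map-++ proj₁ init [ (c , 0) ]
    c-new = proj₂ (Distinct-∷ʳ⁻ (colours init) c (subst Distinct coloursEq distinct))
    r_c≥1 = inSupport c (trans (cong (occurs c) coloursEq) (occurs-∷ʳ-self c (colours init)))
    last-letter : ∀ d → ∑-arrangements R (decAt r d) (λ cy → δᵖ (profile (cy ∷ʳ d)) es) ≡ 𝟙=0 (pred (lookup r d)) * (δᶠ d c * Y d)
    last-letter d = trans (∑-arrangements-cong R (decAt r d) (λ cy supp _ → δᵖ-profile-∷ʳ-zero r cy d init c supp))
      (trans (∑-arrangements-*ˡ R (decAt r d) (𝟙=0 (pred (lookup r d))) (λ cy → δᶠ d c * δᵖ (profile cy) init))
             (cong (𝟙=0 (pred (lookup r d)) *_) (∑-arrangements-*ˡ R (decAt r d) (δᶠ d c) (λ cy → δᵖ (profile cy) init))))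
    inner : ∀ k → pred (lookup r c) ≡ k → 𝟙=0 k * Y c ≡ 𝟙=0 k * profileCount init r
    inner zero r_c≡1 = cong (_+ 0) (trans (∑-arrangements-profile R (decAt r c) init (ValidProfile-∷ʳ-zero R r init c valid r_c≡1))
                                          (cong exactCount (map-toStep-decAt init r c c-new)))
    inner (suc k) _ = refl

  ∑-arrangements-profile-∷ʳ-suc : ∀ {n} R (r : Vec ℕ n) init c g → ValidProfile (suc R) r (init ∷ʳ (c , suc g)) →
    ∑-arrangements (suc R) r (λ cy → δᵖ (profile cy) (init ∷ʳ (c , suc g))) ≡ profileCount (init ∷ʳ (c , suc g)) r
  ∑-arrangements-profile-∷ʳ-suc {n} R r init c g valid = begin
    ∑-arrangements (suc R) r (λ cy → δᵖ (profile cy) es)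
      ≡⟨ ∑-arrangements-snoc R r (λ cy → δᵖ (profile cy) es) ⟩
    ∑[ d < n ] (𝟙>0 (lookup r d) * ∑-arrangements R (decAt r d) (λ cy → δᵖ (profile (cy ∷ʳ d)) es))
      ≡⟨ sum-cong-≗ (λ d → 𝟙>0-cong (lookup r d) (last-letter d)) ⟩
    ∑[ d < n ] (𝟙>0 (lookup r d) * (𝟙>0 (pred (lookup r d)) * profileCount es′ (decAt r d)))
      ≡⟨ profileCount-∷ʳ-suc R r init c g valid ⟩
    profileCount es r ∎
    where
    es = init ∷ʳ (c , suc g)
    es′ = init ∷ʳ (c , g)
    last-letter : ∀ d → 1 ≤ lookup r d →
      ∑-arrangements R (decAt r d) (λ cy → δᵖ (profile (cy ∷ʳ d)) es) ≡ 𝟙>0 (pred (lookup r d)) * profileCount es′ (decAt r d)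
    last-letter d r_d≥1 = trans (∑-arrangements-cong R (decAt r d) (λ cy supp _ → δᵖ-profile-∷ʳ-suc r cy d init c g supp))
      (trans (∑-arrangements-*ˡ R (decAt r d) (𝟙>0 (pred (lookup r d))) (λ cy → δᵖ (profile cy) es′))
             (𝟙>0-cong (pred (lookup r d)) (λ r_d≥2 → ∑-arrangements-profile R (decAt r d) es′ (ValidProfile-∷ʳ-suc R r init c g d valid r_d≥1 r_d≥2))))

-- The r-factor

module _ where

  open import Data.Integer as ℤ using (ℤ; +_)
  import Data.Integer.Properties as ℤₚ
  open import Data.Integer.Tactic.RingSolver using () renaming (solve-∀ to solve-∀ℤ)

  binomℤ-+ : ∀ t b → binomℤ (+ t) (+ b) ≡ binom t b
  binomℤ-+ t b = by-cases (b ≤ᵇ t) refl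
    where
    by-cases : ∀ q → (b ≤ᵇ t) ≡ q → (if q then t C b else 0) ≡ binom t b
    by-cases true _ = sym (binom≡C t b)
    by-cases false b≰ᵇt = sym (binom-< (≰⇒> (λ b≤t → subst T b≰ᵇt (≤⇒≤ᵇ {b} {t} b≤t))))

  -- The product defining the r-factor, written as a recursion over (r₁, …, rₙ) and (l₁, …, lₙ).
  rChain : List ℕ → List ℕ → ℕ
  rChain (r ∷ rs) (l ∷ ls) = binomℤ ((+ (l + sum ls) ℤ.- + sum rs) ℤ.- + 1) (+ r ℤ.- + 1) * rChain rs ls
  rChain _ _ = 1

  pos-suc-+ : ∀ m k → + (suc m + k) ≡ (+ 1 ℤ.+ + m) ℤ.+ + k
  pos-suc-+ m k = trans (ℤₚ.pos-+ (suc m) k) (cong (ℤ._+ + k) (ℤₚ.pos-+ 1 m))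

  rChain-term : ∀ l r ls rs {free} → + free ≡ + sum ls ℤ.- + sum rs →
    binomℤ ((+ (suc l + sum ls) ℤ.- + sum rs) ℤ.- + 1) (+ suc r ℤ.- + 1) ≡ binom (free + l) r
  rChain-term l r ls rs {free} free≡ = trans (cong₂ binomℤ top bottom) (binomℤ-+ (free + l) r)
    where
    top : (+ (suc l + sum ls) ℤ.- + sum rs) ℤ.- + 1 ≡ + (free + l)
    top = begin
      (+ (suc l + sum ls) ℤ.- + sum rs) ℤ.- + 1             ≡⟨ cong (λ k → (k ℤ.- + sum rs) ℤ.- + 1) (pos-suc-+ l (sum ls)) ⟩
      ((+ 1 ℤ.+ + l) ℤ.+ + sum ls ℤ.- + sum rs) ℤ.- + 1     ≡⟨ rearrange (+ l) (+ sum ls) (+ sum rs) ⟩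
      (+ sum ls ℤ.- + sum rs) ℤ.+ + l                       ≡⟨ cong (ℤ._+ + l) free≡ ⟨
      + free ℤ.+ + l                                         ≡⟨ ℤₚ.pos-+ free l ⟨
      + (free + l)                                           ∎
      where
      rearrange : ∀ a b c → ((+ 1 ℤ.+ a) ℤ.+ b ℤ.- c) ℤ.- + 1 ≡ (b ℤ.- c) ℤ.+ a
      rearrange = solve-∀ℤ
    bottom : + suc r ℤ.- + 1 ≡ + r
    bottom = trans (cong (ℤ._- + 1) (ℤₚ.pos-+ 1 r)) (cancel (+ r))
      where
      cancel : ∀ a → (+ 1 ℤ.+ a) ℤ.- + 1 ≡ a
      cancel = solve-∀ℤ

  rChain-free : ∀ l r ls rs {free} → + free ≡ + sum ls ℤ.- + sum rs → r ≤ free + l →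
    + (free + l ∸ r) ≡ + (suc l + sum ls) ℤ.- + (suc r + sum rs)
  rChain-free l r ls rs {free} free≡ r≤ = begin
    + (free + l ∸ r)                                       ≡⟨ ℤₚ.⊖-≥ r≤ ⟨
    (free + l) ℤ.⊖ r                                       ≡⟨ ℤₚ.m-n≡m⊖n (free + l) r ⟨
    + (free + l) ℤ.- + r                                   ≡⟨ cong (ℤ._- + r) (trans (ℤₚ.pos-+ free l) (cong (ℤ._+ + l) free≡)) ⟩
    (+ sum ls ℤ.- + sum rs) ℤ.+ + l ℤ.- + r                ≡⟨ rearrange (+ l) (+ r) (+ sum ls) (+ sum rs) ⟩
    ((+ 1 ℤ.+ + l) ℤ.+ + sum ls) ℤ.- ((+ 1 ℤ.+ + r) ℤ.+ + sum rs) ≡⟨ cong₂ ℤ._-_ (pos-suc-+ l (sum ls)) (pos-suc-+ r (sum rs)) ⟨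
    + (suc l + sum ls) ℤ.- + (suc r + sum rs)              ∎
    where
    rearrange : ∀ a b c d → (c ℤ.- d) ℤ.+ a ℤ.- b ≡ ((+ 1 ℤ.+ a) ℤ.+ c) ℤ.- ((+ 1 ℤ.+ b) ℤ.+ d)
    rearrange = solve-∀ℤ

  rSteps : List ℕ → List ℕ → List (ℕ × ℕ)
  rSteps ls rs = zip (map pred ls) (map pred rs)

  -- As long as no binomial coefficient of the chain vanishes, the free slots are counted exactly.
  fillings-rSteps : ∀ (ls rs : List ℕ) → length ls ≡ length rs → All (1 ≤_) ls → All (1 ≤_) rs →
    (proj₂ (fillings (0 , 1) (rSteps ls rs)) ≡ rChain rs ls) ×
    (rChain rs ls ≢ 0 → + proj₁ (fillings (0 , 1) (rSteps ls rs)) ≡ + sum ls ℤ.- + sum rs)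
  fillings-rSteps [] [] _ [] [] = refl , (λ _ → refl)
  fillings-rSteps (suc l ∷ ls) (suc r ∷ rs) len≡ (_ ∷ ls≥1) (_ ∷ rs≥1) with fillings-rSteps ls rs (suc-injective len≡) ls≥1 rs≥1
  ... | ways≡ , free≡ with rChain rs ls
  ...   | zero = trans (cong (binom (free + l) r *_) ways≡) (trans (*-zeroʳ (binom (free + l) r)) (sym (*-zeroʳ term))) ,
                 (λ chain≢0 → ⊥-elim (chain≢0 (*-zeroʳ term)))
    where
    free = proj₁ (fillings (0 , 1) (rSteps ls rs))
    term = binomℤ ((+ (suc l + sum ls) ℤ.- + sum rs) ℤ.- + 1) (+ suc r ℤ.- + 1)
  ...   | suc k = cong₂ _*_ (sym term≡) ways≡ , λ chain≢0 → rChain-free l r ls rs (free≡ λ ()) (r≤ chain≢0)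
    where
    free = proj₁ (fillings (0 , 1) (rSteps ls rs))
    term≡ = rChain-term l r ls rs (free≡ λ ())
    r≤ : binomℤ ((+ (suc l + sum ls) ℤ.- + sum rs) ℤ.- + 1) (+ suc r ℤ.- + 1) * suc k ≢ 0 → r ≤ free + l
    r≤ chain≢0 with r ≤? free + l
    ... | yes r≤free+l = r≤free+l
    ... | no r≰free+l = ⊥-elim (chain≢0 (trans (cong (_* suc k) term≡) (cong (_* suc k) (binom-< (≰⇒> r≰free+l)))))

  exactCount-rSteps : ∀ (ls rs : List ℕ) → length ls ≡ length rs → All (1 ≤_) ls → All (1 ≤_) rs → sum ls ≡ sum rs →
    exactCount (rSteps ls rs) ≡ rChain rs ls
  exactCount-rSteps ls rs len≡ ls≥1 rs≥1 sum≡ with fillings-rSteps ls rs len≡ ls≥1 rs≥1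
  ... | ways≡ , free≡ with rChain rs ls
  ...   | zero = cong (_* 𝟙=0 (proj₁ (fillings (0 , 1) (rSteps ls rs)))) ways≡
  ...   | suc k = trans (cong₂ (λ u v → u * 𝟙=0 v) ways≡ no-free) (*-identityʳ _)
    where
    no-free : proj₁ (fillings (0 , 1) (rSteps ls rs)) ≡ 0
    no-free = ℤₚ.+-injective (trans (free≡ λ ()) (trans (cong (λ k → + k ℤ.- + sum rs) sum≡) (ℤₚ.+-inverseʳ (+ sum rs))))

  -- The factor j = 1 is binom(r₁ - 1, r₁ - 1) = 1.
  rChain-head : ∀ r rs l ls → 1 ≤ r → l + sum ls ≡ r + sum rs → rChain (r ∷ rs) (l ∷ ls) ≡ rChain rs ls
  rChain-head (suc r) rs l ls _ sum≡ = trans (cong (_* rChain rs ls) (trans (cong₂ binomℤ top bottom) (trans (binomℤ-+ r r) (binom-diag r)))) (+-identityʳ _)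
    where
    top : (+ (l + sum ls) ℤ.- + sum rs) ℤ.- + 1 ≡ + r
    top = trans (cong (λ k → (+ k ℤ.- + sum rs) ℤ.- + 1) sum≡) (trans (cong (λ k → (k ℤ.- + sum rs) ℤ.- + 1) (pos-suc-+ r (sum rs))) (cancel (+ r) (+ sum rs)))
      where
      cancel : ∀ a b → (((+ 1 ℤ.+ a) ℤ.+ b) ℤ.- b) ℤ.- + 1 ≡ a
      cancel = solve-∀ℤ
    bottom : + suc r ℤ.- + 1 ≡ + r
    bottom = trans (cong (ℤ._- + 1) (ℤₚ.pos-+ 1 r)) (cancel (+ r))
      where
      cancel : ∀ a → (+ 1 ℤ.+ a) ℤ.- + 1 ≡ a
      cancel = solve-∀ℤ

  map-applyUpTo : ∀ {A B : Set} (f : A → B) (g : ℕ → A) m → map f (applyUpTo g m) ≡ applyUpTo (f ∘ g) m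
  map-applyUpTo f g zero = refl
  map-applyUpTo f g (suc m) = cong (f (g 0) ∷_) (map-applyUpTo f (g ∘ suc) m)

  applyUpTo-cong : ∀ {A : Set} m {f g : ℕ → A} → (∀ k → f k ≡ g k) → applyUpTo f m ≡ applyUpTo g m
  applyUpTo-cong zero eq = refl
  applyUpTo-cong (suc m) eq = cong₂ _∷_ (eq 0) (applyUpTo-cong m (eq ∘ suc))

  rFactor≡rChain : ∀ m r rs l ls → length ls ≡ m → length rs ≡ m → rFactor (suc m) (r ∷ rs) (l ∷ ls) ≡ rChain rs ls
  rFactor≡rChain m r rs l ls len-ls len-rs = begin
    rFactor (suc m) (r ∷ rs) (l ∷ ls)
      ≡⟨ cong product (trans (cong (map F) (map-applyUpTo (λ k → k + 2) (λ k → k) m)) (map-applyUpTo F (λ k → k + 2) m)) ⟩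
    product (applyUpTo (λ k → F (k + 2)) m)
      ≡⟨ cong product (applyUpTo-cong m (λ k → cong F (+-comm k 2))) ⟩
    product (applyUpTo (λ k → F (2 + k)) m)
      ≡⟨ shifted m rs ls len-ls len-rs ⟩
    rChain rs ls ∎
    where
    F : ℕ → ℕ
    F j = binomℤ ((+ sum (drop (j ∸ 1) (l ∷ ls)) ℤ.- + sum (drop j (r ∷ rs))) ℤ.- + 1) (+ at (r ∷ rs) (j ∸ 1) ℤ.- + 1)
    shifted : ∀ m rs ls → length ls ≡ m → length rs ≡ m → product (applyUpTo (λ k → binomℤ ((+ sum (drop k ls) ℤ.- + sum (drop (suc k) rs)) ℤ.- + 1) (+ at rs k ℤ.- + 1)) m) ≡ rChain rs ls
    shifted zero [] [] _ _ = refl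
    shifted (suc m) (r′ ∷ rs′) (l′ ∷ ls′) len-ls len-rs = cong (binomℤ ((+ (l′ + sum ls′) ℤ.- + sum rs′) ℤ.- + 1) (+ r′ ℤ.- + 1) *_) (shifted m rs′ ls′ (suc-injective len-ls) (suc-injective len-rs))

-- Grouping the arrangements by profile

profileOf : ∀ {n} → Vec (Fin n) n → List ℕ → Profile n
profileOf σ l = zip (Vec.toList σ) (map pred l)

permute≡map : ∀ {n} (σ : Vec (Fin n) n) (v : Vec ℕ n) → permute σ v ≡ map (lookup v) (Vec.toList σ)
permute≡map σ v = Vecₚ.toList-map (lookup v) σ

allB-≢≡not-occurs : ∀ {n} (i : Fin n) is → allB (λ j → not (does (i Fin.≟ j))) is ≡ not (occurs i is)
allB-≢≡not-occurs i [] = refl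
allB-≢≡not-occurs i (j ∷ is) with i Fin.≟ j
... | yes _ = refl
... | no _ = allB-≢≡not-occurs i is

distinctF⇒Distinct : ∀ {n} (cs : List (Fin n)) → distinctF cs ≡ true → Distinct cs
distinctF⇒Distinct [] _ = tt
distinctF⇒Distinct (c ∷ cs) distinct with allB (λ j → not (does (c Fin.≟ j))) cs in c-fresh | distinctF cs in cs-distinct
... | true | true = not-injective (trans (sym (allB-≢≡not-occurs c cs)) c-fresh) , distinctF⇒Distinct cs cs-distinct
  where
  not-injective : ∀ {b} → not b ≡ true → b ≡ false
  not-injective {false} _ = refl

Distinct⇒distinctF : ∀ {n} (cs : List (Fin n)) → Distinct cs → distinctF cs ≡ true
Distinct⇒distinctF [] _ = refl
Distinct⇒distinctF (c ∷ cs) (c∉cs , distinct) = cong₂ _∧_ (trans (allB-≢≡not-occurs c cs) (cong not c∉cs)) (Distinct⇒distinctF cs distinct)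

∑-length : ∀ {A : Set} (us : List A) → ∑ (λ _ → 1) us ≡ length us
∑-length [] = refl
∑-length (u ∷ us) = cong suc (∑-length us)

∑ᶠ-𝟙≤ : ∀ n (f : Fin n → Bool) → ∑[ i < n ] (𝟙 (f i) * 1) ≤ n
∑ᶠ-𝟙≤ zero f = z≤n
∑ᶠ-𝟙≤ (suc n) f = +-mono-≤ (𝟙≤1 (f zero)) (∑ᶠ-𝟙≤ n (f ∘ suc))
  where
  𝟙≤1 : ∀ b → 𝟙 b * 1 ≤ 1
  𝟙≤1 true = s≤s z≤n
  𝟙≤1 false = z≤n

∑ᶠ-𝟙< : ∀ n (f : Fin n → Bool) c → f c ≡ false → ∑[ i < n ] (𝟙 (f i) * 1) < n
∑ᶠ-𝟙< (suc n) f zero fc≡false = subst (λ b → 𝟙 b * 1 + ∑[ i < n ] (𝟙 (f (suc i)) * 1) < suc n) (sym fc≡false) (s≤s (∑ᶠ-𝟙≤ n (f ∘ suc)))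
∑ᶠ-𝟙< (suc n) f (suc c) fc≡false = subst (_≤ suc n) (+-suc (𝟙 (f zero) * 1) _) (+-mono-≤ (𝟙≤1 (f zero)) (∑ᶠ-𝟙< n (f ∘ suc) c fc≡false))
  where
  𝟙≤1 : ∀ b → 𝟙 b * 1 ≤ 1
  𝟙≤1 true = s≤s z≤n
  𝟙≤1 false = z≤n

-- Pigeonhole: n distinct letters of Fin n exhaust it.
Distinct-exhaustive : ∀ {n} (cs : List (Fin n)) → Distinct cs → length cs ≡ n → ∀ c → occurs c cs ≡ true
Distinct-exhaustive {n} cs distinct len≡ c with occurs c cs in c∈?
... | true = refl
... | false = ⊥-elim (<-irrefl refl (subst (_< n) count≡n (∑ᶠ-𝟙< n (λ c′ → occurs c′ cs) c c∈?)))
  where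
  count≡n : ∑[ c′ < n ] (𝟙 (occurs c′ cs) * 1) ≡ n
  count≡n = trans (sym (∑-Distinct cs distinct (λ _ → 1))) (trans (∑-length cs) len≡)

Distinct-length : ∀ {n} (cs : List (Fin n)) → Distinct cs → (∀ c → occurs c cs ≡ true) → length cs ≡ n
Distinct-length {n} cs distinct all = trans (sym (∑-length cs)) (trans (∑-Distinct cs distinct (λ _ → 1))
  (trans (sum-cong-≗ (λ c → cong (λ b → 𝟙 b * 1) (all c))) (sum-replicate-1 n)))
  where
  sum-replicate-1 : ∀ n → ∑[ c < n ] 1 ≡ n
  sum-replicate-1 zero = refl
  sum-replicate-1 (suc n) = cong suc (sum-replicate-1 n)

∑-exhaustive : ∀ {n} (cs : List (Fin n)) → Distinct cs → length cs ≡ n → (h : Fin n → ℕ) → ∑ h cs ≡ ∑[ c < n ] h c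
∑-exhaustive {n} cs distinct len≡ h = trans (∑-Distinct cs distinct h)
  (sum-cong-≗ (λ c → trans (cong (λ b → 𝟙 b * h c) (Distinct-exhaustive cs distinct len≡ c)) (+-identityʳ _)))

∑ᶠ-lookup : ∀ {n} (v : Vec ℕ n) → ∑[ i < n ] lookup v i ≡ Σᵛ v
∑ᶠ-lookup [] = refl
∑ᶠ-lookup (k ∷ v) = cong (k +_) (∑ᶠ-lookup v)

Σᵛ-permute : ∀ {n} (σ : Vec (Fin n) n) (v : Vec ℕ n) → distinctF (Vec.toList σ) ≡ true → sum (permute σ v) ≡ Σᵛ v
Σᵛ-permute {n} σ v σ-distinct = begin
  sum (permute σ v)                    ≡⟨ cong sum (permute≡map σ v) ⟩
  sum (map (lookup v) (Vec.toList σ))  ≡⟨ sum-map (lookup v) (Vec.toList σ) ⟩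
  ∑ (lookup v) (Vec.toList σ)          ≡⟨ ∑-exhaustive (Vec.toList σ) (distinctF⇒Distinct (Vec.toList σ) σ-distinct) (Vecₚ.length-toList σ) (lookup v) ⟩
  ∑[ i < n ] lookup v i                ≡⟨ ∑ᶠ-lookup v ⟩
  Σᵛ v                                 ∎

map-toStep-zip : ∀ {n} (r : Vec ℕ n) (cs : List (Fin n)) (gs : List ℕ) →
  map (toStep r) (zip cs gs) ≡ zip gs (map (pred ∘ lookup r) cs)
map-toStep-zip r [] [] = refl
map-toStep-zip r [] (g ∷ gs) = refl
map-toStep-zip r (c ∷ cs) [] = refl
map-toStep-zip r (c ∷ cs) (g ∷ gs) = cong ((g , pred (lookup r c)) ∷_) (map-toStep-zip r cs gs)

All-lookup : ∀ {n} (r : Vec ℕ n) (cs : List (Fin n)) → (∀ i → 1 ≤ lookup r i) → All (1 ≤_) (map (lookup r) cs)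
All-lookup r [] r≥1 = []
All-lookup r (c ∷ cs) r≥1 = r≥1 c ∷ All-lookup r cs r≥1

profileCount≡rFactor : ∀ {n} (r : Vec ℕ n) (σ : Vec (Fin n) n) (l : List ℕ) → 0 < n → (∀ i → 1 ≤ lookup r i) →
  All (1 ≤_) l → length l ≡ n → sum l ≡ Σᵛ r → distinctF (Vec.toList σ) ≡ true →
  profileCount (profileOf σ l) r ≡ rFactor n (permute σ r) l
profileCount≡rFactor {suc m} r σ@(σ₁ ∷ σ′) l@(l₁ ∷ ls) _ r≥1 l≥1 len-l sum-l σ-distinct = begin
  exactCount (map (toStep r) (zip (Vec.toList σ) (map pred l)))
    ≡⟨ cong exactCount (map-toStep-zip r (Vec.toList σ) (map pred l)) ⟩
  exactCount (zip (map pred l) (map (pred ∘ lookup r) (Vec.toList σ)))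
    ≡⟨ cong (λ ps → exactCount (zip (map pred l) ps)) (trans (Listₚ.map-∘ (Vec.toList σ)) (cong (map pred) (sym (permute≡map σ r)))) ⟩
  exactCount (rSteps l rσ)
    ≡⟨ exactCount-rSteps l rσ (trans len-l (sym len-rσ)) l≥1 (subst (All (1 ≤_)) (sym (permute≡map σ r)) (All-lookup r (Vec.toList σ) r≥1)) sum≡ ⟩
  rChain rσ l
    ≡⟨ rChain-head (lookup r σ₁) rs l₁ ls (r≥1 σ₁) sum≡ ⟩
  rChain rs ls
    ≡⟨ rFactor≡rChain m (lookup r σ₁) rs l₁ ls (suc-injective len-l) (suc-injective len-rσ) ⟨
  rFactor (suc m) rσ l ∎
  where
  rσ = permute σ r
  rs = Vec.toList (Vec.map (lookup r) σ′)
  len-rσ : length rσ ≡ suc m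
  len-rσ = trans (cong length (permute≡map σ r)) (trans (Listₚ.length-map (lookup r) (Vec.toList σ)) (Vecₚ.length-toList σ))
  sum≡ : sum l ≡ sum rσ
  sum≡ = trans sum-l (sym (Σᵛ-permute σ r σ-distinct))

∑-cong-∈ : ∀ {A : Set} {f g : A → ℕ} (us : List A) → (∀ u → u ∈ us → f u ≡ g u) → ∑ f us ≡ ∑ g us
∑-cong-∈ [] eq = refl
∑-cong-∈ (u ∷ us) eq = cong₂ _+_ (eq u (here refl)) (∑-cong-∈ us (λ v v∈us → eq v (there v∈us)))

module KroneckerList {A : Set} (_≟_ : DecidableEquality A) where
  open Kronecker _≟_ using (δ)
  open Kronecker (Listₚ.≡-dec _≟_) using () renaming (δ to δˡ)

  δˡ-∷ : ∀ u v us vs → δˡ (u ∷ us) (v ∷ vs) ≡ δ u v * δˡ us vs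
  δˡ-∷ u v us vs with does (u ≟ v)
  ... | true = sym (+-identityʳ _)
  ... | false = refl

open Kronecker ℕ._≟_ using () renaming (δ to δⁿ; δ-≡ to δⁿ-≡; δ-≢ to δⁿ-≢; ∑-δ to ∑-δⁿ)
_≟ⁿˡ_ : DecidableEquality (List ℕ)
_≟ⁿˡ_ = Listₚ.≡-dec ℕ._≟_

module KroneckerListℕ = Kronecker _≟ⁿˡ_
open KroneckerListℕ using () renaming (δ to δⁿˡ; δ-refl to δⁿˡ-refl; δ-≢ to δⁿˡ-≢; ∑-δ to ∑-δⁿˡ)
module KroneckerListFin {n : ℕ} = Kronecker (Listₚ.≡-dec (Fin._≟_ {n}))
open KroneckerListFin using () renaming (δ to δᶠˡ)

applyUpTo≡tabulate : {A : Set} (m : ℕ) (g : ℕ → A) → applyUpTo g m ≡ tabulate (g ∘ toℕ {m})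
applyUpTo≡tabulate zero g = refl
applyUpTo≡tabulate (suc m) g = cong (g 0 ∷_) (applyUpTo≡tabulate m (g ∘ suc))

∑-upTo-δ : ∀ s i₀ → i₀ ≤ s → ∑ (λ i → δⁿ i i₀) (upTo (suc s)) ≡ 1
∑-upTo-δ s i₀ i₀≤s = begin
  ∑ (λ i → δⁿ i i₀) (upTo (suc s))                ≡⟨ cong (∑ (λ i → δⁿ i i₀)) (applyUpTo≡tabulate (suc s) (λ k → k)) ⟩
  ∑ (λ i → δⁿ i i₀) (tabulate (toℕ {suc s}))      ≡⟨ ∑-tabulate (suc s) (λ i → δⁿ i i₀) toℕ ⟩
  ∑[ j < suc s ] δⁿ (toℕ j) i₀                    ≡⟨ sum-cong-≗ δ-toℕ ⟩
  ∑[ j < suc s ] (δᶠ j j₀ * 1)                    ≡⟨ ∑ᶠ-pick (suc s) j₀ (λ _ → 1) ⟩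
  1                                                ∎
  where
  j₀ : Fin (suc s)
  j₀ = fromℕ< (s≤s i₀≤s)
  δ-toℕ : ∀ j → δⁿ (toℕ j) i₀ ≡ δᶠ j j₀ * 1
  δ-toℕ j with j Fin.≟ j₀
  ... | yes refl = δⁿ-≡ (Finₚ.toℕ-fromℕ< (s≤s i₀≤s))
  ... | no j≢j₀ = δⁿ-≢ (λ j≡i₀ → j≢j₀ (Finₚ.toℕ-injective (trans j≡i₀ (sym (Finₚ.toℕ-fromℕ< (s≤s i₀≤s))))))

∑-wcomp-δ : ∀ k s (l₀ : List ℕ) → length l₀ ≡ k → sum l₀ ≡ s → ∑ (λ l → δⁿˡ l l₀) (wcomp k s) ≡ 1
∑-wcomp-δ zero zero [] _ _ = refl
∑-wcomp-δ (suc k) s (i₀ ∷ l₀) len≡ sum≡ = begin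
  ∑ (λ l → δⁿˡ l (i₀ ∷ l₀)) (concatMap (λ i → map (i ∷_) (wcomp k (s ∸ i))) (upTo (suc s)))
    ≡⟨ ∑-concatMap (λ l → δⁿˡ l (i₀ ∷ l₀)) (λ i → map (i ∷_) (wcomp k (s ∸ i))) (upTo (suc s)) ⟩
  ∑ (λ i → ∑ (λ l → δⁿˡ l (i₀ ∷ l₀)) (map (i ∷_) (wcomp k (s ∸ i)))) (upTo (suc s))
    ≡⟨ ∑-cong (upTo (suc s)) (λ i → trans (∑-map _ (i ∷_) (wcomp k (s ∸ i)))
         (trans (∑-cong (wcomp k (s ∸ i)) (λ l → KroneckerList.δˡ-∷ ℕ._≟_ i i₀ l l₀)) (∑-*ˡ (δⁿ i i₀) _ (wcomp k (s ∸ i))))) ⟩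
  ∑ (λ i → δⁿ i i₀ * ∑ (λ l → δⁿˡ l l₀) (wcomp k (s ∸ i))) (upTo (suc s))
    ≡⟨ ∑-δⁿ (λ i → ∑ (λ l → δⁿˡ l l₀) (wcomp k (s ∸ i))) i₀ (upTo (suc s)) ⟩
  ∑ (λ i → δⁿ i i₀) (upTo (suc s)) * ∑ (λ l → δⁿˡ l l₀) (wcomp k (s ∸ i₀))
    ≡⟨ cong₂ _*_ (∑-upTo-δ s i₀ (subst (i₀ ≤_) sum≡ (m≤m+n i₀ (sum l₀))))
                 (∑-wcomp-δ k (s ∸ i₀) l₀ (suc-injective len≡) (sym (trans (cong (_∸ i₀) (sym sum≡)) (m+n∸m≡n i₀ (sum l₀))))) ⟩
  1 ∎

all-positive? : List ℕ → Bool
all-positive? = allB (λ k → 1 ≤ᵇ k)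

All≥1⇒all-positive? : (l : List ℕ) → All (1 ≤_) l → all-positive? l ≡ true
All≥1⇒all-positive? [] _ = refl
All≥1⇒all-positive? (suc k ∷ l) (_ ∷ l≥1) = All≥1⇒all-positive? l l≥1

all-positive?⇒All≥1 : (l : List ℕ) → T (all-positive? l) → All (1 ≤_) l
all-positive?⇒All≥1 [] _ = []
all-positive?⇒All≥1 (suc k ∷ l) t = s≤s z≤n ∷ all-positive?⇒All≥1 l t

∑-pcomp-δ : ∀ k s (l₀ : List ℕ) → length l₀ ≡ k → sum l₀ ≡ s → All (1 ≤_) l₀ → ∑ (λ l → δⁿˡ l l₀) (pcomp k s) ≡ 1
∑-pcomp-δ k s l₀ len≡ sum≡ l₀≥1 = begin
  ∑ (λ l → δⁿˡ l l₀) (pcomp k s)                                ≡⟨ ∑-filter (λ l → T? (all-positive? l)) (λ l → δⁿˡ l l₀) (wcomp k s) ⟩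
  ∑ (λ l → 𝟙 (all-positive? l) * δⁿˡ l l₀) (wcomp k s)          ≡⟨ ∑-cong (wcomp k s) positive ⟩
  ∑ (λ l → δⁿˡ l l₀) (wcomp k s)                                ≡⟨ ∑-wcomp-δ k s l₀ len≡ sum≡ ⟩
  1 ∎
  where
  positive : ∀ l → 𝟙 (all-positive? l) * δⁿˡ l l₀ ≡ δⁿˡ l l₀
  positive l with l ≟ⁿˡ l₀
  ... | yes refl = cong (λ b → 𝟙 b * 1) (All≥1⇒all-positive? l l₀≥1)
  ... | no _ = *-zeroʳ (𝟙 (all-positive? l))

∑-allMaps-δ : ∀ {n} k (cs : List (Fin n)) (h : List (Fin n) → ℕ) → length cs ≡ k →
  ∑ (λ v → h (Vec.toList v) * δᶠˡ (Vec.toList v) cs) (allMaps n k) ≡ h cs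
∑-allMaps-δ zero [] h _ = trans (+-identityʳ _) (*-identityʳ _)
∑-allMaps-δ {n} (suc k) (c ∷ cs) h len≡ = begin
  ∑ (λ v → h (Vec.toList v) * δᶠˡ (Vec.toList v) (c ∷ cs)) (concatMap (λ i → map (i ∷_) (allMaps n k)) (allFin n))
    ≡⟨ ∑-concatMap _ (λ i → map (i ∷_) (allMaps n k)) (allFin n) ⟩
  ∑ (λ i → ∑ (λ v → h (Vec.toList v) * δᶠˡ (Vec.toList v) (c ∷ cs)) (map (i ∷_) (allMaps n k))) (allFin n)
    ≡⟨ ∑-cong (allFin n) (λ i → trans (∑-map _ (i ∷_) (allMaps n k)) (∑-cong (allMaps n k) (λ v →
         trans (cong (h (i ∷ Vec.toList v) *_) (KroneckerList.δˡ-∷ Fin._≟_ i c (Vec.toList v) cs))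
               (x*[y*z]≡y*[x*z] (h (i ∷ Vec.toList v)) (δᶠ i c) _)))) ⟩
  ∑ (λ i → ∑ (λ v → δᶠ i c * (h (i ∷ Vec.toList v) * δᶠˡ (Vec.toList v) cs)) (allMaps n k)) (allFin n)
    ≡⟨ ∑-cong (allFin n) (λ i → trans (∑-*ˡ (δᶠ i c) _ (allMaps n k)) (cong (δᶠ i c *_) (∑-allMaps-δ k cs (h ∘ (i ∷_)) (suc-injective len≡)))) ⟩
  ∑ (λ i → δᶠ i c * h (i ∷ cs)) (allFin n)
    ≡⟨ ∑-tabulate n (λ i → δᶠ i c * h (i ∷ cs)) (λ i → i) ⟩
  ∑[ i < n ] (δᶠ i c * h (i ∷ cs))
    ≡⟨ ∑ᶠ-pick n c (λ i → h (i ∷ cs)) ⟩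
  h (c ∷ cs) ∎

∑-Sym-δ : ∀ {n} (cs : List (Fin n)) → Distinct cs → length cs ≡ n → ∑ (λ σ → δᶠˡ (Vec.toList σ) cs) (Sym n) ≡ 1
∑-Sym-δ {n} cs distinct len≡ = begin
  ∑ (λ σ → δᶠˡ (Vec.toList σ) cs) (Sym n)
    ≡⟨ ∑-filter (λ σ → T? (distinctF (Vec.toList σ))) _ (allMaps n n) ⟩
  ∑ (λ σ → 𝟙 (distinctF (Vec.toList σ)) * δᶠˡ (Vec.toList σ) cs) (allMaps n n)
    ≡⟨ ∑-allMaps-δ n cs (𝟙 ∘ distinctF) len≡ ⟩
  𝟙 (distinctF cs)
    ≡⟨ cong 𝟙 (Distinct⇒distinctF cs distinct) ⟩
  1 ∎

∈-wcomp⁻ : ∀ k s l → l ∈ wcomp k s → length l ≡ k × sum l ≡ s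
∈-wcomp⁻ zero zero l (here refl) = refl , refl
∈-wcomp⁻ (suc k) s l l∈ with find (∈-concatMap⁻ (λ i → map (i ∷_) (wcomp k (s ∸ i))) {xs = upTo (suc s)} l∈)
... | i , i∈ , l∈′ with ∈-map⁻ (i ∷_) l∈′
...   | l′ , l′∈ , refl with ∈-wcomp⁻ k (s ∸ i) l′ l′∈
...     | len≡ , sum≡ = cong suc len≡ , trans (cong (i +_) sum≡) (m+[n∸m]≡n (ℕ.s≤s⁻¹ (∈-upTo⁻ i∈)))

∈-pcomp⁻ : ∀ k s l → l ∈ pcomp k s → length l ≡ k × sum l ≡ s × All (1 ≤_) l
∈-pcomp⁻ k s l l∈ with ∈-filter⁻ (λ l → T? (all-positive? l)) {xs = wcomp k s} l∈
... | l∈′ , positive with ∈-wcomp⁻ k s l l∈′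
...   | len≡ , sum≡ = len≡ , sum≡ , all-positive?⇒All≥1 l positive

∈-Sym⁻ : ∀ {n} σ → σ ∈ Sym n → Distinct (Vec.toList σ)
∈-Sym⁻ {n} σ σ∈ = distinctF⇒Distinct (Vec.toList σ) (Equivalence.to T-≡ (proj₂ (∈-filter⁻ (λ σ → T? (distinctF (Vec.toList σ))) {xs = allMaps n n} σ∈)))

profileFrom-Distinct : ∀ {n} (S cy : List (Fin n)) →
  Distinct (colours (proj₂ (profileFrom S cy))) × (∀ c → occurs c (colours (proj₂ (profileFrom S cy))) ≡ true → occurs c S ≡ false)
profileFrom-Distinct S [] = tt , (λ c ())
profileFrom-Distinct S (c ∷ cy) with occurs c S in c∈S
... | true = profileFrom-Distinct S cy
... | false with profileFrom-Distinct (c ∷ S) cy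
...   | distinct , new = (c-new , distinct) , new′
  where
  c-new : occurs c (colours (proj₂ (profileFrom (c ∷ S) cy))) ≡ false
  c-new with occurs c (colours (proj₂ (profileFrom (c ∷ S) cy))) in c∈
  ... | false = refl
  ... | true with () ← trans (sym (cong (_∨ occurs c S) (dec-true (c Fin.≟ c) refl))) (new c c∈)
  new′ : ∀ d → occurs d (c ∷ colours (proj₂ (profileFrom (c ∷ S) cy))) ≡ true → occurs d S ≡ false
  new′ d d∈ with d Fin.≟ c
  ... | yes refl = c∈S
  ... | no d≢c = trans (sym (cong (_∨ occurs d S) (dec-false (d Fin.≟ c) d≢c))) (new d d∈)

profileFrom-occurs : ∀ {n} (S cy : List (Fin n)) c →
  occurs c (colours (proj₂ (profileFrom S cy))) ∨ occurs c S ≡ occurs c cy ∨ occurs c S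
profileFrom-occurs S [] c = refl
profileFrom-occurs S (d ∷ cy) c with occurs d S in d∈S
... | true = trans (profileFrom-occurs S cy c) (absorb (c Fin.≟ d))
  where
  absorb : (c≟d : Dec (c ≡ d)) → occurs c cy ∨ occurs c S ≡ (does c≟d ∨ occurs c cy) ∨ occurs c S
  absorb (no _) = refl
  absorb (yes refl) = trans (cong (occurs c cy ∨_) d∈S) (trans (∨-zeroʳ _) (sym (cong ((true ∨ occurs c cy) ∨_) d∈S)))
... | false = trans (∨-left-comm (does (c Fin.≟ d)) _ _) (trans (profileFrom-occurs (d ∷ S) cy c) (sym (∨-left-comm (does (c Fin.≟ d)) _ _)))
  where
  ∨-left-comm : ∀ a b c → (a ∨ b) ∨ c ≡ b ∨ (a ∨ c)
  ∨-left-comm a b c = trans (∨-assoc a b c) (trans (cong (a ∨_) (∨-comm b c)) (trans (sym (∨-assoc a c b)) (∨-comm (a ∨ c) b)))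

profileFrom-length : ∀ {n} (S cy : List (Fin n)) → proj₁ (profileFrom S cy) + profileLength (proj₂ (profileFrom S cy)) ≡ length cy
profileFrom-length S [] = refl
profileFrom-length S (c ∷ cy) with occurs c S
... | true = cong suc (profileFrom-length S cy)
... | false = cong suc (profileFrom-length (c ∷ S) cy)

profile-Distinct : ∀ {n} (cy : List (Fin n)) → Distinct (colours (profile cy))
profile-Distinct cy = proj₁ (profileFrom-Distinct [] cy)

profile-occurs : ∀ {n} (cy : List (Fin n)) c → occurs c (colours (profile cy)) ≡ occurs c cy
profile-occurs cy c = trans (sym (∨-identityʳ _)) (trans (profileFrom-occurs [] cy c) (∨-identityʳ _))

profile-length : ∀ {n} (cy : List (Fin n)) → profileLength (profile cy) ≡ length cy
profile-length cy = subst (λ p → proj₁ p + profileLength (proj₂ p) ≡ length cy) (profileFrom-[] cy) (profileFrom-length [] cy)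

gapsOf : ∀ {n} → Profile n → List ℕ
gapsOf = map (suc ∘ proj₂)

gapsOf-All≥1 : ∀ {n} (es : Profile n) → All (1 ≤_) (gapsOf es)
gapsOf-All≥1 [] = []
gapsOf-All≥1 (e ∷ es) = s≤s z≤n ∷ gapsOf-All≥1 es

colours-zip : ∀ {n} (cs : List (Fin n)) (gs : List ℕ) → length cs ≡ length gs → colours (zip cs gs) ≡ cs
colours-zip [] [] _ = refl
colours-zip (c ∷ cs) (g ∷ gs) len≡ = cong (c ∷_) (colours-zip cs gs (suc-injective len≡))

gapsOf-zip : ∀ {n} (cs : List (Fin n)) (l : List ℕ) → length cs ≡ length l → All (1 ≤_) l → gapsOf (zip cs (map pred l)) ≡ l
gapsOf-zip [] [] _ _ = refl
gapsOf-zip (c ∷ cs) (suc k ∷ l) len≡ (_ ∷ l≥1) = cong (suc k ∷_) (gapsOf-zip cs l (suc-injective len≡) l≥1)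

zip-colours-gapsOf : ∀ {n} (es : Profile n) → zip (colours es) (map pred (gapsOf es)) ≡ es
zip-colours-gapsOf [] = refl
zip-colours-gapsOf ((c , g) ∷ es) = cong ((c , g) ∷_) (zip-colours-gapsOf es)

δᵖ-profileOf : ∀ {n} (es : Profile n) (σ : Vec (Fin n) n) (l : List ℕ) → length l ≡ n → All (1 ≤_) l →
  δᵖ es (profileOf σ l) ≡ δⁿˡ l (gapsOf es) * δᶠˡ (Vec.toList σ) (colours es)
δᵖ-profileOf es σ l len≡ l≥1 with l ≟ⁿˡ gapsOf es | Listₚ.≡-dec Fin._≟_ (Vec.toList σ) (colours es)
... | yes refl | yes σ≡ = δᵖ-≡ (sym (trans (cong (λ cs → zip cs (map pred (gapsOf es))) σ≡) (zip-colours-gapsOf es)))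
... | no l≢ | _ = δᵖ-≢ (λ es≡ → l≢ (trans (sym (gapsOf-zip (Vec.toList σ) l (trans (Vecₚ.length-toList σ) (sym len≡)) l≥1)) (cong gapsOf (sym es≡))))
... | yes _ | no σ≢ = δᵖ-≢ (λ es≡ → σ≢ (trans (sym (colours-zip (Vec.toList σ) (map pred l)
                        (trans (Vecₚ.length-toList σ) (sym (trans (Listₚ.length-map pred l) len≡))))) (cong colours (sym es≡))))

ValidProfile-profileOf : ∀ {n} (r : Vec ℕ n) (σ : Vec (Fin n) n) (l : List ℕ) → (∀ i → 1 ≤ lookup r i) →
  All (1 ≤_) l → length l ≡ n → sum l ≡ Σᵛ r → Distinct (Vec.toList σ) → ValidProfile (Σᵛ r) r (profileOf σ l)
ValidProfile-profileOf r σ l r≥1 l≥1 len≡ sum≡ σ-distinct =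
  subst Distinct (sym coloursEq) σ-distinct ,
  (λ c _ → r≥1 c) ,
  (λ c c∉ → ⊥-elim (true≢false (trans (sym (Distinct-exhaustive (Vec.toList σ) σ-distinct (Vecₚ.length-toList σ) c)) (trans (cong (occurs c) (sym coloursEq)) c∉)))) ,
  trans (trans (sym (sum-map (suc ∘ proj₂) (profileOf σ l))) (cong sum (gapsOf-zip (Vec.toList σ) l (trans (Vecₚ.length-toList σ) (sym len≡)) l≥1))) sum≡
  where
  coloursEq : colours (profileOf σ l) ≡ Vec.toList σ
  coloursEq = colours-zip (Vec.toList σ) (map pred l) (trans (Vecₚ.length-toList σ) (sym (trans (Listₚ.length-map pred l) len≡)))
  true≢false : true ≢ false
  true≢false ()

-- A profile with n distinct colours, of length R, is profileOf σ l for exactly one permutation σ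
-- and one composition l of R into n positive parts.
∑-profileOf-pick : ∀ {n} R (es : Profile n) (H : Profile n → ℕ) → Distinct (colours es) → length (colours es) ≡ n →
  profileLength es ≡ R → ∑ (λ l → ∑ (λ σ → δᵖ es (profileOf σ l) * H (profileOf σ l)) (Sym n)) (pcomp n R) ≡ H es
∑-profileOf-pick {n} R es H distinct colours-length len≡ = begin
  ∑ (λ l → ∑ (λ σ → δᵖ es (profileOf σ l) * H (profileOf σ l)) (Sym n)) (pcomp n R)
    ≡⟨ ∑-cong-∈ (pcomp n R) (λ l l∈ → ∑-cong (Sym n) (λ σ → split l σ (∈-pcomp⁻ n R l l∈))) ⟩
  ∑ (λ l → ∑ (λ σ → δᶠˡ (Vec.toList σ) (colours es) * (δⁿˡ l (gapsOf es) * H es)) (Sym n)) (pcomp n R)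
    ≡⟨ ∑-cong (pcomp n R) (λ l → trans (∑-*ʳ (δⁿˡ l (gapsOf es) * H es) _ (Sym n))
                                        (cong (_* (δⁿˡ l (gapsOf es) * H es)) (∑-Sym-δ (colours es) distinct colours-length))) ⟩
  ∑ (λ l → 1 * (δⁿˡ l (gapsOf es) * H es)) (pcomp n R)
    ≡⟨ ∑-cong (pcomp n R) (λ l → *-identityˡ _) ⟩
  ∑ (λ l → δⁿˡ l (gapsOf es) * H es) (pcomp n R)
    ≡⟨ ∑-*ʳ (H es) (λ l → δⁿˡ l (gapsOf es)) (pcomp n R) ⟩
  ∑ (λ l → δⁿˡ l (gapsOf es)) (pcomp n R) * H es
    ≡⟨ cong (_* H es) (∑-pcomp-δ n R (gapsOf es) (trans (Listₚ.length-map _ es) (trans (sym (Listₚ.length-map proj₁ es)) colours-length))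
                                   (trans (sum-map (suc ∘ proj₂) es) len≡) (gapsOf-All≥1 es)) ⟩
  1 * H es
    ≡⟨ *-identityˡ _ ⟩
  H es ∎
  where
  split : ∀ l σ → length l ≡ n × sum l ≡ R × All (1 ≤_) l →
    δᵖ es (profileOf σ l) * H (profileOf σ l) ≡ δᶠˡ (Vec.toList σ) (colours es) * (δⁿˡ l (gapsOf es) * H es)
  split l σ (len≡ , _ , l≥1) = begin
    δᵖ es (profileOf σ l) * H (profileOf σ l) ≡⟨ δᵖ-transport es (profileOf σ l) H ⟨
    δᵖ es (profileOf σ l) * H es ≡⟨ cong (_* H es) (δᵖ-profileOf es σ l len≡ l≥1) ⟩
    δⁿˡ l (gapsOf es) * δᶠˡ (Vec.toList σ) (colours es) * H es ≡⟨ rearrange (δⁿˡ l (gapsOf es)) (δᶠˡ (Vec.toList σ) (colours es)) (H es) ⟩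
    δᶠˡ (Vec.toList σ) (colours es) * (δⁿˡ l (gapsOf es) * H es) ∎
    where
    rearrange : ∀ a b c → a * b * c ≡ b * (a * c)
    rearrange = solve-∀

∑-arrangements-by-profile : ∀ {n} R (r : Vec ℕ n) (H : Profile n → ℕ) → (∀ i → 1 ≤ lookup r i) →
  ∑-arrangements R r (λ cy → H (profile cy)) ≡
  ∑ (λ l → ∑ (λ σ → ∑-arrangements R r (λ cy → δᵖ (profile cy) (profileOf σ l)) * H (profileOf σ l)) (Sym n)) (pcomp n R)
∑-arrangements-by-profile {n} R r H r≥1 = sym (begin
  ∑ (λ l → ∑ (λ σ → ∑-arrangements R r (λ cy → δᵖ (profile cy) (profileOf σ l)) * H (profileOf σ l)) (Sym n)) (pcomp n R)
    ≡⟨ ∑-cong (pcomp n R) (λ l → ∑-cong (Sym n) (λ σ → sym (∑-arrangements-*ʳ R r (H (profileOf σ l)) _))) ⟩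
  ∑ (λ l → ∑ (λ σ → ∑-arrangements R r (λ cy → δᵖ (profile cy) (profileOf σ l) * H (profileOf σ l))) (Sym n)) (pcomp n R)
    ≡⟨ ∑-cong (pcomp n R) (λ l → sym (∑-arrangements-∑ R r (λ σ cy → δᵖ (profile cy) (profileOf σ l) * H (profileOf σ l)) (Sym n))) ⟩
  ∑ (λ l → ∑-arrangements R r (λ cy → ∑ (λ σ → δᵖ (profile cy) (profileOf σ l) * H (profileOf σ l)) (Sym n))) (pcomp n R)
    ≡⟨ ∑-arrangements-∑ R r (λ l cy → ∑ (λ σ → δᵖ (profile cy) (profileOf σ l) * H (profileOf σ l)) (Sym n)) (pcomp n R) ⟨
  ∑-arrangements R r (λ cy → ∑ (λ l → ∑ (λ σ → δᵖ (profile cy) (profileOf σ l) * H (profileOf σ l)) (Sym n)) (pcomp n R))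
    ≡⟨ ∑-arrangements-cong R r (λ cy supp len≡ → ∑-profileOf-pick R (profile cy) H (profile-Distinct cy) (uses-all-letters cy supp) (trans (profile-length cy) len≡)) ⟩
  ∑-arrangements R r (λ cy → H (profile cy)) ∎)
  where
  uses-all-letters : ∀ cy → SameSupport r cy → length (colours (profile cy)) ≡ n
  uses-all-letters cy (covers , _) = Distinct-length (colours (profile cy)) (profile-Distinct cy)
    (λ c → trans (profile-occurs cy c) (∈⇒occurs c cy (covers c (r≥1 c))))

-- The a-factor

δprod : List ℕ → ℕ
δprod αs = product (map δ0 αs)

δprod≡𝟙=0 : ∀ αs → δprod αs ≡ 𝟙=0 (sum αs)
δprod≡𝟙=0 [] = refl
δprod≡𝟙=0 (zero ∷ αs) = trans (+-identityʳ _) (δprod≡𝟙=0 αs)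
δprod≡𝟙=0 (suc _ ∷ αs) = refl

sum-head₀-drop : ∀ (αs : List ℕ) → sum αs ≡ head₀ αs + sum (drop 1 αs)
sum-head₀-drop [] = refl
sum-head₀-drop (α ∷ αs) = refl

sum-take-shift : ∀ k (αs : List ℕ) → head₀ αs + sum (take k (drop 1 αs)) ≡ sum (take k αs) + head₀ (drop k αs)
sum-take-shift zero αs = +-identityʳ _
sum-take-shift (suc k) [] = refl
sum-take-shift (suc k) (α ∷ αs) = trans (cong (α +_) (trans (sum-take-suc k αs) (sum-take-shift k αs))) (sym (+-assoc α _ _))

sum-take-drop : ∀ k (αs : List ℕ) → sum (take k αs) + sum (drop k αs) ≡ sum αs
sum-take-drop k αs = trans (sym (sum-++ (take k αs) (drop k αs))) (cong sum (Listₚ.take++drop≡id k αs))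

sum-take-+ : ∀ k m (αs : List ℕ) → sum (take (k + m) αs) ≡ sum (take k αs) + sum (take m (drop k αs))
sum-take-+ zero m αs = refl
sum-take-+ (suc k) m [] = cong sum (sym (Listₚ.take-[] m))
sum-take-+ (suc k) m (α ∷ αs) = trans (cong (α +_) (sum-take-+ k m αs)) (sym (+-assoc α _ _))

drop-comm : ∀ k (αs : List ℕ) → drop k (drop 1 αs) ≡ drop 1 (drop k αs)
drop-comm k αs = trans (Listₚ.drop-drop 1 k αs) (trans (cong (λ m → drop m αs) (+-comm 1 k)) (sym (Listₚ.drop-drop k 1 αs)))


module _ where

  open import Data.Integer as ℤ using (ℤ; +_; 0ℤ)
  import Data.Integer.Properties as ℤₚ
  open import Data.Integer.Tactic.RingSolver using () renaming (solve-∀ to solve-∀ℤ)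

  𝟙=0ℤ : ℤ → ℕ
  𝟙=0ℤ (+ zero) = 1
  𝟙=0ℤ _ = 0

  -- xPlacementsᵖ with the x-counts as listed in order of first occurrence, and an integer count
  -- of pending x's.
  xChain : List ℕ → List ℕ → List ℕ → ℤ → ℕ
  xChain (a₁ ∷ as) (k ∷ ls) βs d = binomℤ d (+ a₁) * xChain as ls (drop k βs) (d ℤ.- + a₁ ℤ.+ + sum (take k βs))
  xChain _ _ βs d = 𝟙=0ℤ d

  xPlacementsᵖ-profileOf : ∀ {n} (a : Vec ℕ n) (cs : List (Fin n)) (l βs : List ℕ) s → length cs ≡ length l → All (1 ≤_) l →
    xPlacementsᵖ (zip cs (map pred l)) βs s a ≡ xChain (map (lookup a) cs) l βs (+ s)
  xPlacementsᵖ-profileOf a [] [] βs zero _ _ = refl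
  xPlacementsᵖ-profileOf a [] [] βs (suc s) _ _ = refl
  xPlacementsᵖ-profileOf a (c ∷ cs) (suc k ∷ l) βs s len≡ (_ ∷ l≥1) with lookup a c ≤? s
  ... | yes a_c≤s = cong₂ _*_ (sym (binomℤ-+ s (lookup a c)))
    (trans (xPlacementsᵖ-profileOf a cs l (drop (suc k) βs) _ (suc-injective len≡) l≥1) (cong (xChain (map (lookup a) cs) l (drop (suc k) βs)) pending≡))
    where
    pending≡ : + (s ∸ lookup a c + sum (take (suc k) βs)) ≡ + s ℤ.- + lookup a c ℤ.+ + sum (take (suc k) βs)
    pending≡ = trans (ℤₚ.pos-+ (s ∸ lookup a c) _) (cong (ℤ._+ + sum (take (suc k) βs)) (trans (sym (ℤₚ.⊖-≥ a_c≤s)) (sym (ℤₚ.m-n≡m⊖n s (lookup a c)))))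
  ... | no a_c≰s = trans (cong (_* xPlacementsᵖ (zip cs (map pred l)) (drop (suc k) βs) (s ∸ lookup a c + sum (take (suc k) βs)) a) (binom-< (≰⇒> a_c≰s)))
    (sym (cong (_* xChain (map (lookup a) cs) l (drop (suc k) βs) (+ s ℤ.- + lookup a c ℤ.+ + sum (take (suc k) βs)))
               (trans (binomℤ-+ s (lookup a c)) (binom-< (≰⇒> a_c≰s)))))

  binomℤ-∸ : ∀ a t → binomℤ (+ a ℤ.- + t) (+ a) ≡ 𝟙=0 t
  binomℤ-∸ a zero = trans (cong (λ z → binomℤ z (+ a)) (ℤₚ.+-identityʳ (+ a))) (trans (binomℤ-+ a a) (binom-diag a))
  binomℤ-∸ a (suc t) with suc t ≤? a
  ... | yes 1+t≤a = trans (cong (λ z → binomℤ z (+ a)) (trans (ℤₚ.m-n≡m⊖n a (suc t)) (ℤₚ.⊖-≥ 1+t≤a)))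
                          (trans (binomℤ-+ (a ∸ suc t) a) (binom-< (∸-monoʳ-< {o = 0} (s≤s z≤n) 1+t≤a)))
  ... | no 1+t≰a = trans (cong (λ z → binomℤ z (+ a)) (trans (ℤₚ.m-n≡m⊖n a (suc t)) (ℤₚ.⊖-< (≰⇒> 1+t≰a))))
                         (negative (suc t ∸ a) (m>n⇒m∸n≢0 (≰⇒> 1+t≰a)))
    where
    negative : ∀ k → k ≢ 0 → binomℤ (ℤ.- (+ k)) (+ a) ≡ 0
    negative zero k≢0 = ⊥-elim (k≢0 refl)
    negative (suc k) _ = refl

  -- The product aFactor · δFactor, as a recursion over the factors in order of first occurrence;
  -- d counts the x's passed minus those already attributed.
  aChain : ℤ → List ℕ → List ℕ → List ℕ → ℕ
  aChain d (a₁ ∷ []) (k ∷ []) αs = δprod (drop 1 αs)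
  aChain d (a₁ ∷ a₂ ∷ as) (k ∷ ls) αs = binomℤ (d ℤ.+ + head₀ αs) (+ a₁) * aChain (d ℤ.+ + sum (take k αs) ℤ.- + a₁) (a₂ ∷ as) ls (drop k αs)
  aChain _ _ _ _ = 1

  xChain-last : ∀ d a₁ k αs → d ℤ.+ + sum αs ≡ + a₁ → length αs ≡ k →
    xChain (a₁ ∷ []) (k ∷ []) (drop 1 αs) (d ℤ.+ + head₀ αs) ≡ δprod (drop 1 αs)
  xChain-last d a₁ k αs sum≡ len≡ = begin
    binomℤ D (+ a₁) * 𝟙=0ℤ (D ℤ.- + a₁ ℤ.+ + sum (take k (drop 1 αs)))
      ≡⟨ cong (λ z → binomℤ D (+ a₁) * 𝟙=0ℤ (D ℤ.- + a₁ ℤ.+ + sum z)) (Listₚ.take-all k (drop 1 αs) short) ⟩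
    binomℤ D (+ a₁) * 𝟙=0ℤ (D ℤ.- + a₁ ℤ.+ + sum (drop 1 αs))
      ≡⟨ cong (λ z → binomℤ D (+ a₁) * 𝟙=0ℤ z) nothing-pending ⟩
    binomℤ D (+ a₁) * 1
      ≡⟨ *-identityʳ _ ⟩
    binomℤ D (+ a₁)
      ≡⟨ cong (λ z → binomℤ z (+ a₁)) D≡ ⟩
    binomℤ (+ a₁ ℤ.- + sum (drop 1 αs)) (+ a₁)
      ≡⟨ binomℤ-∸ a₁ (sum (drop 1 αs)) ⟩
    𝟙=0 (sum (drop 1 αs))
      ≡⟨ δprod≡𝟙=0 (drop 1 αs) ⟨
    δprod (drop 1 αs) ∎
    where
    D = d ℤ.+ + head₀ αs
    short : k ≥ length (drop 1 αs)
    short = subst (_≤ k) (sym (trans (Listₚ.length-drop 1 αs) (cong (_∸ 1) len≡))) (m∸n≤m k 1)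
    total : D ℤ.+ + sum (drop 1 αs) ≡ + a₁
    total = trans (ℤₚ.+-assoc d _ _) (trans (cong (λ z → d ℤ.+ z) (sym (trans (cong +_ (sum-head₀-drop αs)) (ℤₚ.pos-+ (head₀ αs) _)))) sum≡)
    nothing-pending : D ℤ.- + a₁ ℤ.+ + sum (drop 1 αs) ≡ + 0
    nothing-pending = trans (swap D (+ a₁) (+ sum (drop 1 αs))) (trans (cong (ℤ._- + a₁) total) (ℤₚ.+-inverseʳ (+ a₁)))
      where
      swap : ∀ p q t → p ℤ.- q ℤ.+ t ≡ (p ℤ.+ t) ℤ.- q
      swap = solve-∀ℤ
    D≡ : D ≡ + a₁ ℤ.- + sum (drop 1 αs)
    D≡ = trans (add-sub D (+ sum (drop 1 αs))) (cong (ℤ._- + sum (drop 1 αs)) total)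
      where
      add-sub : ∀ p t → p ≡ (p ℤ.+ t) ℤ.- t
      add-sub = solve-∀ℤ

  xChain≡aChain : ∀ d as ls αs → length as ≡ length ls → 1 ≤ length as → d ℤ.+ + sum αs ≡ + sum as → length αs ≡ sum ls →
    xChain as ls (drop 1 αs) (d ℤ.+ + head₀ αs) ≡ aChain d as ls αs
  xChain≡aChain d (a₁ ∷ []) (k ∷ []) αs _ _ sum≡ len≡ = xChain-last d a₁ k αs (trans sum≡ (cong +_ (+-identityʳ a₁))) (trans len≡ (+-identityʳ k))
  xChain≡aChain d (a₁ ∷ a₂ ∷ as) (k ∷ ls) αs len-as _ sum≡ len≡ = cong (binomℤ (d ℤ.+ + head₀ αs) (+ a₁) *_) (begin
    xChain (a₂ ∷ as) ls (drop k (drop 1 αs)) ((d ℤ.+ + head₀ αs) ℤ.- + a₁ ℤ.+ + sum (take k (drop 1 αs)))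
      ≡⟨ cong₂ (xChain (a₂ ∷ as) ls) (drop-comm k αs) pending≡ ⟩
    xChain (a₂ ∷ as) ls (drop 1 (drop k αs)) (d′ ℤ.+ + head₀ (drop k αs))
      ≡⟨ xChain≡aChain d′ (a₂ ∷ as) ls (drop k αs) (suc-injective len-as) (s≤s z≤n) sum≡′ len≡′ ⟩
    aChain d′ (a₂ ∷ as) ls (drop k αs) ∎)
    where
    d′ = d ℤ.+ + sum (take k αs) ℤ.- + a₁
    pending≡ : (d ℤ.+ + head₀ αs) ℤ.- + a₁ ℤ.+ + sum (take k (drop 1 αs)) ≡ d′ ℤ.+ + head₀ (drop k αs)
    pending≡ = trans (regroup₁ d (+ head₀ αs) (+ a₁) (+ sum (take k (drop 1 αs))))
      (trans (cong (λ z → d ℤ.+ z ℤ.- + a₁) (trans (sym (ℤₚ.pos-+ (head₀ αs) _)) (trans (cong +_ (sum-take-shift k αs)) (ℤₚ.pos-+ (sum (take k αs)) _))))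
             (regroup₂ d (+ sum (take k αs)) (+ head₀ (drop k αs)) (+ a₁)))
      where
      regroup₁ : ∀ p q t u → (p ℤ.+ q) ℤ.- t ℤ.+ u ≡ p ℤ.+ (q ℤ.+ u) ℤ.- t
      regroup₁ = solve-∀ℤ
      regroup₂ : ∀ p q t u → p ℤ.+ (q ℤ.+ t) ℤ.- u ≡ p ℤ.+ q ℤ.- u ℤ.+ t
      regroup₂ = solve-∀ℤ
    sum≡′ : d′ ℤ.+ + sum (drop k αs) ≡ + sum (a₂ ∷ as)
    sum≡′ = begin
      d ℤ.+ + sum (take k αs) ℤ.- + a₁ ℤ.+ + sum (drop k αs)
        ≡⟨ regroup d (+ sum (take k αs)) (+ a₁) (+ sum (drop k αs)) ⟩
      d ℤ.+ (+ sum (take k αs) ℤ.+ + sum (drop k αs)) ℤ.- + a₁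
        ≡⟨ cong (λ z → d ℤ.+ z ℤ.- + a₁) (trans (sym (ℤₚ.pos-+ (sum (take k αs)) _)) (cong +_ (sum-take-drop k αs))) ⟩
      d ℤ.+ + sum αs ℤ.- + a₁
        ≡⟨ cong (ℤ._- + a₁) (trans sum≡ (ℤₚ.pos-+ a₁ (sum (a₂ ∷ as)))) ⟩
      + a₁ ℤ.+ + sum (a₂ ∷ as) ℤ.- + a₁
        ≡⟨ cancel (+ a₁) (+ sum (a₂ ∷ as)) ⟩
      + sum (a₂ ∷ as) ∎
      where
      regroup : ∀ p q t u → p ℤ.+ q ℤ.- t ℤ.+ u ≡ p ℤ.+ (q ℤ.+ u) ℤ.- t
      regroup = solve-∀ℤ
      cancel : ∀ p q → p ℤ.+ q ℤ.- p ≡ q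
      cancel = solve-∀ℤ
    len≡′ : length (drop k αs) ≡ sum ls
    len≡′ = trans (Listₚ.length-drop k αs) (trans (cong (_∸ k) len≡) (m+n∸m≡n k (sum ls)))

  -- aFactor, with the integer offset d added to each binomial's upper argument.
  aProduct : ℤ → List ℕ → List ℕ → List ℕ → ℕ → ℕ
  aProduct d as ls αs m = product (applyUpTo (λ j → binomℤ (d ℤ.+ (+ sum (take (Lsum ls j + 1) αs) ℤ.- + sum (take j as))) (+ at as j)) m)

  aFactor≡aProduct : ∀ m as ls αs → aFactor (suc m) as ls αs ≡ aProduct 0ℤ as ls αs m
  aFactor≡aProduct m as ls αs = cong product (trans (cong (map F) (map-applyUpTo suc (λ k → k) m))
    (trans (map-applyUpTo F suc m) (applyUpTo-cong m (λ j → cong (λ z → binomℤ z (+ at as j)) (sym (ℤₚ.+-identityˡ (+ sum (take (Lsum ls j + 1) αs) ℤ.- + sum (take j as))))))))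
    where
    F : ℕ → ℕ
    F j = binomℤ (+ sum (take (Lsum ls (j ∸ 1) + 1) αs) ℤ.- + sum (take (j ∸ 1) as)) (+ at as (j ∸ 1))

  aProduct≡aChain : ∀ m d as ls αs → length as ≡ suc m → length ls ≡ suc m →
    aProduct d as ls αs m * δprod (drop (Lsum ls m + 1) αs) ≡ aChain d as ls αs
  aProduct≡aChain zero d (a₁ ∷ []) (k ∷ []) αs _ _ = +-identityʳ _
  aProduct≡aChain (suc m) d (a₁ ∷ a₂ ∷ as) (k ∷ ls) αs len-as len-ls = begin
    F 0 * product (applyUpTo (F ∘ suc) m) * δprod (drop (Lsum (k ∷ ls) (suc m) + 1) αs)
      ≡⟨ *-assoc (F 0) _ _ ⟩
    F 0 * (product (applyUpTo (F ∘ suc) m) * δprod (drop (Lsum (k ∷ ls) (suc m) + 1) αs))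
      ≡⟨ cong₂ (λ u v → u * (product v * δprod (drop (Lsum (k ∷ ls) (suc m) + 1) αs))) first (applyUpTo-cong m shifted) ⟩
    binomℤ (d ℤ.+ + head₀ αs) (+ a₁) * (aProduct d′ (a₂ ∷ as) ls (drop k αs) m * δprod (drop (Lsum (k ∷ ls) (suc m) + 1) αs))
      ≡⟨ cong (λ z → binomℤ (d ℤ.+ + head₀ αs) (+ a₁) * (aProduct d′ (a₂ ∷ as) ls (drop k αs) m * δprod z)) tail-dropped ⟩
    binomℤ (d ℤ.+ + head₀ αs) (+ a₁) * (aProduct d′ (a₂ ∷ as) ls (drop k αs) m * δprod (drop (Lsum ls m + 1) (drop k αs)))
      ≡⟨ cong (binomℤ (d ℤ.+ + head₀ αs) (+ a₁) *_) (aProduct≡aChain m d′ (a₂ ∷ as) ls (drop k αs) (suc-injective len-as) (suc-injective len-ls)) ⟩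
    aChain d (a₁ ∷ a₂ ∷ as) (k ∷ ls) αs ∎
    where
    d′ = d ℤ.+ + sum (take k αs) ℤ.- + a₁
    F : ℕ → ℕ
    F j = binomℤ (d ℤ.+ (+ sum (take (Lsum (k ∷ ls) j + 1) αs) ℤ.- + sum (take j (a₁ ∷ a₂ ∷ as)))) (+ at (a₁ ∷ a₂ ∷ as) j)
    sum-take-1 : ∀ (αs : List ℕ) → sum (take 1 αs) ≡ head₀ αs
    sum-take-1 [] = refl
    sum-take-1 (α ∷ _) = +-identityʳ α
    first : F 0 ≡ binomℤ (d ℤ.+ + head₀ αs) (+ a₁)
    first = cong (λ z → binomℤ z (+ a₁)) (trans (cong (λ z → d ℤ.+ z) (ℤₚ.+-identityʳ _)) (cong (λ z → d ℤ.+ + z) (sum-take-1 αs)))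
    shifted : ∀ j → F (suc j) ≡ binomℤ (d′ ℤ.+ (+ sum (take (Lsum ls j + 1) (drop k αs)) ℤ.- + sum (take j (a₂ ∷ as)))) (+ at (a₂ ∷ as) j)
    shifted j = cong (λ z → binomℤ z (+ at (a₂ ∷ as) j)) (begin
      d ℤ.+ (+ sum (take (k + Lsum ls j + 1) αs) ℤ.- + (a₁ + sum (take j (a₂ ∷ as))))
        ≡⟨ cong (λ z → d ℤ.+ (+ sum (take z αs) ℤ.- + (a₁ + sum (take j (a₂ ∷ as))))) (+-assoc k (Lsum ls j) 1) ⟩
      d ℤ.+ (+ sum (take (k + (Lsum ls j + 1)) αs) ℤ.- + (a₁ + sum (take j (a₂ ∷ as))))
        ≡⟨ cong₂ (λ u v → d ℤ.+ (u ℤ.- v))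
                 (trans (cong +_ (sum-take-+ k (Lsum ls j + 1) αs)) (ℤₚ.pos-+ (sum (take k αs)) _))
                 (ℤₚ.pos-+ a₁ (sum (take j (a₂ ∷ as)))) ⟩
      d ℤ.+ ((+ sum (take k αs) ℤ.+ + sum (take (Lsum ls j + 1) (drop k αs))) ℤ.- (+ a₁ ℤ.+ + sum (take j (a₂ ∷ as))))
        ≡⟨ regroup d (+ sum (take k αs)) (+ sum (take (Lsum ls j + 1) (drop k αs))) (+ a₁) (+ sum (take j (a₂ ∷ as))) ⟩
      d′ ℤ.+ (+ sum (take (Lsum ls j + 1) (drop k αs)) ℤ.- + sum (take j (a₂ ∷ as))) ∎)
      where
      regroup : ∀ p q t u v → p ℤ.+ ((q ℤ.+ t) ℤ.- (u ℤ.+ v)) ≡ p ℤ.+ q ℤ.- u ℤ.+ (t ℤ.- v)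
      regroup = solve-∀ℤ
    tail-dropped : drop (Lsum (k ∷ ls) (suc m) + 1) αs ≡ drop (Lsum ls m + 1) (drop k αs)
    tail-dropped = trans (cong (λ z → drop z αs) (+-assoc k (Lsum ls m) 1)) (sym (Listₚ.drop-drop k (Lsum ls m + 1) αs))

  xPlacementsᵖ≡aFactor : ∀ {n} (a : Vec ℕ n) (σ : Vec (Fin n) n) (l α : List ℕ) → 0 < n → All (1 ≤_) l → length l ≡ n →
    length α ≡ sum l → sum α ≡ Σᵛ a → distinctF (Vec.toList σ) ≡ true →
    xPlacementsᵖ (profileOf σ l) (drop 1 α) (head₀ α) a ≡ aFactor n (permute σ a) l α * δFactor n l α
  xPlacementsᵖ≡aFactor {suc m} a σ l α _ l≥1 len-l len-α sum-α σ-distinct = begin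
    xPlacementsᵖ (zip cs (map pred l)) (drop 1 α) (head₀ α) a
      ≡⟨ xPlacementsᵖ-profileOf a cs l (drop 1 α) (head₀ α) (trans (Vecₚ.length-toList σ) (sym len-l)) l≥1 ⟩
    xChain as l (drop 1 α) (+ head₀ α)
      ≡⟨ cong (xChain as l (drop 1 α)) (sym (ℤₚ.+-identityˡ (+ head₀ α))) ⟩
    xChain as l (drop 1 α) (0ℤ ℤ.+ + head₀ α)
      ≡⟨ xChain≡aChain 0ℤ as l α (trans len-as (sym len-l)) (subst (1 ≤_) (sym len-as) (s≤s z≤n)) sum≡ len-α ⟩
    aChain 0ℤ as l α
      ≡⟨ aProduct≡aChain m 0ℤ as l α len-as len-l ⟨
    aProduct 0ℤ as l α m * δprod (drop (Lsum l m + 1) α)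
      ≡⟨ cong (_* δprod (drop (Lsum l m + 1) α)) (aFactor≡aProduct m as l α) ⟨
    aFactor (suc m) as l α * δFactor (suc m) l α
      ≡⟨ cong (λ as′ → aFactor (suc m) as′ l α * δFactor (suc m) l α) (permute≡map σ a) ⟨
    aFactor (suc m) (permute σ a) l α * δFactor (suc m) l α ∎
    where
    cs = Vec.toList σ
    as = map (lookup a) cs
    len-as : length as ≡ suc m
    len-as = trans (Listₚ.length-map (lookup a) cs) (Vecₚ.length-toList σ)
    sum≡ : 0ℤ ℤ.+ + sum α ≡ + sum as
    sum≡ = trans (ℤₚ.+-identityˡ _) (cong +_ (trans sum-α (sym (trans (cong sum (sym (permute≡map σ a))) (Σᵛ-permute σ a σ-distinct)))))

-- The coefficients

multiplicity≡coeffC : ∀ {n} (r a : Vec ℕ n) (α : List ℕ) → 0 < n → (∀ i → 1 ≤ lookup r i) →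
  length α ≡ Σᵛ r → sum α ≡ Σᵛ a → multiplicity (factors a r) (xyWord α) ≡ coeffC n r a α
multiplicity≡coeffC {n} r a α n>0 r≥1 len-α sum-α = begin
  multiplicity (factors a r) (xyWord α)
    ≡⟨ multiplicity-xyWord α a r admissible len-α sum-α ⟩
  ∑-arrangements (length α) r (λ cy → xPlacements cy (drop 1 α) (head₀ α) a)
    ≡⟨ cong (λ R′ → ∑-arrangements R′ r (λ cy → xPlacements cy (drop 1 α) (head₀ α) a)) len-α ⟩
  ∑-arrangements R r (λ cy → xPlacements cy (drop 1 α) (head₀ α) a)
    ≡⟨ ∑-arrangements-cong R r (λ cy _ _ → xPlacements≡xPlacementsᵖ cy (drop 1 α) (head₀ α) a) ⟩
  ∑-arrangements R r (λ cy → H (profile cy))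
    ≡⟨ ∑-arrangements-by-profile R r H r≥1 ⟩
  ∑ (λ l → ∑ (λ σ → ∑-arrangements R r (λ cy → δᵖ (profile cy) (profileOf σ l)) * H (profileOf σ l)) (Sym n)) (pcomp n R)
    ≡⟨ ∑-cong-∈ (pcomp n R) (λ l l∈ → ∑-cong-∈ (Sym n) (λ σ σ∈ → term l σ (∈-pcomp⁻ n R l l∈) (Distinct⇒distinctF (Vec.toList σ) (∈-Sym⁻ σ σ∈)))) ⟩
  ∑ (λ l → ∑ (λ σ → rFactor n (permute σ r) l * (aFactor n (permute σ a) l α * δFactor n l α)) (Sym n)) (pcomp n R)
    ≡⟨ ∑-cong (pcomp n R) (λ l → trans (∑-cong (Sym n) (λ σ → sym (*-assoc (rFactor n (permute σ r) l) _ _))) (∑-*ʳ (δFactor n l α) _ (Sym n))) ⟩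
  ∑ (λ l → ∑ (λ σ → rFactor n (permute σ r) l * aFactor n (permute σ a) l α) (Sym n) * δFactor n l α) (pcomp n R)
    ≡⟨ trans (sum-map _ (pcomp n R)) (∑-cong (pcomp n R) (λ l → cong (_* δFactor n l α) (sum-map _ (Sym n)))) ⟨
  coeffC n r a α ∎
  where
  R = Σᵛ r
  H : Profile n → ℕ
  H es = xPlacementsᵖ es (drop 1 α) (head₀ α) a
  admissible : Admissible a r
  admissible i r_i≡0 with () ← subst (1 ≤_) r_i≡0 (r≥1 i)
  term : ∀ l σ → length l ≡ n × sum l ≡ R × All (1 ≤_) l → distinctF (Vec.toList σ) ≡ true →
    ∑-arrangements R r (λ cy → δᵖ (profile cy) (profileOf σ l)) * H (profileOf σ l) ≡
    rFactor n (permute σ r) l * (aFactor n (permute σ a) l α * δFactor n l α)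
  term l σ (len-l , sum-l , l≥1) σ-distinct = cong₂ _*_
    (trans (∑-arrangements-profile R r (profileOf σ l) (ValidProfile-profileOf r σ l r≥1 l≥1 len-l sum-l (distinctF⇒Distinct (Vec.toList σ) σ-distinct)))
           (profileCount≡rFactor r σ l n>0 r≥1 l≥1 len-l sum-l σ-distinct))
    (xPlacementsᵖ≡aFactor a σ l α n>0 l≥1 len-l (trans len-α (sym sum-l)) sum-α σ-distinct)

𝟙-[] : Word → ℕ
𝟙-[] [] = 1
𝟙-[] (_ ∷ _) = 0

multiplicity-[]-shW : ∀ u v → ∑ (λ w → δʷ w []) (shW u v) ≡ 𝟙-[] u * δʷ v []
multiplicity-[]-shW [] v = refl
multiplicity-[]-shW (c ∷ u) [] = refl
multiplicity-[]-shW (c ∷ u) (d ∷ v) = trans (∑-++ (λ w → δʷ w []) (map (c ∷_) (shW u (d ∷ v))) (map (d ∷_) (shW (c ∷ u) v)))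
  (cong₂ _+_ (trans (∑-map (λ w → δʷ w []) (c ∷_) (shW u (d ∷ v))) (∑-zero (shW u (d ∷ v))))
             (trans (∑-map (λ w → δʷ w []) (d ∷_) (shW (c ∷ u) v)) (∑-zero (shW (c ∷ u) v))))

multiplicity-[]-∷ : ∀ u us → multiplicity (u ∷ us) [] ≡ 𝟙-[] u * multiplicity us []
multiplicity-[]-∷ u us = trans (∑-concatMap (λ w → δʷ w []) (shW u) (shuffles us))
  (trans (∑-cong (shuffles us) (multiplicity-[]-shW u)) (∑-*ˡ (𝟙-[] u) (λ v → δʷ v []) (shuffles us)))

multiplicity-[] : ∀ {n} (a r : Vec ℕ n) i → 1 ≤ lookup r i → multiplicity (factors a r) [] ≡ 0
multiplicity-[] (a₀ ∷ a) (suc r₀ ∷ r) zero _ = trans (multiplicity-[]-∷ (xpow a₀ ++ ypow (suc r₀)) (factors a r)) (cong (_* multiplicity (factors a r) []) (nonempty a₀))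
  where
  nonempty : ∀ a₀ → 𝟙-[] (xpow a₀ ++ ypow (suc r₀)) ≡ 0
  nonempty zero = refl
  nonempty (suc a₀) = refl
multiplicity-[] (a₀ ∷ a) (r₀ ∷ r) (suc i) r_i≥1 = trans (multiplicity-[]-∷ (xpow a₀ ++ ypow r₀) (factors a r))
  (trans (cong (𝟙-[] (xpow a₀ ++ ypow r₀) *_) (multiplicity-[] a r i r_i≥1)) (*-zeroʳ (𝟙-[] (xpow a₀ ++ ypow r₀))))

xyWord-∷-++ : ∀ k β w → xyWord (k ∷ β) ++ w ≡ xpow k ++ y ∷ (xyWord β ++ w)
xyWord-∷-++ k β w = trans (Listₚ.++-assoc (xpow k ++ [ y ]) (xyWord β) w) (Listₚ.++-assoc (xpow k) [ y ] (xyWord β ++ w))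

-- Every factor ends with y or is empty, and every shuffle of the factors is nonempty.
mutual
  multiplicity-x-last : ∀ {n} β t (a r : Vec ℕ n) → Admissible a r → multiplicity (factors a r) (xyWord β ++ xpow (suc t)) ≡ 0
  multiplicity-x-last {n} [] t a r adm = begin
    multiplicity (factors a r) (x ∷ xpow t)
      ≡⟨ multiplicity-∷ x _ (factors a r) ⟩
    ∑ (λ vs → multiplicity vs (xpow t)) (derivatives x (factors a r))
      ≡⟨ ∑-derivatives-x a r _ ⟩
    ∑[ i < n ] (𝟙>0 (lookup a i) * multiplicity (factors (decAt a i) r) (xpow t))
      ≡⟨ sum-cong-≗ (λ i → 𝟙>0-vanish (lookup a i) (remaining t i)) ⟩
    ∑[ i < n ] 0
      ≡⟨ ∑ᶠ-zero n ⟩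
    0 ∎
    where
    remaining : ∀ t i → 1 ≤ lookup a i → multiplicity (factors (decAt a i) r) (xpow t) ≡ 0
    remaining zero i a_i≥1 = multiplicity-[] (decAt a i) r i (Admissible-≥1 a r i adm a_i≥1)
    remaining (suc t) i _ = multiplicity-x-last [] t (decAt a i) r (Admissible-decAtˡ a r i adm)
  multiplicity-x-last (k ∷ β) t a r adm = trans (cong (multiplicity (factors a r)) (xyWord-∷-++ k β (xpow (suc t)))) (multiplicity-x^k-y-x-last k β t a r adm)

  multiplicity-x^k-y-x-last : ∀ {n} k β t (a r : Vec ℕ n) → Admissible a r → multiplicity (factors a r) (xpow k ++ y ∷ (xyWord β ++ xpow (suc t))) ≡ 0
  multiplicity-x^k-y-x-last {n} zero β t a r adm =
    trans (multiplicity-∷ y _ (factors a r)) (trans (∑-derivatives-y a r _) (trans (sum-cong-≗ (λ i → 𝟙=0-vanish (lookup a i) (λ a_i≡0 →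
      trans (cong (𝟙>0 (lookup r i) *_) (multiplicity-x-last β t a (decAt r i) (Admissible-decAtʳ a r i a_i≡0 adm))) (*-zeroʳ (𝟙>0 (lookup r i)))))) (∑ᶠ-zero n)))
  multiplicity-x^k-y-x-last {n} (suc k) β t a r adm =
    trans (multiplicity-∷ x _ (factors a r)) (trans (∑-derivatives-x a r _) (trans (sum-cong-≗ (λ i → 𝟙>0-vanish (lookup a i) (λ _ →
      multiplicity-x^k-y-x-last k β t (decAt a i) r (Admissible-decAtˡ a r i adm)))) (∑ᶠ-zero n)))

-- The shuffles have length Σ r + Σ a and contain Σ r letters y.
mutual
  multiplicity-xyWord-mismatch : ∀ {n} β (a r : Vec ℕ n) → Admissible a r → (length β ≢ Σᵛ r ⊎ sum β ≢ Σᵛ a) →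
    multiplicity (factors a r) (xyWord β) ≡ 0
  multiplicity-xyWord-mismatch [] a r adm (inj₁ R≢0) with Σᵛ≢0⇒∃≥1 r (R≢0 ∘ sym)
  ... | i , r_i≥1 = multiplicity-[] a r i r_i≥1
  multiplicity-xyWord-mismatch [] a r adm (inj₂ A≢0) with Σᵛ≢0⇒∃≥1 a (A≢0 ∘ sym)
  ... | i , a_i≥1 = multiplicity-[] a r i (Admissible-≥1 a r i adm a_i≥1)
  multiplicity-xyWord-mismatch (k ∷ β) a r adm mismatch =
    trans (cong (multiplicity (factors a r)) (trans (sym (Listₚ.++-identityʳ (xyWord (k ∷ β))))
      (trans (xyWord-∷-++ k β []) (cong (λ w → xpow k ++ y ∷ w) (Listₚ.++-identityʳ (xyWord β))))))
      (multiplicity-x^k-y-mismatch k β a r adm mismatch)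

  multiplicity-x^k-y-mismatch : ∀ {n} k β (a r : Vec ℕ n) → Admissible a r → (length (k ∷ β) ≢ Σᵛ r ⊎ sum (k ∷ β) ≢ Σᵛ a) →
    multiplicity (factors a r) (xpow k ++ y ∷ xyWord β) ≡ 0
  multiplicity-x^k-y-mismatch {n} zero β a r adm mismatch =
    trans (multiplicity-∷ y _ (factors a r)) (trans (∑-derivatives-y a r _) (trans (sum-cong-≗ (λ i → 𝟙=0-vanish (lookup a i) (λ a_i≡0 →
      𝟙>0-vanish (lookup r i) (λ r_i≥1 → multiplicity-xyWord-mismatch β a (decAt r i) (Admissible-decAtʳ a r i a_i≡0 adm) (shorter i r_i≥1))))) (∑ᶠ-zero n)))
    where
    shorter : ∀ i → 1 ≤ lookup r i → length β ≢ Σᵛ (decAt r i) ⊎ sum β ≢ Σᵛ a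
    shorter i r_i≥1 = [ (λ ne → inj₁ (λ eq → ne (trans (cong suc eq) (Σᵛ-decAt r i r_i≥1)))) , inj₂ ]′ mismatch
  multiplicity-x^k-y-mismatch {n} (suc k) β a r adm mismatch =
    trans (multiplicity-∷ x _ (factors a r)) (trans (∑-derivatives-x a r _) (trans (sum-cong-≗ (λ i → 𝟙>0-vanish (lookup a i) (λ a_i≥1 →
      multiplicity-x^k-y-mismatch k β (decAt a i) r (Admissible-decAtˡ a r i adm) (fewer i a_i≥1)))) (∑ᶠ-zero n)))
    where
    fewer : ∀ i → 1 ≤ lookup a i → length (k ∷ β) ≢ Σᵛ r ⊎ sum (k ∷ β) ≢ Σᵛ (decAt a i)
    fewer i a_i≥1 = [ inj₁ , (λ ne → inj₂ (λ eq → ne (trans (cong suc eq) (Σᵛ-decAt a i a_i≥1)))) ]′ mismatch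

-- Every word is x^{β₁} y ⋯ x^{β_k} y x^t for exactly one (β , t).
addX : List ℕ × ℕ → List ℕ × ℕ
addX ([] , t) = ([] , suc t)
addX (b ∷ bs , t) = (suc b ∷ bs , t)

splitXY : Word → List ℕ × ℕ
splitXY [] = ([] , 0)
splitXY (y ∷ w) = (0 ∷ proj₁ (splitXY w) , proj₂ (splitXY w))
splitXY (x ∷ w) = addX (splitXY w)

joinXY : List ℕ × ℕ → Word
joinXY (β , t) = xyWord β ++ xpow t

joinXY-splitXY : ∀ w → joinXY (splitXY w) ≡ w
joinXY-splitXY [] = refl
joinXY-splitXY (y ∷ w) = cong (y ∷_) (joinXY-splitXY w)
joinXY-splitXY (x ∷ w) with splitXY w | joinXY-splitXY w
... | [] , t | eq = cong (x ∷_) eq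
... | b ∷ bs , t | eq = cong (x ∷_) eq

splitXY-x^k-y : ∀ k w → splitXY (xpow k ++ y ∷ w) ≡ (k ∷ proj₁ (splitXY w) , proj₂ (splitXY w))
splitXY-x^k-y zero w = refl
splitXY-x^k-y (suc k) w = cong addX (splitXY-x^k-y k w)

splitXY-joinXY : ∀ β t → splitXY (joinXY (β , t)) ≡ (β , t)
splitXY-joinXY [] zero = refl
splitXY-joinXY [] (suc t) = cong addX (splitXY-joinXY [] t)
splitXY-joinXY (k ∷ β) t = trans (cong splitXY (xyWord-∷-++ k β (xpow t)))
  (trans (splitXY-x^k-y k (xyWord β ++ xpow t)) (cong (λ p → (k ∷ proj₁ p , proj₂ p)) (splitXY-joinXY β t)))

δʷ-xyWord : ∀ α β t → δʷ (xyWord α) (xyWord β ++ xpow t) ≡ δⁿˡ α β * 𝟙=0 t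
δʷ-xyWord α β t with xyWord α ≟W (xyWord β ++ xpow t)
... | yes eq = sym (same (trans (sym (splitXY-joinXY α 0)) (trans (cong splitXY (trans (Listₚ.++-identityʳ (xyWord α)) eq)) (splitXY-joinXY β t))))
  where
  same : ∀ {α′ t′} → (α′ , 0) ≡ (β , t′) → δⁿˡ α′ β * 𝟙=0 t′ ≡ 1
  same refl = cong (_* 1) (δⁿˡ-refl β)
... | no ne with α ≟ⁿˡ β
...   | no _ = refl
...   | yes refl with t
...     | zero = ⊥-elim (ne (sym (Listₚ.++-identityʳ (xyWord α))))
...     | suc _ = refl

∑-wcomp-pick : ∀ k s β (f : List ℕ → ℕ) → length β ≡ k → sum β ≡ s → ∑ (λ α → δⁿˡ α β * f α) (wcomp k s) ≡ f β
∑-wcomp-pick k s β f len≡ sum≡ = trans (∑-δⁿˡ f β (wcomp k s)) (trans (cong (_* f β) (∑-wcomp-δ k s β len≡ sum≡)) (*-identityˡ (f β)))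

∑-wcomp-none : ∀ k s β (f : List ℕ → ℕ) → (length β ≢ k ⊎ sum β ≢ s) → ∑ (λ α → δⁿˡ α β * f α) (wcomp k s) ≡ 0
∑-wcomp-none k s β f mismatch = trans (∑-cong-∈ (wcomp k s) (λ α α∈ → cong (_* f α) (δⁿˡ-≢ {α} {β} (λ α≡β → absurd α≡β (∈-wcomp⁻ k s α α∈))))) (∑-zero (wcomp k s))
  where
  absurd : ∀ {α} → α ≡ β → length α ≡ k × sum α ≡ s → ⊥
  absurd refl (len≡ , sum≡) = [ (λ ne → ne len≡) , (λ ne → ne sum≡) ]′ mismatch

multiplicity≡∑coeffC : ∀ {n} (r a : Vec ℕ n) → 0 < n → (∀ i → 1 ≤ lookup r i) → ∀ w →
  multiplicity (factors a r) w ≡ ∑ (λ α → δʷ (xyWord α) w * coeffC n r a α) (wcomp (Σᵛ r) (Σᵛ a))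
multiplicity≡∑coeffC {n} r a n>0 r≥1 w with splitXY w | joinXY-splitXY w
... | β , t | refl = trans (by-trailing-xs t) (sym (∑-cong (wcomp (Σᵛ r) (Σᵛ a)) (λ α → cong (_* coeffC n r a α) (δʷ-xyWord α β t))))
  where
  admissible : Admissible a r
  admissible i r_i≡0 with () ← subst (1 ≤_) r_i≡0 (r≥1 i)
  picked : multiplicity (factors a r) (xyWord β) ≡ ∑ (λ α → δⁿˡ α β * coeffC n r a α) (wcomp (Σᵛ r) (Σᵛ a))
  picked with length β ℕ.≟ Σᵛ r | sum β ℕ.≟ Σᵛ a
  ... | yes len≡ | yes sum≡ = trans (multiplicity≡coeffC r a β n>0 r≥1 len≡ sum≡) (sym (∑-wcomp-pick (Σᵛ r) (Σᵛ a) β (coeffC n r a) len≡ sum≡))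
  ... | no len≢ | _ = trans (multiplicity-xyWord-mismatch β a r admissible (inj₁ len≢)) (sym (∑-wcomp-none (Σᵛ r) (Σᵛ a) β (coeffC n r a) (inj₁ len≢)))
  ... | yes _ | no sum≢ = trans (multiplicity-xyWord-mismatch β a r admissible (inj₂ sum≢)) (sym (∑-wcomp-none (Σᵛ r) (Σᵛ a) β (coeffC n r a) (inj₂ sum≢)))
  by-trailing-xs : ∀ t → multiplicity (factors a r) (xyWord β ++ xpow t) ≡ ∑ (λ α → δⁿˡ α β * 𝟙=0 t * coeffC n r a α) (wcomp (Σᵛ r) (Σᵛ a))
  by-trailing-xs zero = trans (cong (multiplicity (factors a r)) (Listₚ.++-identityʳ (xyWord β)))
    (trans picked (sym (∑-cong (wcomp (Σᵛ r) (Σᵛ a)) (λ α → cong (_* coeffC n r a α) (*-identityʳ (δⁿˡ α β))))))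
  by-trailing-xs (suc t) = trans (multiplicity-x-last β t a r admissible)
    (sym (trans (∑-cong (wcomp (Σᵛ r) (Σᵛ a)) (λ α → cong (_* coeffC n r a α) (*-zeroʳ (δⁿˡ α β)))) (∑-zero (wcomp (Σᵛ r) (Σᵛ a)))))

module _ where

  open import Data.Integer as ℤ using (+_)
  import Data.Integer.Properties as ℤₚ
  open import Data.Rational as ℚ using (ℚ; 0ℚ; 1ℚ)
  import Data.Rational.Properties as ℚₚ
  open import Data.Rational.Unnormalised as ℚᵘ using (mkℚᵘ; *≡*)
  import Data.Rational.Unnormalised.Properties as ℚᵘₚ

  ⟦_⟧ : ℕ → ℚ
  ⟦ k ⟧ = + k ℚ./ 1

  ⟦suc⟧ : ∀ k → ⟦ suc k ⟧ ≡ 1ℚ ℚ.+ ⟦ k ⟧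
  ⟦suc⟧ k = ℚₚ.toℚᵘ-injective (ℚᵘₚ.≃-trans (toℚᵘ⟦ suc k ⟧) (ℚᵘₚ.≃-trans (*≡* integers)
    (ℚᵘₚ.≃-sym (ℚᵘₚ.≃-trans (ℚₚ.toℚᵘ-homo-+ 1ℚ ⟦ k ⟧) (ℚᵘₚ.+-cong {mkℚᵘ (+ 1) 0} ℚᵘₚ.≃-refl (toℚᵘ⟦ k ⟧))))))
    where
    toℚᵘ⟦_⟧ : ∀ k → ℚ.toℚᵘ ⟦ k ⟧ ℚᵘ.≃ mkℚᵘ (+ k) 0
    toℚᵘ⟦ k ⟧ = ℚₚ.toℚᵘ-fromℚᵘ (mkℚᵘ (+ k) 0)
    integers : + suc k ℤ.* (+ 1 ℤ.* + 1) ≡ (+ 1 ℤ.* + 1 ℤ.+ + k ℤ.* + 1) ℤ.* + 1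
    integers = trans (ℤₚ.*-identityʳ (+ suc k)) (sym (trans (ℤₚ.*-identityʳ _) (cong (ℤ._+_ (+ 1)) (ℤₚ.*-identityʳ (+ k)))))

  ⟦+⟧ : ∀ m k → ⟦ m + k ⟧ ≡ ⟦ m ⟧ ℚ.+ ⟦ k ⟧
  ⟦+⟧ zero k = sym (ℚₚ.+-identityˡ ⟦ k ⟧)
  ⟦+⟧ (suc m) k = trans (⟦suc⟧ (m + k)) (trans (cong (1ℚ ℚ.+_) (⟦+⟧ m k))
    (trans (sym (ℚₚ.+-assoc 1ℚ ⟦ m ⟧ ⟦ k ⟧)) (cong (ℚ._+ ⟦ k ⟧) (sym (⟦suc⟧ m)))))

  ⟦𝟙*⟧ : ∀ b k → (if b then ⟦ k ⟧ ℚ.* 1ℚ else 0ℚ) ≡ ⟦ 𝟙 b * k ⟧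
  ⟦𝟙*⟧ true k = trans (ℚₚ.*-identityʳ ⟦ k ⟧) (cong ⟦_⟧ (sym (+-identityʳ k)))
  ⟦𝟙*⟧ false k = refl

  coeff-++ : ∀ (p q : 𝔥) w → coeff (p ++ q) w ≡ coeff p w ℚ.+ coeff q w
  coeff-++ [] q w = sym (ℚₚ.+-identityˡ _)
  coeff-++ ((c , v) ∷ p) q w = trans (cong ((if does (v ≟W w) then c else 0ℚ) ℚ.+_) (coeff-++ p q w))
    (sym (ℚₚ.+-assoc (if does (v ≟W w) then c else 0ℚ) (coeff p w) (coeff q w)))

  ones : List Word → 𝔥
  ones = map (1ℚ ,_)

  coeff-ones : ∀ ws w → coeff (ones ws) w ≡ ⟦ ∑ (λ v → δʷ v w) ws ⟧
  coeff-ones [] w = refl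
  coeff-ones (v ∷ ws) w = trans (cong₂ ℚ._+_ (one (does (v ≟W w))) (coeff-ones ws w)) (sym (⟦+⟧ (δʷ v w) _))
    where
    one : ∀ b → (if b then 1ℚ else 0ℚ) ≡ ⟦ 𝟙 b ⟧
    one true = refl
    one false = refl

  word⧢ones : ∀ u ws → word u ⧢ ones ws ≡ ones (concatMap (shW u) ws)
  word⧢ones u [] = refl
  word⧢ones u (v ∷ ws) = trans (Listₚ.++-assoc (map (λ w → (1ℚ ℚ.* 1ℚ , w)) (shW u v)) _ [])
    (trans (cong₂ _++_ (cong (λ c → map (c ,_) (shW u v)) (ℚₚ.*-identityˡ 1ℚ)) (word⧢ones u ws))
           (sym (Listₚ.map-++ (1ℚ ,_) (shW u v) (concatMap (shW u) ws))))

  shuffleLHS≡ones : ∀ {n} (r a : Vec ℕ n) → shuffleLHS r a ≡ ones (shuffles (factors a r))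
  shuffleLHS≡ones [] [] = refl
  shuffleLHS≡ones (r₀ ∷ r) (a₀ ∷ a) = trans (cong (word (xpow a₀ ++ ypow r₀) ⧢_) (shuffleLHS≡ones r a))
    (word⧢ones (xpow a₀ ++ ypow r₀) (shuffles (factors a r)))

  coeff-shuffleLHS : ∀ {n} (r a : Vec ℕ n) w → coeff (shuffleLHS r a) w ≡ ⟦ multiplicity (factors a r) w ⟧
  coeff-shuffleLHS r a w = trans (cong (λ p → coeff p w) (shuffleLHS≡ones r a)) (coeff-ones (shuffles (factors a r)) w)

  coeff-shuffleRHS : ∀ {n} (r a : Vec ℕ n) w →
    coeff (shuffleRHS n r a) w ≡ ⟦ ∑ (λ α → δʷ (xyWord α) w * coeffC n r a α) (wcomp (Σᵛ r) (Σᵛ a)) ⟧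
  coeff-shuffleRHS {n} r a w = go (wcomp (Σᵛ r) (Σᵛ a))
    where
    term : List ℕ → 𝔥
    term α = (+ coeffC n r a α ℚ./ 1) · word (xyWord α)
    go : ∀ αs → coeff (Σ𝔥 (map term αs)) w ≡ ⟦ ∑ (λ α → δʷ (xyWord α) w * coeffC n r a α) αs ⟧
    go [] = refl
    go (α ∷ αs) = trans (coeff-++ (term α) (Σ𝔥 (map term αs)) w)
      (trans (cong₂ ℚ._+_ (trans (ℚₚ.+-identityʳ _) (⟦𝟙*⟧ (does (xyWord α ≟W w)) (coeffC n r a α))) (go αs))
             (sym (⟦+⟧ (δʷ (xyWord α) w * coeffC n r a α) _)))

proposition4p1 : (n : ℕ) → 0 < n → (r a : Vec ℕ n) → (∀ i → 0 < lookup r i) →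
    shuffleLHS r a ≈𝔥 shuffleRHS n r a
proposition4p1 n n>0 r a r>0 w = begin
  coeff (shuffleLHS r a) w                                    ≡⟨ coeff-shuffleLHS r a w ⟩
  ⟦ multiplicity (factors a r) w ⟧                            ≡⟨ cong ⟦_⟧ (multiplicity≡∑coeffC r a n>0 r>0 w) ⟩
  ⟦ ∑ (λ α → δʷ (xyWord α) w * coeffC n r a α) (wcomp (Σᵛ r) (Σᵛ a)) ⟧ ≡⟨ coeff-shuffleRHS r a w ⟨
  coeff (shuffleRHS n r a) w                                  ∎
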